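{- Let $a$ and $b$ be coprime positive integers. The Frobenius characteristic of the permutation $S_a$-module $\mathsf{PF}_{a,b}$ of $(a,b)$-parking functions has the following expansions in terms of complete homogeneous, power sum, and Schur symmetric functions, respectively: $$\mathsf{Frob}(\mathsf{PF}_{a,b})=\sum_{\lambda\vdash a}\frac{1}{b}\binom{b}{b-\ell(\lambda),m_1(\lambda),m_2(\lambda),\ldots,m_a(\lambda)}h_\lambda(\mathbf{x}) =\sum_{\lambda\vdash a} b^{\ell(\lambda)-1}\frac{p_\lambda(\mathbf{x})}{z_\lambda} =\sum_{\lambda\vdash a}\frac{s_\lambda(1^b)}{b}\,s_\lambda(\mathbf{x}).$$
   Context: An $(a,b)$-Dyck path is a lattice path from $(0,0)$ to $(b,a)$ consisting of $a$ unit north steps and $b$ unit east steps that stays weakly above the line $y=\frac{a}{b}x$. An $(a,b)$-parking function is an $(a,b)$-Dyck path together with a bijective labeling of its $a$ north steps by $\{1,2,\ldots,a\}$ such that the labels increase going north within each column (i.e. among north steps with the same $x$-coordinate). The symmetric group $S_a$ acts on the set of $(a,b)$-parking functions by permuting the labels and then re-sorting the labels within each column into increasing order. $\mathsf{PF}_{a,b}$ denotes both this set and the corresponding permutation $S_a$-module over $\mathbb{C}$. The Frobenius characteristic of an $S_a$-module with character $\chi$ is $\sum_{\mu\vdash a}\chi(\mu)\,p_\mu(\mathbf{x})/z_\mu$, where $\chi(\mu)$ is the value of $\chi$ on permutations of cycle type $\mu$. For a partition $\lambda$: $\ell(\lambda)$ is the number of (positive) parts, $m_j(\lambda)$ is the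 number of parts equal to $j$, and $z_\lambda=\prod_{j\ge1}j^{m_j(\lambda)}m_j(\lambda)!$. The symmetric functions $h_\lambda,p_\lambda,s_\lambda$ are the usual complete homogeneous, power sum, and Schur symmetric functions in $\mathbf{x}=(x_1,x_2,\ldots)$. $s_\lambda(1^b)$ is $s_\lambda$ evaluated with $b$ variables set to $1$ and the rest to $0$. The multinomial coefficient $\binom{b}{k_0,\ldots,k_a}$ equals $\frac{b!}{k_0!\cdots k_a!}$ and is $0$ if some $k_i$ is negative. -}

module Defs where

open import Data.Bool.Base using (if_then_else_)
open import Data.Fin.Base as Fin using (Fin; zero; fromℕ)
open import Data.Fin.Permutation as Perm using (Permutation′; _⟨$⟩ʳ_)
import Data.Fin.Properties as Fin
open import Data.Integer.Base as ℤ using (ℤ; +_; -[1+_])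
open import Data.List.Base as List
  using (List; []; _∷_; map; mapMaybe; catMaybes; concat; concatMap; cartesianProductWith;
         filter; foldr; length; upTo; applyUpTo; allFin)
open import Data.List.Membership.Propositional using (_∈_)
import Data.List.Membership.DecPropositional as DecMembership
open import Data.List.Relation.Binary.Prefix.Heterogeneous using (Prefix)
open import Data.List.Relation.Binary.Prefix.Heterogeneous.Properties using (prefix?)
open import Data.List.Relation.Unary.All using (All; all?)
open import Data.List.Relation.Unary.All.Properties using (applyUpTo⁺₂)
open import Data.List.Relation.Unary.Linked using (Linked; linked?)
open import Data.List.Relation.Unary.Unique.Propositional using (Unique)
import Data.List.Relation.Unary.Unique.DecPropositional as DecUnique
open import Data.Maybe.Base as Maybe using (Maybe; just; nothing)
import Data.Maybe.Properties as Maybe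
import Data.List.Properties as List
open import Data.Nat.Base using (ℕ; zero; suc; _+_; _*_; _∸_; _^_; _≤_; _≥_; _!; NonZero)
open import Data.Nat.ListAction using (sum; product)
open import Data.Nat.ListAction.Properties using (product≢0)
import Data.Nat.Properties as ℕ
open import Data.Product.Base using (∃; _×_; _,_; proj₁; proj₂)
open import Data.Rational.Base as ℚ using (ℚ; 0ℚ; 1ℚ; _/_)
open import Data.Sum.Function.Propositional using (_⊎-↔_)
open import Data.Unit.Base using (⊤; tt)
open import Data.Vec.Base as Vec using (Vec; []; _∷_)
import Data.Vec.Properties as Vec
open import Function.Construct.Composition using (_↔-∘_)
open import Function.Construct.Symmetry using (↔-sym)
open import Relation.Binary.PropositionalEquality using (_≡_; subst)
open import Relation.Nullary.Decidable
  using (Dec; yes; does; map′; _×-dec_; dec⇒maybe)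
open import Relation.Unary using (Decidable)

words : ∀ {A : Set} → List A → (n : ℕ) → List (Vec A n)
words xs zero    = [] ∷ []
words xs (suc n) = cartesianProductWith _∷_ xs (words xs n)

satisfying : ∀ {A : Set} {P : A → Set} → Decidable P → List A → List (∃ P)
satisfying P? = mapMaybe (λ x → Maybe.map (x ,_) (dec⇒maybe (P? x)))

∑ : ∀ {A : Set} → List A → (A → ℚ) → ℚ
∑ xs f = foldr (λ x acc → f x ℚ.+ acc) 0ℚ xs

infix 5 ∑
syntax ∑ xs (λ x → e) = ∑[ x ∈ xs ] e

⟦_⟧ : ∀ {P : Set} → Dec P → ℚ
⟦ P? ⟧ = if does P? then 1ℚ else 0ℚ

record IsPartition (n : ℕ) (parts : List ℕ) : Set where
  constructor isPartition
  field
    sums-to    : sum parts ≡ n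
    positive   : All (1 ≤_) parts
    decreasing : Linked _≥_ parts

isPartition? : ∀ n → Decidable (IsPartition n)
isPartition? n μ =
  map′ (λ (s , p , d) → isPartition s p d) (λ (isPartition s p d) → s , p , d)
    (sum μ ℕ.≟ n ×-dec all? (1 ℕ.≤?_) μ ×-dec linked? ℕ._≥?_ μ)

Partition : ℕ → Set
Partition n = ∃ (IsPartition n)

partitions : ∀ n → List (Partition n)
partitions n = satisfying (isPartition? n)
  (concatMap (λ l → map Vec.toList (words (applyUpTo suc n) l)) (upTo (suc n)))

parts : ∀ {n} → Partition n → List ℕ
parts = proj₁

ℓ : ∀ {n} → Partition n → ℕ
ℓ μ = length (parts μ)

m : ∀ {n} → Partition n → ℕ → ℕ
m μ j = length (filter (ℕ._≟ j) (parts μ))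

-- The factors with j > n are all 1.
z : ∀ {n} → Partition n → ℕ
z {n} μ = product (applyUpTo (λ i → suc i ^ m μ (suc i) * m μ (suc i) !) n)

z≢0 : ∀ {n} (μ : Partition n) → NonZero (z μ)
z≢0 {n} μ = product≢0 (applyUpTo⁺₂ _ n λ i →
  ℕ.m*n≢0 _ _ {{ℕ.m^n≢0 (suc i) (m μ (suc i))}} {{m μ (suc i) ℕ.!≢0}})

infixl 7 _/z_
_/z_ : ∀ {n} → ℤ → Partition n → ℚ
k /z μ = _/_ k (z μ) {{z≢0 μ}}

-- 1 / k!, read as 0 for negative k, so that a multinomial coefficient
-- with a negative lower entry vanishes.
1/_! : ℤ → ℚ
1/ + k !      = _/_ (+ 1) (k !) {{k ℕ.!≢0}}
1/ -[1+ _ ] ! = 0ℚ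

multinomial : ℕ → List ℤ → ℚ
multinomial b ks = foldr (λ k q → 1/ k ! ℚ.* q) (+ (b !) / 1) ks

-- A formal power series in x₁, x₂, … of bounded degree, given by its
-- coefficients: f n (α₁ ∷ … ∷ αₙ ∷ []) is the coefficient of
-- x₁^α₁ ⋯ xₙ^αₙ.  Each monomial involves finitely many variables, so
-- quantifying over all n covers all monomials in infinitely many variables.
Series : Set
Series = (n : ℕ) → Vec ℕ n → ℚ

infix 4 _≈_
_≈_ : Series → Series → Set
f ≈ g = ∀ n (α : Vec ℕ n) → f n α ≡ g n α

∑ˢ : ∀ {A : Set} → List A → (A → Series) → Series
∑ˢ xs f n α = ∑[ x ∈ xs ] f x n α

infix 5 ∑ˢ
syntax ∑ˢ xs (λ x → e) = ∑ˢ[ x ∈ xs ] e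

infixr 7 _•_
_•_ : ℚ → Series → Series
(q • f) n α = q ℚ.* f n α

splittings : ∀ {n} → Vec ℕ n → List (Vec ℕ n × Vec ℕ n)
splittings []      = ([] , []) ∷ []
splittings (k ∷ α) =
  cartesianProductWith (λ i (β , γ) → i ∷ β , k ∸ i ∷ γ) (upTo (suc k)) (splittings α)

infixr 7 _⊛_
_⊛_ : Series → Series → Series
(f ⊛ g) n α = ∑[ βγ ∈ splittings α ] f n (proj₁ βγ) ℚ.* g n (proj₂ βγ)

_≟ᵐ_ : ∀ {n} (α β : Vec ℕ n) → Dec (α ≡ β)
_≟ᵐ_ = Vec.≡-dec ℕ._≟_

one : Series
one n α = ⟦ α ≟ᵐ Vec.replicate n 0 ⟧

∏ˢ : (ℕ → Series) → List ℕ → Series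
∏ˢ f = foldr (λ k g → f k ⊛ g) one

hᵏ : ℕ → Series
hᵏ k n α = ⟦ Vec.sum α ℕ.≟ k ⟧

-- ∑ᵢ xᵢ^k; only meaningful for k ≥ 1.
pᵏ : ℕ → Series
pᵏ k n α = ∑[ i ∈ allFin n ] ⟦ α ≟ᵐ (Vec.replicate n 0 Vec.[ i ]≔ k) ⟧

h p : ∀ {d} → Partition d → Series
h μ = ∏ˢ hᵏ (parts μ)
p μ = ∏ˢ pᵏ (parts μ)

-- Tableaux are lists of rows, top row first (English convention), with
-- entries indexing the variables.
Tableau : ℕ → Set
Tableau n = List (List (Fin n))

fillings : ∀ n → List ℕ → List (Tableau n)
fillings n []      = [] ∷ []
fillings n (k ∷ μ) =
  cartesianProductWith _∷_ (map Vec.toList (words (allFin n) k)) (fillings n μ)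

-- Every row is weakly increasing, and each entry of a row is strictly
-- larger than the entry above it.
Semistandard : ∀ {n} → Tableau n → Set
Semistandard T =
  All (Linked Fin._≤_) T × Linked (λ upper lower → Prefix Fin._>_ lower upper) T

semistandard? : ∀ {n} → Decidable (Semistandard {n})
semistandard? T =
  all? (linked? Fin._≤?_) T ×-dec
  linked? (λ upper lower → prefix? (λ i j → j Fin.<? i) lower upper) T

ssyt : ∀ n → List ℕ → List (Tableau n)
ssyt n μ = filter semistandard? (fillings n μ)

content : ∀ {n} → Tableau n → Vec ℕ n
content T = Vec.tabulate λ i → length (filter (Fin._≟ i) (concat T))

s : ∀ {d} → Partition d → Series
s μ n α = ∑[ T ∈ ssyt n (parts μ) ] ⟦ α ≟ᵐ content T ⟧

-- Value at x₁ = ⋯ = x_b = 1 and xᵢ = 0 for i > b of a series f of degree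
-- at most d.  Only monomials in x₁, …, x_b survive, and those with
-- nonzero coefficient have all their exponents at most d.
evalOnes : (d b : ℕ) → Series → ℚ
evalOnes d b f = ∑[ α ∈ words (upTo (suc d)) b ] f b α

s[1^_] : ∀ b {d} → Partition d → ℚ
s[1^ b ] {d} μ = evalOnes d b (s μ)

-- The k-cycle i ↦ i + 1 (mod k).
cycle : ∀ k → Permutation′ k
cycle zero    = Perm.id
cycle (suc k) = Perm.insert (fromℕ k) zero Perm.id

infixr 6 _⊕_
_⊕_ : ∀ {k l} → Permutation′ k → Permutation′ l → Permutation′ (k + l)
σ ⊕ τ = ↔-sym Fin.+↔⊎ ↔-∘ ((σ ⊎-↔ τ) ↔-∘ Fin.+↔⊎)

cycles : (μ : List ℕ) → Permutation′ (sum μ)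
cycles []      = Perm.id
cycles (k ∷ μ) = cycle k ⊕ cycles μ

-- The representative (1 2 … μ₁)(μ₁+1 … μ₁+μ₂)⋯ of cycle type μ.
ofCycleType : ∀ {n} → Partition n → Permutation′ n
ofCycleType (μ , μ⊢n) = subst Permutation′ (IsPartition.sums-to μ⊢n) (cycles μ)

-- χ is a character, hence constant on cycle types, so its value on cycle
-- type μ can be read off at any representative.
Frob : ∀ {n} → (Permutation′ n → ℚ) → Series
Frob {n} χ = ∑ˢ[ μ ∈ partitions n ] (χ (ofCycleType μ) ℚ.* (+ 1 /z μ)) • p μ

-- A step is an east step, or a north step carrying a label.
Step : Set → Set
Step L = Maybe L

pattern N x = just x
pattern E   = nothing

-- The rest of a lattice path from the point (x , y) to (b , a), which never
-- goes below the line y = (a / b) x.  Both ends of each step satisfy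
-- a x ≤ b y, hence so does the whole step.
DyckFrom : ∀ {L} (a b x y : ℕ) → List (Step L) → Set
DyckFrom a b x y []        = x ≡ b × y ≡ a
DyckFrom a b x y (N _ ∷ w) = a * x ≤ b * y × DyckFrom a b x (suc y) w
DyckFrom a b x y (E ∷ w)   = a * x ≤ b * y × DyckFrom a b (suc x) y w

dyckFrom? : ∀ {L} a b x y → Decidable (DyckFrom {L} a b x y)
dyckFrom? a b x y []        = x ℕ.≟ b ×-dec y ℕ.≟ a
dyckFrom? a b x y (N _ ∷ w) = a * x ℕ.≤? b * y ×-dec dyckFrom? a b x (suc y) w
dyckFrom? a b x y (E ∷ w)   = a * x ℕ.≤? b * y ×-dec dyckFrom? a b (suc x) y w

-- Paths whose north steps are labelled by {1, …, a}, represented as Fin a.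
LabelledPath : ℕ → Set
LabelledPath a = List (Step (Fin a))

_≟ᵖ_ : ∀ {a} (w v : LabelledPath a) → Dec (w ≡ v)
_≟ᵖ_ = List.≡-dec (Maybe.≡-dec Fin._≟_)

labels : ∀ {a} → LabelledPath a → List (Fin a)
labels = catMaybes

-- Two consecutive north steps lie in the same column.
Ascending : ∀ {a} → Step (Fin a) → Step (Fin a) → Set
Ascending (N i) (N j) = i Fin.< j
Ascending (N _) E     = ⊤
Ascending E     _     = ⊤

ascending? : ∀ {a} (u v : Step (Fin a)) → Dec (Ascending u v)
ascending? (N i) (N j) = i Fin.<? j
ascending? (N _) E     = yes tt
ascending? E     _     = yes tt

record IsParkingFunction (a b : ℕ) (w : LabelledPath a) : Set where
  constructor isParkingFunction
  field
    dyck       : DyckFrom a b 0 0 w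
    injective  : Unique (labels w)
    surjective : ∀ i → i ∈ labels w
    increasing : Linked Ascending w

isParkingFunction? : ∀ a b → Decidable (IsParkingFunction a b)
isParkingFunction? a b w =
  map′ (λ (d , u , e , i) → isParkingFunction d u e i)
       (λ (isParkingFunction d u e i) → d , u , e , i)
    (dyckFrom? a b 0 0 w ×-dec unique? (labels w) ×-dec
     Fin.all? (λ i → i ∈? labels w) ×-dec linked? ascending? w)
  where
  open DecUnique {A = Fin a} Fin._≟_ using (unique?)
  open DecMembership {A = Fin a} Fin._≟_ using (_∈?_)

PF : (a b : ℕ) → List (LabelledPath a)
PF a b = filter (isParkingFunction? a b)
  (map Vec.toList (words (E ∷ map N (allFin a)) (a + b)))

-- Adds a north step at the foot of a path whose columns are sorted, moving
-- its label up to the right place in its column.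
insertNorth : ∀ {a} → Fin a → LabelledPath a → LabelledPath a
insertNorth i []        = N i ∷ []
insertNorth i (E ∷ w)   = N i ∷ E ∷ w
insertNorth i (N j ∷ w) =
  if does (i Fin.≤? j) then N i ∷ N j ∷ w else N j ∷ insertNorth i w

sortColumns : ∀ {a} → LabelledPath a → LabelledPath a
sortColumns []        = []
sortColumns (E ∷ w)   = E ∷ sortColumns w
sortColumns (N i ∷ w) = insertNorth i (sortColumns w)

infixr 7 _·_
_·_ : ∀ {a} → Permutation′ a → LabelledPath a → LabelledPath a
σ · w = sortColumns (map (Maybe.map (σ ⟨$⟩ʳ_)) w)

-- The (v , w) entry of the matrix of σ on the permutation module with
-- basis PF a b, and the trace of that matrix.  All values are rational.
matrixPF : ∀ {a} → Permutation′ a → LabelledPath a → LabelledPath a → ℚ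
matrixPF σ v w = ⟦ v ≟ᵖ (σ · w) ⟧

χ[PF_,_] : ∀ a b → Permutation′ a → ℚ
χ[PF a , b ] σ = ∑[ w ∈ PF a b ] matrixPF σ w w

{-# OPTIONS --safe #-}
module Submission where

-- A parking function is a map f from labels to columns with b · #{i | f i < x} ≥ a x for all x < b, and it
-- is fixed by σ when f is constant on the cycles of σ.  Placing the ℓ cycles freely gives b^ℓ maps; rotating
-- the columns cyclically, exactly one of b rotations is parking, because the heights
-- b · #{i | f i < x} - a x are distinct modulo b and the rotation has to start at their minimum.  Hence
-- χ(μ) = b^(ℓ(μ) - 1), which is the power sum expansion.  Up to the factor 1 / b, all three expansions equal
-- the degree a part of ∏ᵢ (1 - xᵢ)⁻ᵇ.  For the power sums both sides satisfy d X_d = b ∑ⱼ pⱼ X_{d-j}; for the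
-- complete functions both satisfy X_{b+1,d} = ∑ⱼ hⱼ X_{b,d-j}, where on the side of the partitions the
-- recursion removes a part; for the Schur functions this is Cauchy's identity, proved by building tableaux
-- from horizontal strips and using the Pieri rule for the numbers s_λ(1^b), which itself follows by induction
-- on b from Fomin's local rule for RSK.

open import Defs
open import Data.Bool.Base using (true; false; if_then_else_)
open import Data.Empty using (⊥; ⊥-elim)
open import Data.Fin.Base as Fin using (Fin; zero; suc; fromℕ; inject₁; punchIn; splitAt; _↑ˡ_; _↑ʳ_; join)
open import Data.Fin.Induction using (<-weakInduction)
open import Data.Fin.Permutation as Perm using (Permutation′; _⟨$⟩ʳ_; _⟨$⟩ˡ_; inverseˡ; inverseʳ)
import Data.Fin.Properties as Fin
import Data.Integer.Base as ℤ
import Data.Integer.Properties as ℤ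
open import Data.List.Base
  using (List; []; _∷_; _++_; map; cartesianProductWith; filter; length; upTo; concat; allFin; tabulate;
         concatMap; applyUpTo; mapMaybe; replicate; foldr)
import Data.List.Membership.DecPropositional as DecMembership
open import Data.List.Membership.Propositional using (_∈_; _∉_)
open import Data.List.Membership.Propositional.Properties as Mem using (∈-upTo⁺; ∈-upTo⁻)
open import Data.List.Membership.Propositional.Properties.WithK using (unique∧set⇒bag)
import Data.List.Properties as List
open import Data.List.Relation.Binary.BagAndSetEquality using (∼bag⇒↭)
open import Data.List.Relation.Binary.Disjoint.Propositional using (Disjoint)
open import Data.List.Relation.Binary.Permutation.Propositional as Perm using (_↭_)
open import Data.List.Relation.Binary.Prefix.Heterogeneous using (Prefix; []; _∷_)
open import Data.List.Relation.Binary.Prefix.Heterogeneous.Properties using (length-mono)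
open import Data.List.Relation.Unary.All as All using (All; []; _∷_)
import Data.List.Relation.Unary.All.Properties as All
open import Data.List.Relation.Unary.AllPairs as AllPairs using ([]; _∷_; AllPairs)
import Data.List.Relation.Unary.AllPairs.Properties as AllPairs
open import Data.List.Relation.Unary.Any using (here; there)
open import Data.List.Relation.Unary.Linked as Linked using (Linked; []; [-]; _∷_; linked?)
open import Data.List.Relation.Unary.Linked.Properties using (Linked⇒AllPairs; AllPairs⇒Linked)
open import Data.List.Relation.Unary.Unique.Propositional using (Unique)
import Data.List.Relation.Unary.Unique.Propositional.Properties as Unique
open import Data.Maybe.Base as Maybe using (just; nothing; Maybe)
import Data.Maybe.Properties as Maybe
import Data.Nat.Base as ℕ
open import Data.Nat.Coprimality as Coprime using (Coprime; coprime-divisor)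
open import Data.Nat.ListAction using (sum; product)
import Data.Nat.Properties as ℕ
open import Data.Nat.Tactic.RingSolver using (solve-∀)
open import Data.Product.Base using (∃; _×_; _,_; proj₁; proj₂)
import Data.Rational.Base as ℚ
import Data.Rational.Properties as ℚ
open import Data.Rational.Solver using (module +-*-Solver)
open import Data.Rational.Unnormalised.Base as ℚᵘ using (*≡*)
import Data.Rational.Unnormalised.Properties as ℚᵘ
open import Data.Sum.Base using (inj₁; inj₂; _⊎_; [_,_]′)
open import Data.Unit.Base using (tt; ⊤)
open import Data.Vec.Base as Vec using (Vec; []; _∷_; lookup; _∷ʳ_; toList)
import Data.Vec.Properties as Vec
open import Function.Base using (_∘_; id; const)
open import Function.Bundles using (mk⇔)
open import Relation.Binary.Definitions using (tri<; tri≈; tri>)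
open import Relation.Binary.PropositionalEquality
open import Relation.Nullary using (¬_; Dec; yes; no; contradiction; does)
open import Relation.Nullary.Decidable using (dec-true; dec-false; _×-dec_)
open import Relation.Unary using (Decidable)

-- The recursions for p and h have one source. When a partition has weight 1 / ∏ m_j!, marking one
-- of its parts of size j gives a factor m_j, which turns 1 / m_j! into the weight left after that
-- part is removed. Marking with weight j yields the factor d of the power sum recursion; marking
-- with weight 1 yields ℓ, and (b + 1 - ℓ) F(b + 1, ℓ) = (b + 1) F(b, ℓ) for falling factorials F
-- turns this into a recursion on b.
--
-- For the Schur functions, let U_p add a horizontal strip of size p and let D remove any horizontal
-- strip. The local rule says D U_p = ∑_{j ≤ p} U_j D. As s_λ(1^b) counts the ways to empty λ by b
-- applications of D, the Pieri rule follows with coefficients h_p(1^b), whose recursion on b is the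
-- same sum over j ≤ p. The rule matches λ_{i+1} with κ_i, a shift by one row. Shapes are therefore
-- vectors of a fixed length with room for more rows than there are letters left, so that the last
-- row is empty wherever the rule is applied. Vectors that do not decrease are allowed: they carry
-- no tableaux, and the sums need no side condition.

-- Finite sums of rational numbers and Iverson brackets

module RationalSums where

  open import Data.Integer.Base using (ℤ; +_)
  open import Data.Nat.Base using (ℕ; zero; suc; NonZero)
  open import Data.Rational.Base using (ℚ; 0ℚ; 1ℚ; _/_; _+_; _*_)

  private variable
    A B C : Set
    P Q : Set

  +-swap : ∀ p q r → p + (q + r) ≡ q + (p + r)
  +-swap p q r = trans (sym (ℚ.+-assoc p q r)) (trans (cong (_+ r) (ℚ.+-comm p q)) (ℚ.+-assoc q p r))

  *-swap : ∀ p q r → p * (q * r) ≡ q * (p * r)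
  *-swap p q r = trans (sym (ℚ.*-assoc p q r)) (trans (cong (_* r) (ℚ.*-comm p q)) (ℚ.*-assoc q p r))

  +-medial : ∀ p q r s → (p + q) + (r + s) ≡ (p + r) + (q + s)
  +-medial p q r s = trans (ℚ.+-assoc p q (r + s)) (trans (cong (λ t → p + t) (+-swap q r s)) (sym (ℚ.+-assoc p r (q + s))))

  ↥↧-cong : ∀ i m j n .{{_ : NonZero m}} .{{_ : NonZero n}} → i ℤ.* + n ≡ j ℤ.* + m → i / m ≡ j / n
  ↥↧-cong i (suc m) j (suc n) eq = ℚ.fromℚᵘ-cong {ℚᵘ.mkℚᵘ i m} {ℚᵘ.mkℚᵘ j n} (*≡* eq)

  /-*-/ : ∀ i m j n .{{_ : NonZero m}} .{{_ : NonZero n}} .{{_ : NonZero (m ℕ.* n)}} →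
          (i / m) * (j / n) ≡ (i ℤ.* j) / (m ℕ.* n)
  /-*-/ i (suc m) j (suc n) = ℚ.toℚᵘ-injective
    (ℚᵘ.≃-trans (ℚ.toℚᵘ-homo-* (i / suc m) (j / suc n))
    (ℚᵘ.≃-trans (ℚᵘ.*-cong (ℚ.toℚᵘ-fromℚᵘ x) (ℚ.toℚᵘ-fromℚᵘ y))
      (ℚᵘ.≃-sym (ℚ.toℚᵘ-fromℚᵘ (x ℚᵘ.* y)))))
    where
    x y : ℚᵘ.ℚᵘ
    x = ℚᵘ.mkℚᵘ i m
    y = ℚᵘ.mkℚᵘ j n

  -- Opaque, as unification would otherwise unfold the gcd computation in _/_.
  opaque

    ι : ℕ → ℚ
    ι n = + n / 1

    1/ι : (n : ℕ) .{{_ : NonZero n}} → ℚ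
    1/ι n = + 1 / n

    ι-+ : ∀ m n → ι (m ℕ.+ n) ≡ ι m + ι n
    ι-+ m n = ℚ.toℚᵘ-injective
      (ℚᵘ.≃-trans (ℚ.toℚᵘ-fromℚᵘ (ℚᵘ.mkℚᵘ (+ (m ℕ.+ n)) 0))
      (ℚᵘ.≃-trans (*≡* (cong (ℤ._* + 1) (sym (cong₂ ℤ._+_ (ℤ.*-identityʳ (+ m)) (ℤ.*-identityʳ (+ n))))))
      (ℚᵘ.≃-trans (ℚᵘ.+-cong (ℚᵘ.≃-sym (ℚ.toℚᵘ-fromℚᵘ x)) (ℚᵘ.≃-sym (ℚ.toℚᵘ-fromℚᵘ y)))
        (ℚᵘ.≃-sym (ℚ.toℚᵘ-homo-+ (ι m) (ι n))))))
      where
      x y : ℚᵘ.ℚᵘ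
      x = ℚᵘ.mkℚᵘ (+ m) 0
      y = ℚᵘ.mkℚᵘ (+ n) 0

    ι-* : ∀ m n → ι (m ℕ.* n) ≡ ι m * ι n
    ι-* m n = sym (trans (/-*-/ (+ m) 1 (+ n) 1) (cong (λ i → i / 1) (sym (ℤ.pos-* m n))))

    /≡ι*1/ : ∀ k n .{{_ : NonZero n}} → + k / n ≡ ι k * 1/ι n
    /≡ι*1/ k (suc n) = sym (trans (/-*-/ (+ k) 1 (+ 1) (suc n))
      (↥↧-cong (+ k ℤ.* + 1) (1 ℕ.* suc n) (+ k) (suc n)
        (cong₂ ℤ._*_ (ℤ.*-identityʳ (+ k)) (cong +_ (sym (ℕ.*-identityˡ (suc n)))))))

    1/ι-* : ∀ m n .{{_ : NonZero m}} .{{_ : NonZero n}} .{{_ : NonZero (m ℕ.* n)}} →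
      1/ι (m ℕ.* n) ≡ 1/ι m * 1/ι n
    1/ι-* m n = sym (/-*-/ (+ 1) m (+ 1) n)

    1/ι-*-ι : ∀ n .{{_ : NonZero n}} → 1/ι n * ι n ≡ 1ℚ
    1/ι-*-ι (suc n) = trans (ℚ.*-comm (+ 1 / suc n) (ι (suc n))) (trans (sym (/≡ι*1/ (suc n) (suc n)))
      (↥↧-cong (+ suc n) (suc n) (+ 1) 1 (ℤ.*-comm (+ suc n) (+ 1))))

    ι-1 : ι 1 ≡ 1ℚ
    ι-1 = refl

    ι-0 : ι 0 ≡ 0ℚ
    ι-0 = refl

    ι-def : ∀ n → + n / 1 ≡ ι n
    ι-def n = refl

    1/ι-def : ∀ n .{{_ : NonZero n}} → + 1 / n ≡ 1/ι n
    1/ι-def n = refl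

  ι-suc : ∀ n → ι (suc n) ≡ 1ℚ + ι n
  ι-suc n = trans (ι-+ 1 n) (cong (_+ ι n) ι-1)

  1/ι-*-ι-* : ∀ n .{{_ : NonZero n}} p → 1/ι n * (ι n * p) ≡ p
  1/ι-*-ι-* n p = trans (sym (ℚ.*-assoc (1/ι n) (ι n) p)) (trans (cong (_* p) (1/ι-*-ι n)) (ℚ.*-identityˡ p))

  ι-cancelˡ : ∀ n .{{_ : NonZero n}} {p q} → ι n * p ≡ ι n * q → p ≡ q
  ι-cancelˡ n {p} {q} eq = trans (sym (1/ι-*-ι-* n p)) (trans (cong (1/ι n *_) eq) (1/ι-*-ι-* n q))

  *-0ˡ : ∀ {p} → p ≡ 0ℚ → ∀ q → p * q ≡ 0ℚ
  *-0ˡ refl q = ℚ.*-zeroˡ q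

  *-0ʳ : ∀ p {q} → q ≡ 0ℚ → p * q ≡ 0ℚ
  *-0ʳ p refl = ℚ.*-zeroʳ p

  ⟦⟧-yes : (d : Dec P) → P → ⟦ d ⟧ ≡ 1ℚ
  ⟦⟧-yes d p rewrite dec-true d p = refl

  ⟦⟧-no : (d : Dec P) → ¬ P → ⟦ d ⟧ ≡ 0ℚ
  ⟦⟧-no d ¬p rewrite dec-false d ¬p = refl

  ⟦⟧-cong : (d : Dec P) (e : Dec Q) → (P → Q) → (Q → P) → ⟦ d ⟧ ≡ ⟦ e ⟧
  ⟦⟧-cong (yes p) e f g = sym (⟦⟧-yes e (f p))
  ⟦⟧-cong (no ¬p) e f g = sym (⟦⟧-no e (¬p ∘ g))

  ⟦⟧-× : (d : Dec P) (e : Dec Q) → ⟦ d ×-dec e ⟧ ≡ ⟦ d ⟧ * ⟦ e ⟧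
  ⟦⟧-× (yes _) e = sym (ℚ.*-identityˡ ⟦ e ⟧)
  ⟦⟧-× (no _)  e = sym (ℚ.*-zeroˡ ⟦ e ⟧)

  ⟦⟧-*-cong : (d : Dec P) {p q : ℚ} → (P → p ≡ q) → ⟦ d ⟧ * p ≡ ⟦ d ⟧ * q
  ⟦⟧-*-cong (yes p) eq = cong (1ℚ *_) (eq p)
  ⟦⟧-*-cong (no _) {p} {q} eq = trans (ℚ.*-zeroˡ p) (sym (ℚ.*-zeroˡ q))

  ⟦⟧-*-0 : (d : Dec P) {q : ℚ} → (P → q ≡ 0ℚ) → ⟦ d ⟧ * q ≡ 0ℚ
  ⟦⟧-*-0 d {q} eq = trans (⟦⟧-*-cong d eq) (ℚ.*-zeroʳ ⟦ d ⟧)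

  ⟦⟧-*-yes : (d : Dec P) → P → ∀ p → ⟦ d ⟧ * p ≡ p
  ⟦⟧-*-yes d pf p = trans (cong (_* p) (⟦⟧-yes d pf)) (ℚ.*-identityˡ p)

  ⟦⟧-*-no : (d : Dec P) → ¬ P → ∀ p → ⟦ d ⟧ * p ≡ 0ℚ
  ⟦⟧-*-no d pf p = trans (cong (_* p) (⟦⟧-no d pf)) (ℚ.*-zeroˡ p)

  ∑-cong : (xs : List A) {F G : A → ℚ} → (∀ x → x ∈ xs → F x ≡ G x) → ∑ xs F ≡ ∑ xs G
  ∑-cong []       eq = refl
  ∑-cong (x ∷ xs) eq = cong₂ _+_ (eq x (here refl)) (∑-cong xs (λ y y∈ → eq y (there y∈)))

  ∑-ext : (xs : List A) {F G : A → ℚ} → (∀ x → F x ≡ G x) → ∑ xs F ≡ ∑ xs G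
  ∑-ext xs eq = ∑-cong xs (λ x _ → eq x)

  ∑-0 : (xs : List A) → ∑ xs (λ _ → 0ℚ) ≡ 0ℚ
  ∑-0 []       = refl
  ∑-0 (x ∷ xs) = trans (ℚ.+-identityˡ _) (∑-0 xs)

  ∑-zero : (xs : List A) {F : A → ℚ} → (∀ x → x ∈ xs → F x ≡ 0ℚ) → ∑ xs F ≡ 0ℚ
  ∑-zero xs eq = trans (∑-cong xs eq) (∑-0 xs)

  ∑-+ : (xs : List A) (F G : A → ℚ) → ∑ xs (λ x → F x + G x) ≡ ∑ xs F + ∑ xs G
  ∑-+ []       F G = refl
  ∑-+ (x ∷ xs) F G = trans (cong (λ t → (F x + G x) + t) (∑-+ xs F G)) (+-medial (F x) (G x) (∑ xs F) (∑ xs G))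

  ∑-*ˡ : (xs : List A) (q : ℚ) (F : A → ℚ) → ∑ xs (λ x → q * F x) ≡ q * ∑ xs F
  ∑-*ˡ []       q F = sym (ℚ.*-zeroʳ q)
  ∑-*ˡ (x ∷ xs) q F = trans (cong (λ t → q * F x + t) (∑-*ˡ xs q F)) (sym (ℚ.*-distribˡ-+ q (F x) (∑ xs F)))

  ∑-*ʳ : (xs : List A) (q : ℚ) (F : A → ℚ) → ∑ xs (λ x → F x * q) ≡ ∑ xs F * q
  ∑-*ʳ xs q F = trans (∑-ext xs (λ x → ℚ.*-comm (F x) q)) (trans (∑-*ˡ xs q F) (ℚ.*-comm q (∑ xs F)))

  ∑-swap : (xs : List A) (ys : List B) (F : A → B → ℚ) →
           ∑ xs (λ x → ∑ ys (F x)) ≡ ∑ ys (λ y → ∑ xs (λ x → F x y))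
  ∑-swap []       ys F = sym (∑-0 ys)
  ∑-swap (x ∷ xs) ys F = trans (cong (λ t → ∑ ys (F x) + t) (∑-swap xs ys F))
      (sym (∑-+ ys (F x) (λ y → ∑ xs (λ x′ → F x′ y))))

  ∑-++ : (xs ys : List A) (F : A → ℚ) → ∑ (xs ++ ys) F ≡ ∑ xs F + ∑ ys F
  ∑-++ []       ys F = sym (ℚ.+-identityˡ _)
  ∑-++ (x ∷ xs) ys F = trans (cong (λ t → F x + t) (∑-++ xs ys F)) (sym (ℚ.+-assoc (F x) (∑ xs F) (∑ ys F)))

  ∑-map : (f : A → B) (xs : List A) (F : B → ℚ) → ∑ (map f xs) F ≡ ∑ xs (F ∘ f)
  ∑-map f []       F = refl
  ∑-map f (x ∷ xs) F = cong (λ t → F (f x) + t) (∑-map f xs F)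

  ∑-cartesian : (f : A → B → C) (xs : List A) (ys : List B) (F : C → ℚ) →
                ∑ (cartesianProductWith f xs ys) F ≡ ∑ xs (λ x → ∑ ys (λ y → F (f x y)))
  ∑-cartesian f []       ys F = refl
  ∑-cartesian f (x ∷ xs) ys F = trans (∑-++ (map (f x) ys) _ F)
    (cong₂ _+_ (∑-map (f x) ys F) (∑-cartesian f xs ys F))

  ∑-filter : {P : A → Set} (P? : Decidable P) (xs : List A) (F : A → ℚ) →
             ∑ (filter P? xs) F ≡ ∑ xs (λ x → ⟦ P? x ⟧ * F x)
  ∑-filter P? []       F = refl
  ∑-filter P? (x ∷ xs) F with P? x
  ... | yes _ = cong₂ _+_ (sym (ℚ.*-identityˡ (F x))) (∑-filter P? xs F)
  ... | no _  = trans (sym (ℚ.+-identityˡ _)) (cong₂ _+_ (sym (ℚ.*-zeroˡ (F x))) (∑-filter P? xs F))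

  ∑-satisfying : {P : A → Set} (P? : Decidable P) (xs : List A) (F : A → ℚ) →
                 ∑ (satisfying P? xs) (F ∘ proj₁) ≡ ∑ (filter P? xs) F
  ∑-satisfying P? []       F = refl
  ∑-satisfying P? (x ∷ xs) F with P? x
  ... | yes _ = cong (λ t → F x + t) (∑-satisfying P? xs F)
  ... | no _  = ∑-satisfying P? xs F

  ∑-↭ : {xs ys : List A} (F : A → ℚ) → xs ↭ ys → ∑ xs F ≡ ∑ ys F
  ∑-↭ F Perm.refl         = refl
  ∑-↭ F (Perm.prep x p)   = cong (λ t → F x + t) (∑-↭ F p)
  ∑-↭ F (Perm.swap x y p) = trans (cong (λ t → F x + (F y + t)) (∑-↭ F p)) (+-swap (F x) (F y) _)
  ∑-↭ F (Perm.trans p q)  = trans (∑-↭ F p) (∑-↭ F q)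

  Unique-map-∈ : (f : A → B) {xs : List A} → (∀ {x y} → x ∈ xs → y ∈ xs → f x ≡ f y → x ≡ y) →
                 Unique xs → Unique (map f xs)
  Unique-map-∈ f inj []             = []
  Unique-map-∈ f {x ∷ xs} inj (x∉ ∷ u) =
    All.tabulate (λ y∈ fx≡y → let (x′ , x′∈ , y≡) = Mem.∈-map⁻ f y∈ in
      All.lookup x∉ x′∈ (inj (here refl) (there x′∈) (trans fx≡y y≡)))
    ∷ Unique-map-∈ f (λ p q → inj (there p) (there q)) u

  -- Duplicate-free lists with the same elements are permutations of each other, so a change of
  -- variables reduces to membership. Injectivity is asked for on `xs` alone, since maps such as
  -- `extend` or `pad` lose information elsewhere.
  ∑-bij : {xs : List A} {ys : List B} → Unique xs → Unique ys →
          (f : A → B) →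
          (∀ {x} → x ∈ xs → f x ∈ ys) →
          (∀ {x y} → x ∈ xs → y ∈ xs → f x ≡ f y → x ≡ y) →
          (∀ {y} → y ∈ ys → ∃ λ x → x ∈ xs × f x ≡ y) →
          {F : A → ℚ} {G : B → ℚ} → (∀ {x} → x ∈ xs → F x ≡ G (f x)) →
          ∑ xs F ≡ ∑ ys G
  ∑-bij {xs = xs} {ys} ux uy f into inj onto {F} {G} eq =
    trans (∑-cong xs (λ _ x∈ → eq x∈)) (trans (sym (∑-map f xs G))
      (∑-↭ G (∼bag⇒↭ (unique∧set⇒bag (Unique-map-∈ f inj ux) uy (mk⇔ to from)))))
    where
    to : ∀ {y} → y ∈ map f xs → y ∈ ys
    to y∈ with Mem.∈-map⁻ f y∈
    ... | x , x∈ , refl = into x∈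
    from : ∀ {y} → y ∈ ys → y ∈ map f xs
    from y∈ with onto y∈
    ... | x , x∈ , refl = Mem.∈-map⁺ f x∈

  ∑-single : {xs : List A} → Unique xs → ∀ {x} → x ∈ xs → {F : A → ℚ} →
             (∀ {y} → y ∈ xs → y ≢ x → F y ≡ 0ℚ) → ∑ xs F ≡ F x
  ∑-single {xs = x ∷ xs} (x∉ ∷ u) (here refl) {F} z =
    trans (cong (λ t → F x + t) (∑-zero xs (λ y y∈ → z (there y∈) (λ y≡x → All.lookup x∉ y∈ (sym y≡x)))))
        (ℚ.+-identityʳ (F x))
  ∑-single {xs = y ∷ xs} (y∉ ∷ u) (there x∈) {F} z =
    trans (cong₂ _+_ (z (here refl) (λ y≡x → All.lookup y∉ x∈ y≡x)) (∑-single u x∈ (z ∘ there))) (ℚ.+-identityˡ _)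

  ∑-⟦⟧-* : {P : A → Set} (P? : Decidable P) {xs : List A} → Unique xs → ∀ {x} → x ∈ xs → P x →
           (∀ {y} → P y → y ≡ x) → (F : A → ℚ) → ∑ xs (λ y → ⟦ P? y ⟧ * F y) ≡ F x
  ∑-⟦⟧-* P? u {x} x∈ px only F = trans
    (∑-single u x∈ {λ y → ⟦ P? y ⟧ * F y} (λ {y} _ y≢x → ⟦⟧-*-no (P? y) (y≢x ∘ only) (F y)))
    (⟦⟧-*-yes (P? x) px (F x))

  ∑-⟦⟧-1 : {P : A → Set} (P? : Decidable P) {xs : List A} → Unique xs → ∀ {x} → x ∈ xs → P x →
           (∀ {y} → P y → y ≡ x) → ∑ xs (λ y → ⟦ P? y ⟧) ≡ 1ℚ
  ∑-⟦⟧-1 P? {xs} u x∈ px only = trans (∑-ext xs (λ y → sym (ℚ.*-identityʳ ⟦ P? y ⟧))) (∑-⟦⟧-* P? u x∈ px only (λ _ → 1ℚ))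

  ∑-upTo-suc : ∀ n (F : ℕ → ℚ) → ∑ (upTo (suc n)) F ≡ F 0 + ∑ (upTo n) (F ∘ suc)
  ∑-upTo-suc n F = cong (λ t → F 0 + t)
      (trans (cong (λ l → ∑ l F) (sym (List.map-applyUpTo id suc n))) (∑-map suc (upTo n) F))

  ∑-upTo-sucʳ : ∀ n (F : ℕ → ℚ) → ∑ (upTo (suc n)) F ≡ ∑ (upTo n) F + F n
  ∑-upTo-sucʳ n F = trans (cong (λ l → ∑ l F) (sym (List.upTo-∷ʳ n)))
      (trans (∑-++ (upTo n) (n ∷ []) F) (cong (λ t → ∑ (upTo n) F + t) (ℚ.+-identityʳ (F n))))

  ∈-words : {xs : List A} → ∀ {n} {v : Vec A n} → (∀ i → Vec.lookup v i ∈ xs) → v ∈ words xs n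
  ∈-words {n = zero}  {[]}    _ = here refl
  ∈-words {n = suc n} {x ∷ v} h = Mem.∈-cartesianProductWith⁺ _∷_ (h Fin.zero) (∈-words (h ∘ Fin.suc))

  ∈-words⁻ : {xs : List A} → ∀ {n} {v : Vec A n} → v ∈ words xs n → ∀ i → Vec.lookup v i ∈ xs
  ∈-words⁻ {xs = xs} {suc n} v∈ i with Mem.∈-cartesianProductWith⁻ _∷_ xs (words xs n) v∈
  ∈-words⁻ {n = suc n} v∈ Fin.zero    | x , v , x∈ , v∈′ , refl = x∈
  ∈-words⁻ {n = suc n} v∈ (Fin.suc i) | x , v , x∈ , v∈′ , refl = ∈-words⁻ v∈′ i

  words-unique : {xs : List A} → Unique xs → ∀ n → Unique (words xs n)
  words-unique u zero    = [] ∷ []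
  words-unique u (suc n) = Unique.cartesianProductWith⁺ _∷_ Vec.∷-injective u (words-unique u n)

  vec-ext : ∀ {n} {v w : Vec A n} → (∀ i → Vec.lookup v i ≡ Vec.lookup w i) → v ≡ w
  vec-ext {v = v} {w} eq = trans (sym (Vec.tabulate∘lookup v)) (trans (Vec.tabulate-cong eq) (Vec.tabulate∘lookup w))

  toList-injective : ∀ {n} {v w : Vec A n} → Vec.toList v ≡ Vec.toList w → v ≡ w
  toList-injective {v = v} {w} eq = trans (sym (Vec.cast-is-id refl v)) (Vec.toList-injective refl v w eq)

  ∈-toList-words : {xs : List A} (w : List A) → All (_∈ xs) w → w ∈ map Vec.toList (words xs (length w))
  ∈-toList-words {xs = xs} w all = subst (_∈ map Vec.toList (words xs (length w))) (Vec.toList∘fromList w)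
    (Mem.∈-map⁺ Vec.toList (∈-words (entry all)))
    where
    entry : ∀ {w} → All (_∈ xs) w → ∀ i → Vec.lookup (Vec.fromList w) i ∈ xs
    entry (x∈ ∷ all) Fin.zero    = x∈
    entry (x∈ ∷ all) (Fin.suc i) = entry all i

  ∑-1 : (xs : List A) → ∑ xs (λ _ → 1ℚ) ≡ ι (length xs)
  ∑-1 []       = sym ι-0
  ∑-1 (x ∷ xs) = trans (cong (λ t → 1ℚ + t) (∑-1 xs)) (sym (ι-suc (length xs)))

  ∑-∑-* : (xs : List A) (ys : List B) (F : A → ℚ) (G : A → B → ℚ) →
    ∑ xs (λ x → F x * ∑ ys (G x)) ≡ ∑ ys (λ y → ∑ xs (λ x → F x * G x y))
  ∑-∑-* xs ys F G = trans (∑-ext xs (λ x → sym (∑-*ˡ ys (F x) (G x)))) (∑-swap xs ys (λ x y → F x * G x y))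

-- The cycle lemma: heights above the diagonal and the parking rotation

module CycleLemma where

  open import Data.Nat.Base
  open import Data.Nat.Properties
  open import Data.Nat.Divisibility

  Σ< : (ℕ → ℕ) → ℕ → ℕ
  Σ< c zero    = 0
  Σ< c (suc y) = Σ< c y + c y

  Σ<-cong : ∀ {c d} x → (∀ {j} → j < x → c j ≡ d j) → Σ< c x ≡ Σ< d x
  Σ<-cong zero    eq = refl
  Σ<-cong (suc x) eq = cong₂ _+_ (Σ<-cong x (λ j<x → eq (m<n⇒m<1+n j<x))) (eq ≤-refl)

  Σ<-shift : ∀ c r x → Σ< c (r + x) ≡ Σ< c r + Σ< (λ j → c (r + j)) x
  Σ<-shift c r zero    = trans (cong (Σ< c) (+-identityʳ r)) (sym (+-identityʳ _))
  Σ<-shift c r (suc x) = trans (cong (Σ< c) (+-suc r x))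
    (trans (cong (_+ c (r + x)) (Σ<-shift c r x)) (+-assoc (Σ< c r) _ _))

  -- The parking condition for columns of sizes c 0, …, c (b ∸ 1).
  Parking : (a b : ℕ) → (ℕ → ℕ) → Set
  Parking a b c = ∀ {x} → x < b → a * x ≤ b * Σ< c x

  parking? : ∀ a b c → Dec (Parking a b c)
  parking? a b c = allUpTo? (λ x → a * x ≤? b * Σ< c x) b

  minimum : (D : ℕ → ℕ) (n : ℕ) → ∃ λ r → r < suc n × (∀ {y} → y < suc n → D r ≤ D y)
  minimum D zero = 0 , ≤-refl , λ { (s≤s z≤n) → ≤-refl }
  minimum D (suc n) with minimum D n
  ... | r , r< , min with ≤-total (D r) (D (suc n))
  ... | inj₁ le = r , m<n⇒m<1+n r< , λ y< → step y<
    where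
    step : ∀ {y} → y < suc (suc n) → D r ≤ D y
    step {y} y< with m<1+n⇒m<n∨m≡n y<
    ... | inj₁ y<n = min y<n
    ... | inj₂ refl = le
  ... | inj₂ ge = suc n , ≤-refl , λ y< → step y<
    where
    step : ∀ {y} → y < suc (suc n) → D (suc n) ≤ D y
    step {y} y< with m<1+n⇒m<n∨m≡n y<
    ... | inj₁ y<n = ≤-trans ge (min y<n)
    ... | inj₂ refl = ≤-refl

  module Heights (a b : ℕ) (coprime : Coprime a b) (c : ℕ → ℕ)
                    (periodic : ∀ x → c (b + x) ≡ c x) (total : Σ< c b ≡ a) where

    S : ℕ → ℕ
    S = Σ< c

    S-periodic : ∀ y → S (b + y) ≡ a + S y
    S-periodic y = trans (Σ<-shift c b y) (cong₂ _+_ total (Σ<-cong y (λ {j} _ → periodic j)))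

    -- The height b · S y - a · y above the diagonal, shifted by 2 a b to stay in ℕ for y ≤ 2 b.
    D : ℕ → ℕ
    D y = b * S y + a * (b + b ∸ y)

    D-+ : ∀ {y} → y ≤ b + b → D y + a * y ≡ b * S y + a * (b + b)
    D-+ {y} y≤ = trans (+-assoc (b * S y) _ _) (cong (b * S y +_)
      (trans (sym (*-distribˡ-+ a (b + b ∸ y) y)) (cong (a *_) (m∸n+n≡m y≤))))

    -- Seen from r, the path starts afresh: up to the term a x, the heights at r + x and at r differ
    -- by b times a column sum that begins at column r. Hence the rotation by r is parking iff D r ≤
    -- D (r + x) for all x < b.
    D-shift : ∀ r x → r + x ≤ b + b → D (r + x) + a * x ≡ D r + b * Σ< (λ j → c (r + j)) x
    D-shift r x le = +-cancelʳ-≡ (a * r) _ _ (begin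
      D (r + x) + a * x + a * r         ≡⟨ lemma₁ (D (r + x)) a x r ⟩
      D (r + x) + a * (r + x)           ≡⟨ D-+ le ⟩
      b * S (r + x) + a * (b + b)       ≡⟨ cong (λ t → b * t + a * (b + b)) (Σ<-shift c r x) ⟩
      b * (S r + S′) + a * (b + b)      ≡⟨ lemma₂ b (S r) S′ (a * (b + b)) ⟩
      b * S r + a * (b + b) + b * S′    ≡⟨ cong (_+ b * S′) (sym (D-+ (≤-trans (m≤m+n r x) le))) ⟩
      D r + a * r + b * S′              ≡⟨ lemma₃ (D r) (a * r) (b * S′) ⟩
      D r + b * S′ + a * r              ∎)
      where
      open ≡-Reasoning
      S′ = Σ< (λ j → c (r + j)) x
      lemma₁ : ∀ d a x r → d + a * x + a * r ≡ d + a * (r + x)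
      lemma₁ = solve-∀
      lemma₂ : ∀ b s s′ k → b * (s + s′) + k ≡ b * s + k + b * s′
      lemma₂ = solve-∀
      lemma₃ : ∀ d e f → d + e + f ≡ d + f + e
      lemma₃ = solve-∀

    -- One period adds a labels and b columns, which changes the height by b a - a b = 0.
    D-periodic : ∀ {y} → y < b → D (b + y) ≡ D y
    D-periodic {y} y<b = +-cancelʳ-≡ (a * y + a * b) _ _ (begin
      D (b + y) + (a * y + a * b)            ≡⟨ lemma₁ (D (b + y)) a y b ⟩
      D (b + y) + a * (b + y)                ≡⟨ D-+ (+-monoʳ-≤ b (<⇒≤ y<b)) ⟩
      b * S (b + y) + a * (b + b)            ≡⟨ cong (λ t → b * t + a * (b + b)) (S-periodic y) ⟩
      b * (a + S y) + a * (b + b)            ≡⟨ lemma₂ b a (S y) (a * (b + b)) ⟩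
      b * S y + a * (b + b) + a * b          ≡⟨ cong (_+ a * b) (sym (D-+ (≤-trans (<⇒≤ y<b) (m≤m+n b b)))) ⟩
      D y + a * y + a * b                    ≡⟨ +-assoc (D y) _ _ ⟩
      D y + (a * y + a * b)                  ∎)
      where
      open ≡-Reasoning
      lemma₁ : ∀ d a y b → d + (a * y + a * b) ≡ d + a * (b + y)
      lemma₁ = solve-∀
      lemma₂ : ∀ b a s k → b * (a + s) + k ≡ b * s + k + a * b
      lemma₂ = solve-∀

    -- Equal heights at r < r′ would give a (r′ - r) = b S′. By coprimality b would divide r′ - r,
    -- although 0 < r′ - r < b.
    D-distinct : ∀ {r r′} → r < r′ → r′ < b → D r ≢ D r′
    D-distinct {r} {r′} r<r′ r′<b eq with m≤n⇒∃[o]m+o≡n r<r′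
    ... | k , refl = <⇒≱ (≤-<-trans (m≤n+m (suc k) r) (subst (_< b) (sym (+-suc r k)) r′<b)) (∣⇒≤ b∣1+k)
      where
      open ≡-Reasoning
      S′ = Σ< (λ j → c (r + j)) (suc k)
      eq′ : a * suc k ≡ b * S′
      eq′ = +-cancelˡ-≡ (D r) _ _ (begin
        D r + a * suc k            ≡⟨ cong (_+ a * suc k) (trans eq (cong D (sym (+-suc r k)))) ⟩
        D (r + suc k) + a * suc k  ≡⟨ D-shift r (suc k) (≤-trans (≤-reflexive (+-suc r k)) (≤-trans (<⇒≤ r′<b) (m≤m+n b b))) ⟩
        D r + b * S′               ∎)
      b∣1+k : b ∣ suc k
      b∣1+k = coprime-divisor (Coprime.sym coprime) (subst (b ∣_) (sym eq′) (m∣m*n S′))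

    D-injective : ∀ {r r′} → r < b → r′ < b → D r ≡ D r′ → r ≡ r′
    D-injective {r} {r′} r<b r′<b eq with <-cmp r r′
    ... | tri< r<r′ _ _ = contradiction eq (D-distinct r<r′ r′<b)
    ... | tri≈ _ r≡r′ _ = r≡r′
    ... | tri> _ _ r>r′ = contradiction (sym eq) (D-distinct r>r′ r<b)

    Minimal : ℕ → Set
    Minimal r = ∀ {y} → y < b → D r ≤ D y

    parking⇒minimal : ∀ {r} → r < b → Parking a b (λ j → c (r + j)) → Minimal r
    parking⇒minimal {r} r<b park {y} y<b with ≤-total r y
    ... | inj₁ r≤y = subst (λ t → D r ≤ D t) (m+[n∸m]≡n r≤y) (at (≤-<-trans (m∸n≤m y r) y<b))
      where
      at : ∀ {x} → x < b → D r ≤ D (r + x)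
      at {x} x<b = +-cancelʳ-≤ (a * x) _ _ (≤-trans (+-monoʳ-≤ (D r) (park x<b))
        (≤-reflexive (sym (D-shift r x (+-mono-≤ (<⇒≤ r<b) (<⇒≤ x<b))))))
    ... | inj₂ y≤r with m≤n⇒m<n∨m≡n y≤r
    ... | inj₂ refl = ≤-refl
    -- For y < r the rotation meets column y only after wrapping around, at b + y, where the height
    -- is the same.
    ... | inj₁ y<r = subst (D r ≤_) (trans (cong D (m+[n∸m]≡n (≤-trans (<⇒≤ r<b) (m≤m+n b y)))) (D-periodic y<b)) (at x<b)
      where
      at : ∀ {x} → x < b → D r ≤ D (r + x)
      at {x} x<b = +-cancelʳ-≤ (a * x) _ _ (≤-trans (+-monoʳ-≤ (D r) (park x<b))
        (≤-reflexive (sym (D-shift r x (+-mono-≤ (<⇒≤ r<b) (<⇒≤ x<b))))))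
      x<b : b + y ∸ r < b
      x<b = +-cancelʳ-< r _ _ (subst (_< b + r) (sym (m∸n+n≡m (≤-trans (<⇒≤ r<b) (m≤m+n b y)))) (+-monoʳ-< b y<r))

    minimal⇒parking : ∀ {r} → r < b → Minimal r → Parking a b (λ j → c (r + j))
    minimal⇒parking {r} r<b min {x} x<b = +-cancelˡ-≤ (D r) _ _ (≤-trans (+-monoˡ-≤ (a * x) Dr≤)
      (≤-reflexive (D-shift r x (+-mono-≤ (<⇒≤ r<b) (<⇒≤ x<b)))))
      where
      Dr≤ : D r ≤ D (r + x)
      Dr≤ with <-≤-connex (r + x) b
      ... | inj₁ lt = min lt
      ... | inj₂ ge = subst (D r ≤_) (trans (sym (D-periodic y<b)) (cong D (m+[n∸m]≡n ge))) (min y<b)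
        where
        y<b : r + x ∸ b < b
        y<b = +-cancelʳ-< b _ _ (subst (_< b + b) (sym (m∸n+n≡m ge)) (+-mono-< r<b x<b))

    -- A rotation is parking iff it starts at a minimum of D over one period. The minimum is
    -- attained just once because the heights in a period are distinct.
    unique-rotation : .{{_ : NonZero b}} → ∃ λ r → r < b × Parking a b (λ j → c (r + j)) ×
      (∀ {r′} → r′ < b → Parking a b (λ j → c (r′ + j)) → r′ ≡ r)
    unique-rotation with minimum D (pred b)
    ... | r , r< , min = r , r<b , minimal⇒parking r<b min′ ,
          λ r′<b park → D-injective r′<b r<b (≤-antisym (parking⇒minimal r′<b park r<b) (min′ r′<b))
      where
      r<b = subst (r <_) (suc-pred b) r<
      min′ : Minimal r
      min′ {y} y<b = min (subst (y <_) (sym (suc-pred b)) y<b)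

-- Counting parking placements of blocks by cyclic rotation

module Rotations where

  open RationalSums
  open CycleLemma
  open import Data.Nat.Base
  open import Data.Nat.Properties
  open import Data.Nat.DivMod
  open import Data.Rational.Base using (ℚ; 1ℚ)

  -- The column sizes when the j-th block, of size μⱼ, is put into column gⱼ.
  load : (μ : List ℕ) → Vec ℕ (length μ) → ℕ → ℕ
  load []      []      x = 0
  load (k ∷ μ) (c ∷ g) x = (if does (c ≟ x) then k else 0) + load μ g x

  Σ<-indicator : ∀ c k {y} → c < y → Σ< (λ x → if does (c ≟ x) then k else 0) y ≡ k
  Σ<-indicator c k {suc y} c<1+y with m<1+n⇒m<n∨m≡n c<1+y
  ... | inj₁ c<y rewrite dec-false (c ≟ y) (<⇒≢ c<y) = trans (+-identityʳ _) (Σ<-indicator c k c<y)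

  ... | inj₂ refl rewrite dec-true (c ≟ c) refl = cong (_+ k) (Σ<-0 c ≤-refl)
    where

    Σ<-0 : ∀ y → y ≤ c → Σ< (λ x → if does (c ≟ x) then k else 0) y ≡ 0
    Σ<-0 zero    _ = refl
    Σ<-0 (suc y) y<c rewrite dec-false (c ≟ y) (≢-sym (<⇒≢ y<c)) = trans (+-identityʳ _) (Σ<-0 y (<⇒≤ y<c))

  Σ<-+ : ∀ c d y → Σ< (λ x → c x + d x) y ≡ Σ< c y + Σ< d y
  Σ<-+ c d zero    = refl
  Σ<-+ c d (suc y) = trans (cong (_+ (c y + d y)) (Σ<-+ c d y)) (lemma (Σ< c y) (Σ< d y) (c y) (d y))
    where
    lemma : ∀ s t u v → s + t + (u + v) ≡ s + u + (t + v)
    lemma = solve-∀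

  Σ<-0 : ∀ y → Σ< (λ _ → 0) y ≡ 0
  Σ<-0 zero    = refl
  Σ<-0 (suc y) = trans (+-identityʳ _) (Σ<-0 y)

  load-total : ∀ μ g {b} → (∀ i → lookup g i < b) → Σ< (load μ g) b ≡ sum μ
  load-total []      []      {b} _ = Σ<-0 b
  load-total (k ∷ μ) (c ∷ g) {b} g< = trans (Σ<-+ (λ x → if does (c ≟ x) then k else 0) (load μ g) b)
    (cong₂ _+_ (Σ<-indicator c k (g< Fin.zero)) (load-total μ g (g< ∘ Fin.suc)))

  ∈-words-upTo : ∀ {b n} {g : Vec ℕ n} → (∀ i → lookup g i < b) → g ∈ words (upTo b) n
  ∈-words-upTo g< = ∈-words (λ i → ∈-upTo⁺ (g< i))

  ∈-words-upTo⁻ : ∀ {b n} {g : Vec ℕ n} → g ∈ words (upTo b) n → ∀ i → lookup g i < b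
  ∈-words-upTo⁻ g∈ i = ∈-upTo⁻ (∈-words⁻ g∈ i)

  ∑-words-1 : ∀ b n → ∑ (words (upTo b) n) (λ _ → 1ℚ) ≡ ι (b ^ n)
  ∑-words-1 b zero    = trans (ℚ.+-identityʳ 1ℚ) (sym ι-1)
  ∑-words-1 b (suc n) = trans (∑-cartesian _∷_ (upTo b) (words (upTo b) n) (λ _ → 1ℚ))
    (trans (∑-ext (upTo b) (λ _ → trans (∑-words-1 b n) (sym (ℚ.*-identityˡ (ι (b ^ n))))))
    (trans (∑-*ʳ (upTo b) (ι (b ^ n)) (λ _ → 1ℚ))
    (trans (cong (ℚ._* ι (b ^ n)) (trans (∑-1 (upTo b)) (cong ι (List.length-upTo b))))
      (sym (ι-* b (b ^ n))))))

  module _ (b : ℕ) .{{_ : NonZero b}} where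

    -- `rotate r` subtracts r modulo b; adding b ∸ r instead keeps the computation in ℕ.
    rotate unrotate : ℕ → ℕ → ℕ
    rotate   r c = (c + (b ∸ r)) % b
    unrotate r c = (c + r) % b

    +-%ˡ : ∀ m n → (m % b + n) % b ≡ (m + n) % b
    +-%ˡ m n = trans (%-distribˡ-+ (m % b) n b)
        (trans (cong (λ t → (t + n % b) % b) (m%n%n≡m%n m b)) (sym (%-distribˡ-+ m n b)))

    rotate-unrotate : ∀ {r c} → r ≤ b → c < b → rotate r (unrotate r c) ≡ c
    rotate-unrotate {r} {c} r≤b c<b = trans (+-%ˡ (c + r) (b ∸ r))
      (trans (cong (_% b) (trans (+-assoc c r (b ∸ r)) (cong (c +_) (m+[n∸m]≡n r≤b))))
      (trans ([m+n]%n≡m%n c b) (m<n⇒m%n≡m c<b)))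

    unrotate-rotate : ∀ {r c} → r ≤ b → c < b → unrotate r (rotate r c) ≡ c
    unrotate-rotate {r} {c} r≤b c<b = trans (+-%ˡ (c + (b ∸ r)) r)
      (trans (cong (_% b) (trans (+-assoc c (b ∸ r) r) (cong (c +_) (m∸n+n≡m r≤b))))
      (trans ([m+n]%n≡m%n c b) (m<n⇒m%n≡m c<b)))

    load-rotate : ∀ μ g {r x} → (∀ i → lookup g i < b) → r ≤ b → x < b →
                  load μ (Vec.map (rotate r) g) x ≡ load μ g ((r + x) % b)
    load-rotate []      []      g< r≤b x<b = refl
    load-rotate (k ∷ μ) (c ∷ g) {r} {x} g< r≤b x<b = cong₂ _+_ (head (rotate r c ≟ x))
        (load-rotate μ g (g< ∘ Fin.suc) r≤b x<b)
      where
      x′ = (r + x) % b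
      x′≡ : x′ ≡ unrotate r x
      x′≡ = cong (_% b) (+-comm r x)
      head : (d : Dec (rotate r c ≡ x)) → (if does d then k else 0) ≡ (if does (c ≟ x′) then k else 0)
      head (yes eq) rewrite dec-true (c ≟ x′)
          (trans (sym (unrotate-rotate r≤b (g< Fin.zero))) (trans (cong (unrotate r) eq) (sym x′≡))) = refl
      head (no neq) rewrite dec-false (c ≟ x′)
          (λ eq → neq (trans (cong (rotate r) (trans eq x′≡)) (rotate-unrotate r≤b x<b))) = refl

    ∑-rotate : ∀ n r → r ≤ b → (F : Vec ℕ n → ℚ) →
               ∑ (words (upTo b) n) (F ∘ Vec.map (rotate r)) ≡ ∑ (words (upTo b) n) F
    ∑-rotate n r r≤b F = ∑-bij (words-unique (Unique.upTo⁺ b) n) (words-unique (Unique.upTo⁺ b) n) (Vec.map (rotate r))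
      (λ {g} g∈ → ∈-words-upTo (λ i → subst (_< b) (sym (Vec.lookup-map i (rotate r) g)) (m%n<n _ b)))
      (λ {g} {h} g∈ h∈ eq → trans (sym (inv g∈)) (trans (cong (Vec.map (unrotate r)) eq) (inv h∈)))
      (λ {g} g∈ → Vec.map (unrotate r) g ,
        ∈-words-upTo (λ i → subst (_< b) (sym (Vec.lookup-map i (unrotate r) g)) (m%n<n _ b)) ,
        vec-ext (λ i → trans (Vec.lookup-map i (rotate r) (Vec.map (unrotate r) g))
            (trans (cong (rotate r) (Vec.lookup-map i (unrotate r) g)) (rotate-unrotate r≤b (∈-words-upTo⁻ g∈ i)))))
      {F ∘ Vec.map (rotate r)} {F} (λ _ → refl)
      where
      inv : ∀ {g : Vec ℕ n} → g ∈ words (upTo b) n → Vec.map (unrotate r) (Vec.map (rotate r) g) ≡ g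
      inv {g} g∈ = vec-ext (λ i → trans (Vec.lookup-map i (unrotate r) (Vec.map (rotate r) g))
          (trans (cong (unrotate r) (Vec.lookup-map i (rotate r) g)) (unrotate-rotate r≤b (∈-words-upTo⁻ g∈ i))))

    Parking-cong : ∀ a {c d} → (∀ {x} → x < b → c x ≡ d x) → Parking a b c → Parking a b d
    Parking-cong a eq park {x} x<b = subst (λ t → a * x ≤ b * t) (Σ<-cong x (λ j<x → eq (<-trans j<x x<b))) (park x<b)

    -- The column sizes are continued b-periodically to `c`. Rotating the placement by r then
    -- amounts to reading `c` from r on, and the cycle lemma applies to `c`.
    ∑-rotations : ∀ μ → Coprime (sum μ) b → (g : Vec ℕ (length μ)) → (∀ i → lookup g i < b) →
      ∑ (upTo b) (λ r → ⟦ parking? (sum μ) b (load μ (Vec.map (rotate r) g)) ⟧) ≡ 1ℚ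
    ∑-rotations μ coprime g g< = trans (∑-cong (upTo b) (λ r r∈ → let r<b = ∈-upTo⁻ r∈ in
        ⟦⟧-cong (parking? (sum μ) b (load μ (Vec.map (rotate r) g))) (parking? (sum μ) b (λ j → c (r + j)))
          (Parking-cong (sum μ) (λ x<b → load-rotate μ g g< (<⇒≤ r<b) x<b))
          (Parking-cong (sum μ) (λ x<b → sym (load-rotate μ g g< (<⇒≤ r<b) x<b)))))
      (single unique-rotation)
      where
      c : ℕ → ℕ
      c x = load μ g (x % b)
      open Heights (sum μ) b coprime c
        (λ x → cong (load μ g) (trans (cong (_% b) (+-comm b x)) ([m+n]%n≡m%n x b)))
        (trans (Σ<-cong b (λ j<b → cong (load μ g) (m<n⇒m%n≡m j<b))) (load-total μ g g<))
      single : (∃ λ r → r < b × Parking (sum μ) b (λ j → c (r + j)) ×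
        (∀ {r′} → r′ < b → Parking (sum μ) b (λ j → c (r′ + j)) → r′ ≡ r)) →
        ∑ (upTo b) (λ r → ⟦ parking? (sum μ) b (λ j → c (r + j)) ⟧) ≡ 1ℚ
      single (r , r<b , park , uniq) = trans
        (∑-single (Unique.upTo⁺ b) (∈-upTo⁺ r<b)
          (λ {y} y∈ y≢r → ⟦⟧-no (parking? (sum μ) b (λ j → c (y + j))) (y≢r ∘ uniq (∈-upTo⁻ y∈))))
        (⟦⟧-yes (parking? (sum μ) b (λ j → c (r + j))) park)

    -- Double counting of the pairs (r, g) such that g rotated by r is parking. For fixed r the
    -- rotation permutes the placements, which gives b times the number of parking ones. For fixed g
    -- exactly one r works, which gives the number of all placements.
    ∑-parking : ∀ μ → Coprime (sum μ) b →
      ι b ℚ.* ∑ (words (upTo b) (length μ)) (λ g → ⟦ parking? (sum μ) b (load μ g) ⟧) ≡ ι (b ^ length μ)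
    ∑-parking μ coprime = begin
      ι b ℚ.* ∑ W F
        ≡⟨ cong (ℚ._* ∑ W F) (trans (cong ι (sym (List.length-upTo b))) (sym (∑-1 (upTo b)))) ⟩
      ∑ (upTo b) (λ _ → 1ℚ) ℚ.* ∑ W F
        ≡⟨ sym (∑-*ʳ (upTo b) (∑ W F) (λ _ → 1ℚ)) ⟩
      ∑ (upTo b) (λ _ → 1ℚ ℚ.* ∑ W F)
        ≡⟨ ∑-cong (upTo b) (λ r r∈ → trans (ℚ.*-identityˡ (∑ W F)) (sym (∑-rotate (length μ) r (<⇒≤ (∈-upTo⁻ r∈)) F))) ⟩
      ∑ (upTo b) (λ r → ∑ W (F ∘ Vec.map (rotate r)))
        ≡⟨ ∑-swap (upTo b) W (λ r → F ∘ Vec.map (rotate r)) ⟩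
      ∑ W (λ g → ∑ (upTo b) (λ r → F (Vec.map (rotate r) g)))
        ≡⟨ ∑-cong W (λ g g∈ → ∑-rotations μ coprime g (∈-words-upTo⁻ g∈)) ⟩
      ∑ W (λ _ → 1ℚ)
        ≡⟨ ∑-words-1 b (length μ) ⟩
      ι (b ^ length μ) ∎
      where
      open ≡-Reasoning
      W = words (upTo b) (length μ)
      F : Vec ℕ (length μ) → ℚ
      F g = ⟦ parking? (sum μ) b (load μ g) ⟧

-- Labelled paths as lists of sorted columns

module Columns where

  open CycleLemma using (Σ<)
  open import Data.Nat.Base
  open import Data.Nat.Properties

  private variable
    a : ℕ

  Sorted : List (Fin a) → Set
  Sorted = AllPairs Fin._<_

  Sorted⇒Unique : {l : List (Fin a)} → Sorted l → Unique l
  Sorted⇒Unique = AllPairs.map Fin.<⇒≢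

  -- Lets columns be compared as sets: the heads agree because each of them is the least element.
  sorted-unique : {l l′ : List (Fin a)} → Sorted l → Sorted l′ →
                  (∀ {i} → i ∈ l → i ∈ l′) → (∀ {i} → i ∈ l′ → i ∈ l) → l ≡ l′
  sorted-unique [] [] f g = refl
  sorted-unique [] (_ ∷ _) f g with () ← g (here refl)
  sorted-unique (_ ∷ _) [] f g with () ← f (here refl)
  sorted-unique {l = x ∷ l} {y ∷ l′} (x< ∷ s) (y< ∷ s′) f g = cong₂ _∷_ x≡y
    (sorted-unique s s′ (λ i∈ → drop x≡y (f (there i∈)) (All.lookup x< i∈))
                        (λ i∈ → drop (sym x≡y) (g (there i∈)) (All.lookup y< i∈)))
    where
    x≡y : x ≡ y
    x≡y with f (here refl) | g (here refl)
    ... | here eq  | _        = eq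
    ... | there _  | here eq  = sym eq
    ... | there x∈ | there y∈ = contradiction (All.lookup x< y∈) (<-asym (All.lookup y< x∈))
    drop : ∀ {i u v} {k : List (Fin _)} → u ≡ v → i ∈ v ∷ k → u Fin.< i → i ∈ k
    drop refl (here refl) u<i = contradiction u<i (<-irrefl refl)
    drop refl (there i∈)  _   = i∈

  insert : Fin a → List (Fin a) → List (Fin a)
  insert i []      = i ∷ []
  insert i (j ∷ l) = if does (i Fin.≤? j) then i ∷ j ∷ l else j ∷ insert i l

  ∈-insert⁻ : ∀ i (l : List (Fin a)) {j} → j ∈ insert i l → j ≡ i ⊎ j ∈ l
  ∈-insert⁻ i [] (here eq) = inj₁ eq
  ∈-insert⁻ i (k ∷ l) j∈ with does (i Fin.≤? k)
  ∈-insert⁻ i (k ∷ l) (here eq)  | true = inj₁ eq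
  ∈-insert⁻ i (k ∷ l) (there j∈) | true = inj₂ j∈
  ∈-insert⁻ i (k ∷ l) (here eq)  | false = inj₂ (here eq)
  ∈-insert⁻ i (k ∷ l) (there j∈) | false with ∈-insert⁻ i l j∈
  ... | inj₁ eq  = inj₁ eq
  ... | inj₂ j∈′ = inj₂ (there j∈′)

  ∈-insert⁺ : ∀ i (l : List (Fin a)) {j} → j ≡ i ⊎ j ∈ l → j ∈ insert i l
  ∈-insert⁺ i [] (inj₁ eq) = here eq
  ∈-insert⁺ i (k ∷ l) h with does (i Fin.≤? k)
  ∈-insert⁺ i (k ∷ l) (inj₁ eq) | true = here eq
  ∈-insert⁺ i (k ∷ l) (inj₂ j∈) | true = there j∈
  ∈-insert⁺ i (k ∷ l) (inj₁ eq) | false = there (∈-insert⁺ i l (inj₁ eq))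
  ∈-insert⁺ i (k ∷ l) (inj₂ (here eq)) | false = here eq
  ∈-insert⁺ i (k ∷ l) (inj₂ (there j∈)) | false = there (∈-insert⁺ i l (inj₂ j∈))

  insert-sorted : ∀ i {l : List (Fin a)} → Sorted l → i ∉ l → Sorted (insert i l)
  insert-sorted i [] _ = [] ∷ []
  insert-sorted i {k ∷ l} (k< ∷ s) i∉ with i Fin.≤? k
  ... | yes i≤k rewrite dec-true (i Fin.≤? k) i≤k = (i<k ∷ All.map (<-trans i<k) k<) ∷ k< ∷ s
    where i<k = ≤∧≢⇒< i≤k (λ eq → i∉ (here (Fin.toℕ-injective eq)))
  ... | no i≰k rewrite dec-false (i Fin.≤? k) i≰k = All.tabulate
      (λ j∈ → [ (λ { refl → ≰⇒> i≰k }) , All.lookup k< ]′ (∈-insert⁻ i l j∈))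
                 ∷ insert-sorted i s (i∉ ∘ there)

  sort : List (Fin a) → List (Fin a)
  sort []      = []
  sort (i ∷ l) = insert i (sort l)

  ∈-sort⁻ : ∀ (l : List (Fin a)) {j} → j ∈ sort l → j ∈ l
  ∈-sort⁻ (i ∷ l) j∈ with ∈-insert⁻ i (sort l) j∈
  ... | inj₁ eq  = here eq
  ... | inj₂ j∈′ = there (∈-sort⁻ l j∈′)

  ∈-sort⁺ : ∀ (l : List (Fin a)) {j} → j ∈ l → j ∈ sort l
  ∈-sort⁺ (i ∷ l) (here eq)  = ∈-insert⁺ i (sort l) (inj₁ eq)
  ∈-sort⁺ (i ∷ l) (there j∈) = ∈-insert⁺ i (sort l) (inj₂ (∈-sort⁺ l j∈))

  sort-sorted : {l : List (Fin a)} → Unique l → Sorted (sort l)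
  sort-sorted [] = []
  sort-sorted {l = i ∷ l} (i∉ ∷ u) = insert-sorted i (sort-sorted u)
    (λ i∈ → All.lookup i∉ (∈-sort⁻ l i∈) refl)

  path : List (List (Fin a)) → LabelledPath a
  path []       = []
  path (l ∷ ls) = map just l ++ nothing ∷ path ls

  labels-path : (ls : List (List (Fin a))) → labels (path ls) ≡ concat ls
  labels-path []             = refl
  labels-path ([] ∷ ls)      = labels-path ls
  labels-path ((i ∷ l) ∷ ls) = cong (i ∷_) (labels-path (l ∷ ls))

  -- North steps only move away from the diagonal, so the condition is tested once per column, at
  -- its foot.
  DyckColumns : (a b x y : ℕ) → List (List (Fin a)) → Set
  DyckColumns a b x y []       = x ≡ b × y ≡ a
  DyckColumns a b x y (l ∷ ls) = a * x ≤ b * y × DyckColumns a b (suc x) (y + length l) ls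

  dyck⁺ : ∀ b {x y} (ls : List (List (Fin a))) → DyckColumns a b x y ls → DyckFrom a b x y (path ls)
  dyck⁺ b [] d = d
  dyck⁺ {a} b {x} {y} ([] ∷ ls) (le , d) = le , subst (λ t → DyckFrom a b (suc x) t (path ls)) (+-identityʳ y) (dyck⁺ b ls d)
  dyck⁺ {a} b {x} {y} ((i ∷ l) ∷ ls) (le , d) = le , dyck⁺ b (l ∷ ls)
    (≤-trans le (*-monoʳ-≤ b (n≤1+n y)) , subst (λ t → DyckColumns a b (suc x) t ls) (+-suc y (length l)) d)

  dyck⁻ : ∀ b {x y} (ls : List (List (Fin a))) → DyckFrom a b x y (path ls) → DyckColumns a b x y ls
  dyck⁻ b [] d = d
  dyck⁻ {a} b {x} {y} ([] ∷ ls) (le , d) = le , subst (λ t → DyckColumns a b (suc x) t ls) (sym (+-identityʳ y))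
      (dyck⁻ b ls d)
  dyck⁻ {a} b {x} {y} ((i ∷ l) ∷ ls) (le , d) =
    le , subst (λ t → DyckColumns a b (suc x) t ls) (sym (+-suc y (length l))) (proj₂ (dyck⁻ b (l ∷ ls) d))

  -- Such a path cannot end with a north step, which would start at (b , a ∸ 1), below the diagonal.
  dyck-path : ∀ b .{{_ : NonZero b}} {x y} (w : LabelledPath a) → DyckFrom a b x y w → ∃ λ ls → w ≡ path ls
  dyck-path b [] d = [] , refl
  dyck-path b (nothing ∷ w) (_ , d) with dyck-path b w d
  ... | ls , refl = [] ∷ ls , refl
  dyck-path b (just i ∷ w) (le , d) with dyck-path b w d
  dyck-path b {y = y} (just i ∷ .[]) (le , refl , refl) | [] , refl =
    contradiction (≤-trans (≤-reflexive (*-comm b (suc y))) le) (<⇒≱ (*-monoʳ-< b ≤-refl))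
  dyck-path b (just i ∷ _) _ | l ∷ ls , refl = (i ∷ l) ∷ ls , refl

  -- Places a parking function among the words of length a + b from which `PF` is filtered.
  dyck-length : ∀ b {x y} (w : LabelledPath a) → DyckFrom a b x y w → x + y + length w ≡ a + b
  dyck-length {a} b [] (refl , refl) = trans (+-identityʳ _) (+-comm b a)
  dyck-length b {x} {y} (just _ ∷ w)  (_ , d) = trans (lemma x y (length w)) (dyck-length b w d)
    where
    lemma : ∀ x y n → x + y + suc n ≡ x + suc y + n
    lemma = solve-∀
  dyck-length b {x} {y} (nothing ∷ w) (_ , d) = trans (+-suc (x + y) (length w)) (dyck-length b w d)

  dyckColumns-length : ∀ b {x y} (ls : List (List (Fin a))) → DyckColumns a b x y ls → x + length ls ≡ b
  dyckColumns-length b {x} []       (eq , _) = trans (+-identityʳ x) eq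
  dyckColumns-length b {x} (l ∷ ls) (_ , d)  = trans (+-suc x (length ls)) (dyckColumns-length b ls d)

  ascending⁺ : {ls : List (List (Fin a))} → All Sorted ls → Linked Ascending (path ls)
  ascending⁺ [] = []
  ascending⁺ ([] ∷ s) = cons (ascending⁺ s)
    where
    cons : {w : LabelledPath _} → Linked Ascending w → Linked Ascending (nothing ∷ w)
    cons {w = []}    l = [-]
    cons {w = _ ∷ _} l = tt ∷ l
  ascending⁺ {ls = (i ∷ []) ∷ ls} ((_ ∷ s) ∷ ss) = tt ∷ ascending⁺ (s ∷ ss)
  ascending⁺ {ls = (i ∷ j ∷ l) ∷ ls} (((i<j ∷ _) ∷ s) ∷ ss) = i<j ∷ ascending⁺ (s ∷ ss)

  ascending⁻ : (ls : List (List (Fin a))) → Linked Ascending (path ls) → All Sorted ls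
  ascending⁻ [] _ = []
  ascending⁻ ([] ∷ ls) l = [] ∷ ascending⁻ ls (Linked.tail l)
  ascending⁻ ((i ∷ []) ∷ ls) (_ ∷ l) with _ ∷ ss ← ascending⁻ ([] ∷ ls) l = ([] ∷ []) ∷ ss
  ascending⁻ ((i ∷ j ∷ l′) ∷ ls) (i<j ∷ l) with s@(j< ∷ _) ∷ ss ← ascending⁻ ((j ∷ l′) ∷ ls) l =
    ((i<j ∷ All.map (<-trans i<j) j<) ∷ s) ∷ ss

  insertNorth-path : ∀ (i : Fin a) l ls → insertNorth i (path (l ∷ ls)) ≡ path (insert i l ∷ ls)
  insertNorth-path i []      ls = refl
  insertNorth-path i (j ∷ l) ls with does (i Fin.≤? j)
  ... | true  = refl
  ... | false = cong (just j ∷_) (insertNorth-path i l ls)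

  ·-path : ∀ (σ : Permutation′ a) ls → σ · path ls ≡ path (map (sort ∘ map (σ ⟨$⟩ʳ_)) ls)
  ·-path σ []             = refl
  ·-path σ ([] ∷ ls)      = cong (nothing ∷_) (·-path σ ls)
  ·-path σ ((i ∷ l) ∷ ls) = trans (cong (insertNorth (σ ⟨$⟩ʳ i)) (·-path σ (l ∷ ls)))
    (insertNorth-path (σ ⟨$⟩ʳ i) (sort (map (σ ⟨$⟩ʳ_) l)) (map (sort ∘ map (σ ⟨$⟩ʳ_)) ls))

  path-injective : {ls ls′ : List (List (Fin a))} → path ls ≡ path ls′ → ls ≡ ls′
  path-injective {ls = []} {[]} _ = refl
  path-injective {ls = []} {[] ∷ _} ()
  path-injective {ls = []} {(_ ∷ _) ∷ _} ()
  path-injective {ls = [] ∷ _} {[]} ()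
  path-injective {ls = (_ ∷ _) ∷ _} {[]} ()
  path-injective {ls = [] ∷ ls} {[] ∷ ls′} eq = cong ([] ∷_) (path-injective (List.∷-injectiveʳ eq))
  path-injective {ls = [] ∷ ls} {(_ ∷ _) ∷ ls′} ()
  path-injective {ls = (_ ∷ _) ∷ ls} {[] ∷ ls′} ()
  path-injective {ls = (i ∷ l) ∷ ls} {(j ∷ l′) ∷ ls′} eq
    with refl ← List.∷-injectiveˡ eq | refl ← path-injective {ls = l ∷ ls} {l′ ∷ ls′} (List.∷-injectiveʳ eq) = refl

  column : (Fin a → ℕ) → ℕ → List (Fin a)
  column {a} f x = filter (λ i → f i ≟ x) (allFin a)

  ∈-column⁺ : ∀ (f : Fin a → ℕ) {x i} → f i ≡ x → i ∈ column f x
  ∈-column⁺ f {x} {i} eq = Mem.∈-filter⁺ (λ i → f i ≟ x) (Mem.∈-allFin i) eq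

  ∈-column⁻ : ∀ (f : Fin a → ℕ) {x i} → i ∈ column f x → f i ≡ x
  ∈-column⁻ {a} f {x} i∈ = proj₂ (Mem.∈-filter⁻ (λ i → f i ≟ x) {xs = allFin a} i∈)

  column-sorted : ∀ (f : Fin a → ℕ) x → Sorted (column f x)
  column-sorted f x = AllPairs.filter⁺ (λ i → f i ≟ x) (AllPairs.tabulate⁺-< (λ i<j → i<j))

  columns : (Fin a → ℕ) → ℕ → ℕ → List (List (Fin a))
  columns f x zero    = []
  columns f x (suc n) = column f x ∷ columns f (suc x) n

  <-zero : ∀ {x j} → j < x + 0 → j < x
  <-zero {x} {j} = subst (j <_) (+-identityʳ x)

  <-suc⁺ : ∀ {x n j} → j < x + suc n → j < suc x + n
  <-suc⁺ {x} {n} {j} = subst (j <_) (+-suc x n)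

  <-suc⁻ : ∀ {x n j} → j < suc x + n → j < x + suc n
  <-suc⁻ {x} {n} {j} = subst (j <_) (sym (+-suc x n))

  ∈-columns⁺ : ∀ (f : Fin a → ℕ) x n {i} → x ≤ f i → f i < x + n → i ∈ concat (columns f x n)
  ∈-columns⁺ f x zero    le lt = contradiction (<-zero lt) (≤⇒≯ le)
  ∈-columns⁺ f x (suc n) le lt with m≤n⇒m<n∨m≡n le
  ... | inj₁ x<  = Mem.∈-++⁺ʳ (column f x) (∈-columns⁺ f (suc x) n x< (<-suc⁺ lt))
  ... | inj₂ eq = Mem.∈-++⁺ˡ (∈-column⁺ f (sym eq))

  ∈-columns⁻ : ∀ (f : Fin a → ℕ) x n {i} → i ∈ concat (columns f x n) → x ≤ f i
  ∈-columns⁻ f x (suc n) i∈ with Mem.∈-++⁻ (column f x) i∈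
  ... | inj₁ i∈₁ = ≤-reflexive (sym (∈-column⁻ f i∈₁))
  ... | inj₂ i∈₂ = <⇒≤ (∈-columns⁻ f (suc x) n i∈₂)

  columns-sorted : ∀ (f : Fin a → ℕ) x n → All Sorted (columns f x n)
  columns-sorted f x zero    = []
  columns-sorted f x (suc n) = column-sorted f x ∷ columns-sorted f (suc x) n

  columns-unique : ∀ (f : Fin a → ℕ) x n → Unique (concat (columns f x n))
  columns-unique f x zero    = []
  columns-unique f x (suc n) = Unique.++⁺ (Sorted⇒Unique (column-sorted f x)) (columns-unique f (suc x) n)
    (λ (i∈₁ , i∈₂) → <-irrefl (sym (∈-column⁻ f i∈₁)) (∈-columns⁻ f (suc x) n i∈₂))

  columns-cong : ∀ {f g : Fin a → ℕ} → (∀ i → f i ≡ g i) → ∀ x n → columns f x n ≡ columns g x n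
  columns-cong eq x zero    = refl
  columns-cong {f = f} {g} eq x (suc n) = cong₂ _∷_
    (List.filter-≐ (λ i → f i ≟ x) (λ i → g i ≟ x) ((λ {i} p → trans (sym (eq i)) p) , (λ {i} p → trans (eq i) p)) (allFin _))
    (columns-cong eq (suc x) n)

  columns-injective : ∀ {f g : Fin a → ℕ} x n → columns f x n ≡ columns g x n →
                      ∀ {i} → x ≤ f i → f i < x + n → f i ≡ g i
  columns-injective {f = f} x zero eq le lt = contradiction (<-zero lt) (≤⇒≯ le)
  columns-injective {f = f} {g} x (suc n) eq {i} le lt with m≤n⇒m<n∨m≡n le
  ... | inj₁ x< = columns-injective (suc x) n (List.∷-injectiveʳ eq) x< (<-suc⁺ lt)
  ... | inj₂ x≡ = trans (sym x≡) (sym (∈-column⁻ g (subst (i ∈_) (List.∷-injectiveˡ eq) (∈-column⁺ f (sym x≡)))))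

  module _ {a : ℕ} where

    open DecMembership {A = Fin a} Fin._≟_ using (_∈?_)

    columnOf : List (List (Fin a)) → Fin a → ℕ
    columnOf []       i = 0
    columnOf (l ∷ ls) i with i ∈? l
    ... | yes _ = 0
    ... | no _  = suc (columnOf ls i)

    columnOf-here : ∀ l ls {i} → i ∈ l → columnOf (l ∷ ls) i ≡ 0
    columnOf-here l ls {i} i∈ with i ∈? l
    ... | yes _ = refl
    ... | no i∉ = contradiction i∈ i∉

    columnOf-there : ∀ l ls {i} → i ∉ l → columnOf (l ∷ ls) i ≡ suc (columnOf ls i)
    columnOf-there l ls {i} i∉ with i ∈? l
    ... | yes i∈ = contradiction i∈ i∉
    ... | no _   = refl

    columnOf-< : ∀ ls {i} → i ∈ concat ls → columnOf ls i < length ls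
    columnOf-< (l ∷ ls) {i} i∈ with i ∈? l | Mem.∈-++⁻ l i∈
    ... | yes _ | _        = s≤s z≤n
    ... | no i∉ | inj₁ i∈₁ = contradiction i∈₁ i∉
    ... | no i∉ | inj₂ i∈₂ = s≤s (columnOf-< ls i∈₂)

    -- The last hypothesis is shaped for induction along the list: a label is either in one of the
    -- remaining columns, at x plus its index there, or it was used up to the left of x.
    columns-columnOf : ∀ ls (f : Fin a → ℕ) x → All Sorted ls → Unique (concat ls) →
      (∀ i → (i ∈ concat ls × f i ≡ x + columnOf ls i) ⊎ (i ∉ concat ls × f i < x)) →
      columns f x (length ls) ≡ ls
    columns-columnOf []       f x _ _ _ = refl
    columns-columnOf (l ∷ ls) f x (s ∷ ss) u h = cong₂ _∷_
      (sorted-unique (column-sorted f x) s to from)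
      (columns-columnOf ls f (suc x) ss u-tail h′)
      where
      disjoint : ∀ {i} → i ∈ l → i ∈ concat ls → ⊥
      disjoint = go l u
        where
        go : ∀ l′ → Unique (l′ ++ concat ls) → ∀ {i} → i ∈ l′ → i ∈ concat ls → ⊥
        go (j ∷ l′) (j∉ ∷ u) (here refl) i∈ = All.lookup j∉ (Mem.∈-++⁺ʳ l′ i∈) refl
        go (j ∷ l′) (_ ∷ u)  (there i∈₁) i∈ = go l′ u i∈₁ i∈
      u-tail : Unique (concat ls)
      u-tail = go l u
        where
        go : ∀ l′ → Unique (l′ ++ concat ls) → Unique (concat ls)
        go []       u       = u
        go (_ ∷ l′) (_ ∷ u) = go l′ u
      to : ∀ {i} → i ∈ column f x → i ∈ l
      to {i} i∈ with h i
      ... | inj₂ (_ , lt) = contradiction (∈-column⁻ f i∈) (<⇒≢ lt)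
      ... | inj₁ (i∈ls , eq) with Mem.∈-++⁻ l i∈ls
      ... | inj₁ i∈l = i∈l
      ... | inj₂ i∈′ = contradiction
        (+-cancelˡ-≡ x 0 _ (trans (+-identityʳ x)
            (trans (sym (∈-column⁻ f i∈)) (trans eq (cong (x +_) (columnOf-there l ls (λ i∈l → disjoint i∈l i∈′))))))) 0≢1+n
      from : ∀ {i} → i ∈ l → i ∈ column f x
      from {i} i∈ with h i
      ... | inj₁ (_ , eq) = ∈-column⁺ f (trans eq (trans (cong (x +_) (columnOf-here l ls i∈)) (+-identityʳ x)))
      ... | inj₂ (i∉ , _) = contradiction (Mem.∈-++⁺ˡ i∈) i∉
      h′ : ∀ i → (i ∈ concat ls × f i ≡ suc x + columnOf ls i) ⊎ (i ∉ concat ls × f i < suc x)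
      h′ i with h i
      ... | inj₂ (i∉ , lt) = inj₂ (i∉ ∘ Mem.∈-++⁺ʳ l , m<n⇒m<1+n lt)
      ... | inj₁ (i∈ , eq) with Mem.∈-++⁻ l i∈
      ... | inj₁ i∈₁ = inj₂ (disjoint i∈₁ , s≤s
          (≤-reflexive (trans eq (trans (cong (x +_) (columnOf-here l ls i∈₁)) (+-identityʳ x)))))
      ... | inj₂ i∈₂ = inj₁ (i∈₂ , trans eq
          (trans (cong (x +_) (columnOf-there l ls (λ i∈₁ → disjoint i∈₁ i∈₂))) (+-suc x _)))

  -- When f is invariant under σ, each column is mapped onto itself as a set, and sorting restores
  -- it as a list.
  fixed⁺ : ∀ (σ : Permutation′ a) (f : Fin a → ℕ) → (∀ i → f (σ ⟨$⟩ʳ i) ≡ f i) → ∀ x n →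
           map (sort ∘ map (σ ⟨$⟩ʳ_)) (columns f x n) ≡ columns f x n
  fixed⁺ σ f inv x zero    = refl
  fixed⁺ σ f inv x (suc n) = cong₂ _∷_
    (sorted-unique (sort-sorted (Unique.map⁺ σ-injective (Sorted⇒Unique (column-sorted f x)))) (column-sorted f x) to from)
    (fixed⁺ σ f inv (suc x) n)
    where
    σ-injective : ∀ {i j} → σ ⟨$⟩ʳ i ≡ σ ⟨$⟩ʳ j → i ≡ j
    σ-injective eq = trans (sym (inverseˡ σ)) (trans (cong (σ ⟨$⟩ˡ_) eq) (inverseˡ σ))
    to : ∀ {i} → i ∈ sort (map (σ ⟨$⟩ʳ_) (column f x)) → i ∈ column f x
    to i∈ with Mem.∈-map⁻ (σ ⟨$⟩ʳ_) (∈-sort⁻ (map (σ ⟨$⟩ʳ_) (column f x)) i∈)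
    ... | j , j∈ , refl = ∈-column⁺ f (trans (inv j) (∈-column⁻ f j∈))
    from : ∀ {i} → i ∈ column f x → i ∈ sort (map (σ ⟨$⟩ʳ_) (column f x))
    from {i} i∈ = ∈-sort⁺ (map (σ ⟨$⟩ʳ_) (column f x)) (subst (_∈ map (σ ⟨$⟩ʳ_) (column f x)) (inverseʳ σ)
      (Mem.∈-map⁺ (σ ⟨$⟩ʳ_) (∈-column⁺ f (trans (sym (inv (σ ⟨$⟩ˡ i))) (trans (cong f (inverseʳ σ)) (∈-column⁻ f i∈))))))

  fixed⁻ : ∀ (σ : Permutation′ a) (f : Fin a → ℕ) x n →
           map (sort ∘ map (σ ⟨$⟩ʳ_)) (columns f x n) ≡ columns f x n →
           ∀ {i} → x ≤ f i → f i < x + n → f (σ ⟨$⟩ʳ i) ≡ f i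
  fixed⁻ σ f x zero    eq le lt = contradiction (<-zero lt) (≤⇒≯ le)
  fixed⁻ σ f x (suc n) eq {i} le lt with m≤n⇒m<n∨m≡n le
  ... | inj₁ x< = fixed⁻ σ f (suc x) n (List.∷-injectiveʳ eq) x< (<-suc⁺ lt)
  ... | inj₂ x≡ = trans (∈-column⁻ f (subst (_ ∈_) (List.∷-injectiveˡ eq)
        (∈-sort⁺ (map (σ ⟨$⟩ʳ_) (column f x)) (Mem.∈-map⁺ (σ ⟨$⟩ʳ_) (∈-column⁺ f (sym x≡)))))) x≡

  -- The height at the foot of a column is the number of labels in the columns before it; this
  -- translates the parking condition on column sizes into the Dyck condition.
  dyckColumns⁺ : ∀ b (f : Fin a → ℕ) x n → let c = λ j → length (column f j) in
    (∀ {j} → x ≤ j → j < x + n → a * j ≤ b * Σ< c j) → x + n ≡ b → Σ< c b ≡ a →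
    DyckColumns a b x (Σ< c x) (columns f x n)
  dyckColumns⁺ b f x zero h refl tot = sym (+-identityʳ x) , trans (cong (Σ< _) (sym (+-identityʳ x))) tot
  dyckColumns⁺ b f x (suc n) h refl tot = h ≤-refl (subst (x <_) (sym (+-suc x n)) (s≤s (m≤m+n x n))) ,
    dyckColumns⁺ b f (suc x) n (λ le lt → h (<⇒≤ le) (<-suc⁻ lt)) (sym (+-suc x n)) tot

  dyckColumns⁻ : ∀ b (f : Fin a → ℕ) x n → let c = λ j → length (column f j) in
    DyckColumns a b x (Σ< c x) (columns f x n) → ∀ {j} → x ≤ j → j < x + n → a * j ≤ b * Σ< c j
  dyckColumns⁻ b f x zero    d le lt = contradiction (<-zero lt) (≤⇒≯ le)
  dyckColumns⁻ b f x (suc n) (e , d) le lt with m≤n⇒m<n∨m≡n le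
  ... | inj₁ x<   = dyckColumns⁻ b f (suc x) n d x< (<-suc⁺ lt)
  ... | inj₂ refl = e

-- Parking functions fixed by a permutation of given cycle type

module FixedPaths where

  open RationalSums
  open Columns
  open CycleLemma
  open Rotations
  open import Data.Nat.Base
  open import Data.Nat.Properties
  open import Data.Rational.Base using (ℚ; 1ℚ)

  -- Coordinates for the column functions fixed by `cycles μ`: all labels of the j-th cycle go to
  -- column gⱼ.
  block : (μ : List ℕ) → Vec ℕ (length μ) → Fin (sum μ) → ℕ
  block (k ∷ μ) (c ∷ g) i = [ const c , block μ g ]′ (splitAt k i)

  block-ˡ : ∀ k μ c g i → block (k ∷ μ) (c ∷ g) (i ↑ˡ sum μ) ≡ c
  block-ˡ k μ c g i rewrite Fin.splitAt-↑ˡ k i (sum μ) = refl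

  block-ʳ : ∀ k μ c g i → block (k ∷ μ) (c ∷ g) (k ↑ʳ i) ≡ block μ g i
  block-ʳ k μ c g i rewrite Fin.splitAt-↑ʳ k (sum μ) i = refl

  reps : (μ : List ℕ) → (Fin (sum μ) → ℕ) → Vec ℕ (length μ)
  reps []          f = []
  -- An empty cycle has no label from which a column could be read; 0 is a default value.
  reps (zero ∷ μ)  f = 0 ∷ reps μ f
  reps (suc k ∷ μ) f = f zero ∷ reps μ (f ∘ (suc k ↑ʳ_))

  split-elim : ∀ k {n} (Q : Fin (k + n) → Set) → (∀ i → Q (i ↑ˡ n)) → (∀ j → Q (k ↑ʳ j)) → ∀ i → Q i
  split-elim k {n} Q l r i with splitAt k i | Fin.join-splitAt k n i
  ... | inj₁ j | refl = l j
  ... | inj₂ j | refl = r j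

  ⊕-ˡ : ∀ {k l} (σ : Permutation′ k) (τ : Permutation′ l) i → (σ ⊕ τ) ⟨$⟩ʳ (i ↑ˡ l) ≡ (σ ⟨$⟩ʳ i) ↑ˡ l
  ⊕-ˡ {k} {l} σ τ i rewrite Fin.splitAt-↑ˡ k i l = refl

  ⊕-ʳ : ∀ {k l} (σ : Permutation′ k) (τ : Permutation′ l) i → (σ ⊕ τ) ⟨$⟩ʳ (k ↑ʳ i) ≡ k ↑ʳ (τ ⟨$⟩ʳ i)
  ⊕-ʳ {k} {l} σ τ i rewrite Fin.splitAt-↑ʳ k l i = refl

  punchIn-fromℕ : ∀ {k} (i : Fin k) → punchIn (fromℕ k) i ≡ inject₁ i
  punchIn-fromℕ zero    = refl
  punchIn-fromℕ (suc i) = cong suc (punchIn-fromℕ i)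

  cycle-inject₁ : ∀ {k} (i : Fin k) → cycle (suc k) ⟨$⟩ʳ inject₁ i ≡ suc i
  cycle-inject₁ {k} i = trans (cong (cycle (suc k) ⟨$⟩ʳ_) (sym (punchIn-fromℕ i)))
      (Perm.insert-punchIn (fromℕ k) zero Perm.id i)

  -- The cycle sends every j except the last to j + 1, so invariance carries the value at 0 upwards.
  cycle-invariant : ∀ {k} (f : Fin (suc k) → ℕ) → (∀ i → f (cycle (suc k) ⟨$⟩ʳ i) ≡ f i) → ∀ i → f i ≡ f zero
  cycle-invariant {k} f inv = <-weakInduction (λ i → f i ≡ f zero) refl
    (λ j eq → trans (cong f (sym (cycle-inject₁ j))) (trans (inv (inject₁ j)) eq))

  block-invariant : ∀ μ g i → block μ g (cycles μ ⟨$⟩ʳ i) ≡ block μ g i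
  block-invariant []      []      ()
  block-invariant (k ∷ μ) (c ∷ g) = split-elim k _
    (λ i → trans (cong (block (k ∷ μ) (c ∷ g)) (⊕-ˡ (cycle k) (cycles μ) i))
      (trans (block-ˡ k μ c g (cycle k ⟨$⟩ʳ i)) (sym (block-ˡ k μ c g i))))
    (λ j → trans (cong (block (k ∷ μ) (c ∷ g)) (⊕-ʳ (cycle k) (cycles μ) j))
      (trans (block-ʳ k μ c g (cycles μ ⟨$⟩ʳ j)) (trans (block-invariant μ g j) (sym (block-ʳ k μ c g j)))))

  block-reps : ∀ μ (f : Fin (sum μ) → ℕ) → (∀ i → f (cycles μ ⟨$⟩ʳ i) ≡ f i) → ∀ i → block μ (reps μ f) i ≡ f i
  block-reps []          f inv ()
  block-reps (zero ∷ μ)  f inv = block-reps μ f (λ i → trans (cong f (sym (⊕-ʳ (cycle 0) (cycles μ) i))) (inv i))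
  block-reps (suc k ∷ μ) f inv = split-elim (suc k) _
    (λ i → trans (block-ˡ (suc k) μ (f zero) (reps μ f′) i)
      (sym (cycle-invariant (λ j → f (j ↑ˡ sum μ))
          (λ j → trans (cong f (sym (⊕-ˡ (cycle (suc k)) (cycles μ) j))) (inv (j ↑ˡ sum μ))) i)))
    (λ j → trans (block-ʳ (suc k) μ (f zero) (reps μ f′) j)
      (block-reps μ f′ (λ i → trans (cong f (sym (⊕-ʳ (cycle (suc k)) (cycles μ) i))) (inv (suc k ↑ʳ i))) j))
    where f′ = f ∘ (suc k ↑ʳ_)

  reps-cong : ∀ μ {f g : Fin (sum μ) → ℕ} → (∀ i → f i ≡ g i) → reps μ f ≡ reps μ g
  reps-cong []          eq = refl
  reps-cong (zero ∷ μ)  eq = cong (0 ∷_) (reps-cong μ eq)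
  reps-cong (suc k ∷ μ) eq = cong₂ _∷_ (eq zero) (reps-cong μ (eq ∘ (suc k ↑ʳ_)))

  reps-block : ∀ μ → All (1 ≤_) μ → ∀ g → reps μ (block μ g) ≡ g
  reps-block []          _        []      = refl
  reps-block (suc k ∷ μ) (_ ∷ μ>) (c ∷ g) = cong (c ∷_)
    (trans (reps-cong μ (block-ʳ (suc k) μ c g)) (reps-block μ μ> g))

  block-< : ∀ μ g {b} → (∀ i → lookup g i < b) → ∀ i → block μ g i < b
  block-< []      []      g< ()
  block-< (k ∷ μ) (c ∷ g) {b} g< = split-elim k _
    (λ i → subst (_< b) (sym (block-ˡ k μ c g i)) (g< zero))
    (λ j → subst (_< b) (sym (block-ʳ k μ c g j)) (block-< μ g (g< ∘ suc) j))

  reps-< : ∀ μ f {b} → All (1 ≤_) μ → (∀ i → f i < b) → ∀ i → lookup (reps μ f) i < b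
  reps-< (suc k ∷ μ) f (_ ∷ _)  f< zero    = f< zero
  reps-< (suc k ∷ μ) f (_ ∷ μ>) f< (suc i) = reps-< μ (f ∘ (suc k ↑ʳ_)) μ> (f< ∘ (suc k ↑ʳ_)) i

  count : ∀ {n} → (Fin n → ℕ) → ℕ → ℕ
  count {zero}  φ x = 0
  count {suc n} φ x = (if does (φ zero ≟ x) then 1 else 0) + count (φ ∘ suc) x

  length-filter-tabulate : ∀ {n} {A : Set} (f : A → ℕ) (h : Fin n → A) x →
    length (filter (λ i → f i ≟ x) (tabulate h)) ≡ count (f ∘ h) x
  length-filter-tabulate {zero}  f h x = refl
  length-filter-tabulate {suc n} f h x with does (f (h zero) ≟ x)
  ... | true  = cong suc (length-filter-tabulate f (h ∘ suc) x)
  ... | false = length-filter-tabulate f (h ∘ suc) x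

  count-cong : ∀ {n} {φ ψ : Fin n → ℕ} x → (∀ i → φ i ≡ ψ i) → count φ x ≡ count ψ x
  count-cong {zero}  x eq = refl
  count-cong {suc n} x eq = cong₂ _+_ (cong (λ t → if does (t ≟ x) then 1 else 0) (eq zero)) (count-cong x (eq ∘ suc))

  count-const : ∀ k {n} (φ : Fin (k + n) → ℕ) {c} x → (∀ i → φ (i ↑ˡ n) ≡ c) →
    count φ x ≡ (if does (c ≟ x) then k else 0) + count (φ ∘ (k ↑ʳ_)) x
  count-const zero    φ {c} x eq with does (c ≟ x)
  ... | true  = refl
  ... | false = refl
  count-const (suc k) φ {c} x eq rewrite eq zero | count-const k (φ ∘ suc) x (eq ∘ suc) with does (c ≟ x)
  ... | true  = refl
  ... | false = refl

  count-block : ∀ μ g x → count (block μ g) x ≡ load μ g x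
  count-block []      []      x = refl
  count-block (k ∷ μ) (c ∷ g) x = trans (count-const k (block (k ∷ μ) (c ∷ g)) x (block-ˡ k μ c g))
    (cong ((if does (c ≟ x) then k else 0) +_) (trans (count-cong x (block-ʳ k μ c g)) (count-block μ g x)))

  length-column-block : ∀ μ g x → length (column (block μ g) x) ≡ load μ g x
  length-column-block μ g x = trans (length-filter-tabulate (block μ g) (λ i → i) x) (count-block μ g x)

  PF-unique : ∀ a b → Unique (PF a b)
  PF-unique a b = Unique.filter⁺ (isParkingFunction? a b)
    (Unique.map⁺ toList-injective (words-unique steps-unique (a + b)))
    where
    steps-unique : Unique (nothing ∷ map just (allFin a))
    steps-unique = All.tabulate (λ x∈ eq → absurd (Mem.∈-map⁻ just x∈) eq) ∷ Unique.map⁺ Maybe.just-injective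
        (Unique.allFin⁺ a)
      where
      absurd : ∀ {x : Step (Fin a)} → (∃ λ i → i ∈ allFin a × x ≡ just i) → ¬ (nothing ≡ x)
      absurd (i , _ , refl) ()

  ∈-PF⁺ : ∀ {a b w} → IsParkingFunction a b w → w ∈ PF a b
  ∈-PF⁺ {a} {b} {w} pf = Mem.∈-filter⁺ (isParkingFunction? a b)
    (subst (λ k → w ∈ map Vec.toList (words (nothing ∷ map just (allFin a)) k)) (dyck-length b w (IsParkingFunction.dyck pf))
      (∈-toList-words w (All.tabulate (λ {x} _ → every x)))) pf
    where
    every : (x : Step (Fin a)) → x ∈ nothing ∷ map just (allFin a)
    every nothing  = here refl
    every (just i) = there (Mem.∈-map⁺ just (Mem.∈-allFin i))

  module _ (μ : List ℕ) (μ>0 : All (1 ≤_) μ) (b : ℕ) .{{_ : NonZero b}} where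

    private
      a = sum μ
      σ = cycles μ

    toPath : Vec ℕ (length μ) → LabelledPath a
    toPath g = path (columns (block μ g) 0 b)

    Σ<-column : ∀ g x → Σ< (λ j → length (column (block μ g) j)) x ≡ Σ< (load μ g) x
    Σ<-column g x = Σ<-cong x (λ {j} _ → length-column-block μ g j)

    toPath-parking : ∀ g → (∀ i → lookup g i < b) → Parking a b (load μ g) → IsParkingFunction a b (toPath g)
    toPath-parking g g< park = isParkingFunction
      (dyck⁺ b ls (dyckColumns⁺ b (block μ g) 0 b (λ {j} _ j<b → subst (λ t → a * j ≤ b * t) (sym (Σ<-column g j)) (park j<b))
        refl (trans (Σ<-column g b) (load-total μ g g<))))
      (subst Unique (sym (labels-path ls)) (columns-unique (block μ g) 0 b))
      (λ i → subst (i ∈_) (sym (labels-path ls)) (∈-columns⁺ (block μ g) 0 b z≤n (block-< μ g g< i)))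
      (ascending⁺ (columns-sorted (block μ g) 0 b))
      where ls = columns (block μ g) 0 b

    toPath-fixed : ∀ g → toPath g ≡ σ · toPath g
    toPath-fixed g = sym (trans (·-path σ (columns (block μ g) 0 b))
      (cong path (fixed⁺ σ (block μ g) (block-invariant μ g) 0 b)))

    toPath-injective : ∀ g h → (∀ i → lookup g i < b) → toPath g ≡ toPath h → g ≡ h
    toPath-injective g h g< eq = trans (sym (reps-block μ μ>0 g)) (trans (reps-cong μ
      (λ i → columns-injective 0 b (path-injective eq) z≤n (block-< μ g g< i))) (reps-block μ μ>0 h))

    -- A fixed parking function is cut into columns. The function `columnOf` is then invariant under
    -- σ, hence determined by its values at the first labels of the cycles.
    fromPath : ∀ w → IsParkingFunction a b w → w ≡ σ · w →
      ∃ λ g → (∀ i → lookup g i < b) × Parking a b (load μ g) × toPath g ≡ w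
    fromPath w (isParkingFunction d u s asc) fix with dyck-path b w d
    ... | ls , refl = reps μ f , reps-< μ f μ>0 f<b ,
        (λ {x} x<b → subst (λ t → a * x ≤ b * t)
          (trans (Σ<-cong x (λ {j} _ → cong length (cong-column j))) (Σ<-column (reps μ f) x))
          (dyckColumns⁻ b f 0 b (subst (DyckColumns a b 0 0) (sym cols) (dyck⁻ b ls d)) z≤n x<b)) ,
        cong path (trans (columns-cong (block-reps μ f invariant) 0 b) cols)
      where
      f : Fin a → ℕ
      f = columnOf ls
      ∈ls : ∀ i → i ∈ concat ls
      ∈ls i = subst (i ∈_) (labels-path ls) (s i)
      length≡b : length ls ≡ b
      length≡b = dyckColumns-length b ls (dyck⁻ b ls d)
      f<b : ∀ i → f i < b
      f<b i = subst (f i <_) length≡b (columnOf-< ls (∈ls i))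
      cols : columns f 0 b ≡ ls
      cols = trans (cong (columns f 0) (sym length≡b)) (columns-columnOf ls f 0 (ascending⁻ ls asc)
        (subst Unique (labels-path ls) u) (λ i → inj₁ (∈ls i , refl)))
      invariant : ∀ i → f (σ ⟨$⟩ʳ i) ≡ f i
      invariant i = fixed⁻ σ f 0 b (subst (λ l → map (sort ∘ map (σ ⟨$⟩ʳ_)) l ≡ l) (sym cols)
        (sym (path-injective (trans fix (·-path σ ls))))) z≤n (f<b i)
      cong-column : ∀ j → column f j ≡ column (block μ (reps μ f)) j
      cong-column j = List.∷-injectiveˡ (sym (columns-cong (block-reps μ f invariant) j 1))

    -- The trace of a permutation matrix counts fixed points, and `toPath` matches these with the
    -- parking placements of the cycles.
    χ-cycles : χ[PF a , b ] σ ≡ ∑ (words (upTo b) (length μ)) (λ g → ⟦ parking? a b (load μ g) ⟧)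
    χ-cycles = begin
      ∑ (PF a b) (λ w → ⟦ w ≟ᵖ (σ · w) ⟧)
        ≡⟨ ∑-ext (PF a b) (λ w → sym (ℚ.*-identityʳ ⟦ w ≟ᵖ (σ · w) ⟧)) ⟩
      ∑ (PF a b) (λ w → ⟦ w ≟ᵖ (σ · w) ⟧ ℚ.* 1ℚ)
        ≡⟨ sym (∑-filter fixed? (PF a b) (λ _ → 1ℚ)) ⟩
      ∑ (filter fixed? (PF a b)) (λ _ → 1ℚ)
        ≡⟨ sym (∑-bij (Unique.filter⁺ park? (words-unique (Unique.upTo⁺ b) (length μ)))
            (Unique.filter⁺ fixed? (PF-unique a b)) toPath
             (λ {g} g∈ → let (g∈W , park) = Mem.∈-filter⁻ park? {xs = W} g∈ in
                Mem.∈-filter⁺ fixed? (∈-PF⁺ (toPath-parking g (∈-words-upTo⁻ g∈W) park)) (toPath-fixed g))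
             (λ {g} {h} g∈ h∈ → toPath-injective g h (∈-words-upTo⁻ (proj₁ (Mem.∈-filter⁻ park? {xs = W} g∈))))
             (λ {w} w∈ → let (w∈PF , fix) = Mem.∈-filter⁻ fixed? {xs = PF a b} w∈
                             (g , g< , park , eq) = fromPath w
                                 (proj₂ (Mem.∈-filter⁻ (isParkingFunction? a b)
                                 {xs = map Vec.toList (words (nothing ∷ map just (allFin a)) (a + b))} w∈PF)) fix in
                g , Mem.∈-filter⁺ park? (∈-words-upTo g<) park , eq)
             {λ _ → 1ℚ} {λ _ → 1ℚ} (λ _ → refl)) ⟩
      ∑ (filter park? W) (λ _ → 1ℚ)
        ≡⟨ ∑-filter park? W (λ _ → 1ℚ) ⟩
      ∑ W (λ g → ⟦ park? g ⟧ ℚ.* 1ℚ)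
        ≡⟨ ∑-ext W (λ g → ℚ.*-identityʳ ⟦ park? g ⟧) ⟩
      ∑ W (λ g → ⟦ park? g ⟧) ∎
      where
      open ≡-Reasoning
      W = words (upTo b) (length μ)
      park? : ∀ g → Dec (Parking a b (load μ g))
      park? g = parking? a b (load μ g)
      fixed? : ∀ w → Dec (w ≡ σ · w)
      fixed? w = w ≟ᵖ (σ · w)

-- Partitions as plain lists

module PartitionLists where

  open RationalSums
  open import Data.Nat.Base
  open import Data.Nat.Properties
  open import Data.Rational.Base using (ℚ)

  candidates : ℕ → List (List ℕ)
  candidates n = concatMap (λ l → map Vec.toList (words (applyUpTo suc n) l)) (upTo (suc n))

  partitionLists : ℕ → List (List ℕ)
  partitionLists n = filter (isPartition? n) (candidates n)

  -- Summing over plain lists spares the later bijections any comparison of proofs of `IsPartition`.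
  ∑-partitions : ∀ n (F : List ℕ → ℚ) → ∑ (partitions n) (F ∘ parts) ≡ ∑ (partitionLists n) F
  ∑-partitions n F = ∑-satisfying (isPartition? n) (candidates n) F

  partitionLists-unique : ∀ n → Unique (partitionLists n)
  partitionLists-unique n = Unique.filter⁺ (isPartition? n) {xs = candidates n}
      (Unique.concat⁺ {xss = map ofLength (upTo (suc n))}
    (All.map⁺ {f = ofLength} (All.tabulate {xs = upTo (suc n)}
        (λ {l} _ → Unique.map⁺ toList-injective
        (words-unique (Unique.applyUpTo⁺₁ suc n (λ i<j _ → <⇒≢ i<j ∘ suc-injective)) l))))
    (AllPairs.map⁺ {f = ofLength} (AllPairs.map disjoint (Unique.upTo⁺ (suc n)))))
    where
    ofLength : ℕ → List (List ℕ)
    ofLength l = map Vec.toList (words (applyUpTo suc n) l)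
    len : ∀ l {x} → x ∈ ofLength l → length x ≡ l
    len l x∈ with Mem.∈-map⁻ Vec.toList x∈
    ... | v , _ , refl = Vec.length-toList v
    disjoint : ∀ {l l′} → l ≢ l′ → Disjoint (ofLength l) (ofLength l′)
    disjoint {l} {l′} l≢l′ (x∈ , x∈′) = l≢l′ (trans (sym (len l x∈)) (len l′ x∈′))

  length≤sum : ∀ {μ} → All (1 ≤_) μ → length μ ≤ sum μ
  length≤sum []      = z≤n
  length≤sum (p ∷ h) = +-mono-≤ p (length≤sum h)

  part≤sum : ∀ {k μ} → k ∈ μ → k ≤ sum μ
  part≤sum {μ = k ∷ μ} (here refl) = m≤m+n k (sum μ)
  part≤sum {μ = j ∷ μ} (there k∈)  = ≤-trans (part≤sum k∈) (m≤n+m (sum μ) j)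

  ∈-partitionLists⁺ : ∀ {n μ} → IsPartition n μ → μ ∈ partitionLists n
  ∈-partitionLists⁺ {n} {μ} isp@(isPartition refl pos dec) = Mem.∈-filter⁺ (isPartition? n)
    (Mem.∈-concat⁺′ (∈-toList-words μ (All.tabulate entry))
      (Mem.∈-map⁺ (λ l → map Vec.toList (words (applyUpTo suc n) l)) (Mem.∈-upTo⁺ (s≤s (length≤sum pos))))) isp
    where
    entry : ∀ {k} → k ∈ μ → k ∈ applyUpTo suc n
    entry {zero}  k∈ with () ← All.lookup pos k∈
    entry {suc k} k∈ = Mem.∈-applyUpTo⁺ suc (part≤sum k∈)

  ∈-partitionLists⁻ : ∀ {n μ} → μ ∈ partitionLists n → IsPartition n μ
  ∈-partitionLists⁻ {n} μ∈ = proj₂ (Mem.∈-filter⁻ (isPartition? n) {xs = candidates n} μ∈)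

-- Semistandard tableaux and horizontal strips

module Branching where

  open RationalSums
  open import Data.Nat.Base
  open import Data.Nat.Properties
  open import Data.Rational.Base using (ℚ)

  private variable
    n : ℕ

  -- λ / κ is a horizontal strip: κ₁ ≤ λ₁, λ₂ ≤ κ₁, κ₂ ≤ λ₂, …
  Cap : ℕ → List ℕ → Set
  Cap k []      = ⊤
  Cap k (l ∷ _) = l ≤ k

  Strip : List ℕ → List ℕ → Set
  Strip []      []       = ⊤
  Strip []      (_ ∷ _)  = ⊥
  Strip (_ ∷ _) []       = ⊥
  Strip (k ∷ κ) (l ∷ ls) = k ≤ l × Cap k ls × Strip κ ls

  cap? : ∀ k ls → Dec (Cap k ls)
  cap? k []      = yes tt
  cap? k (l ∷ _) = l ≤? k

  strip? : ∀ κ ls → Dec (Strip κ ls)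
  strip? []      []       = yes tt
  strip? []      (_ ∷ _)  = no λ ()
  strip? (_ ∷ _) []       = no λ ()
  strip? (k ∷ κ) (l ∷ ls) = k ≤? l ×-dec cap? k ls ×-dec strip? κ ls

  lower : Fin (suc n) → Maybe (Fin n)
  lower {zero}  _       = nothing
  lower {suc n} zero    = just zero
  lower {suc n} (suc i) = Maybe.map suc (lower i)

  lower-inject₁ : (i : Fin n) → lower (inject₁ i) ≡ just i
  lower-inject₁ zero    = refl
  lower-inject₁ (suc i) = cong (Maybe.map suc) (lower-inject₁ i)

  lower-fromℕ : ∀ n → lower (fromℕ n) ≡ nothing
  lower-fromℕ zero    = refl
  lower-fromℕ (suc n) = cong (Maybe.map suc) (lower-fromℕ n)

  data LastView {n : ℕ} : Fin (suc n) → Set where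
    ‵inject₁ : (i : Fin n) → LastView (inject₁ i)
    ‵fromℕ   : LastView (fromℕ n)

  lastView : (i : Fin (suc n)) → LastView i
  lastView {zero}  zero    = ‵fromℕ
  lastView {suc n} zero    = ‵inject₁ zero
  lastView {suc n} (suc i) with lastView i
  ... | ‵inject₁ j = ‵inject₁ (suc j)
  ... | ‵fromℕ     = ‵fromℕ

  row : List (Fin n) → ℕ → List (Fin (suc n))
  row {n} r k = map inject₁ r ++ replicate k (fromℕ n)

  lowerRow : List (Fin (suc n)) → List (Fin n)
  lowerRow = mapMaybe lower

  length-row : ∀ (r : List (Fin n)) k → length (row r k) ≡ length r + k
  length-row r k = trans (List.length-++ (map inject₁ r)) (cong₂ _+_ (List.length-map inject₁ r) (List.length-replicate k))

  lowerRow-row : ∀ (r : List (Fin n)) k → lowerRow (row r k) ≡ r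
  lowerRow-row {n} r k = trans (List.mapMaybe-++ lower (map inject₁ r) _)
    (trans (cong₂ _++_ (List.mapMaybe-map-retract lower-inject₁ r) (none k)) (List.++-identityʳ r))
    where
    none : ∀ k → lowerRow (replicate k (fromℕ n)) ≡ []
    none zero    = refl
    none (suc k) rewrite lower-fromℕ n = none k

  all-max : ∀ (r : List (Fin (suc n))) → All (fromℕ n Fin.≤_) r → r ≡ replicate (length r) (fromℕ n)
  all-max []      []       = refl
  all-max (y ∷ r) (le ∷ h) = cong₂ _∷_ (Fin.≤-antisym (Fin.≤fromℕ y) le) (all-max r h)

  -- Weak increase pushes all copies of the largest letter to the end of the row.
  row-decompose : {r : List (Fin (suc n))} → AllPairs Fin._≤_ r → ∃ λ k → r ≡ row (lowerRow r) k
  row-decompose [] = 0 , refl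
  row-decompose {n} {x ∷ r} (x≤ ∷ s) with row-decompose s | lastView x
  ... | k , eq | ‵inject₁ i rewrite lower-inject₁ i = k , cong (inject₁ i ∷_) eq
  ... | k , eq | ‵fromℕ rewrite lower-fromℕ n | all-max r x≤ | lowerRow-row {n} [] (length r) = suc (length r) , refl

  row-lowerRow : {r : List (Fin (suc n))} → Linked Fin._≤_ r → row (lowerRow r) (length r ∸ length (lowerRow r)) ≡ r
  row-lowerRow {r = r} s with row-decompose (Linked⇒AllPairs ≤-trans s)
  ... | k , eq = trans (cong (row (lowerRow r)) k≡) (sym eq)
    where
    k≡ : length r ∸ length (lowerRow r) ≡ k
    k≡ = trans (cong (_∸ length (lowerRow r)) (trans (cong length eq) (length-row (lowerRow r) k)))
        (m+n∸m≡n (length (lowerRow r)) k)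

  inject₁-≤⁺ : {i j : Fin n} → i Fin.≤ j → inject₁ i Fin.≤ inject₁ j
  inject₁-≤⁺ {i = i} {j} = subst₂ _≤_ (sym (Fin.toℕ-inject₁ i)) (sym (Fin.toℕ-inject₁ j))

  inject₁-≤⁻ : {i j : Fin n} → inject₁ i Fin.≤ inject₁ j → i Fin.≤ j
  inject₁-≤⁻ {i = i} {j} = subst₂ _≤_ (Fin.toℕ-inject₁ i) (Fin.toℕ-inject₁ j)

  inject₁-<⁺ : {i j : Fin n} → i Fin.< j → inject₁ i Fin.< inject₁ j
  inject₁-<⁺ {i = i} {j} = subst₂ _<_ (sym (Fin.toℕ-inject₁ i)) (sym (Fin.toℕ-inject₁ j))

  inject₁-<⁻ : {i j : Fin n} → inject₁ i Fin.< inject₁ j → i Fin.< j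
  inject₁-<⁻ {i = i} {j} = subst₂ _<_ (Fin.toℕ-inject₁ i) (Fin.toℕ-inject₁ j)

  inject₁<fromℕ : (i : Fin n) → inject₁ i Fin.< fromℕ n
  inject₁<fromℕ {n} i = subst (Fin.toℕ (inject₁ i) <_) (sym (Fin.toℕ-fromℕ n)) (Fin.inject₁ℕ< i)

  fromℕ≮ : (i : Fin (suc n)) → ¬ fromℕ n Fin.< i
  fromℕ≮ i lt = <⇒≱ lt (Fin.≤fromℕ i)

  row-weak⁺ : {r : List (Fin n)} → Linked Fin._≤_ r → ∀ k → Linked Fin._≤_ (row r k)
  row-weak⁺ {n} [] zero          = []
  row-weak⁺ {n} [] (suc zero)    = [-]
  row-weak⁺ {n} [] (suc (suc k)) = ≤-refl ∷ row-weak⁺ [] (suc k)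
  row-weak⁺ [-] zero             = [-]
  row-weak⁺ {r = x ∷ []} [-] (suc k) = Fin.≤fromℕ (inject₁ x) ∷ row-weak⁺ [] (suc k)
  row-weak⁺ (le ∷ s) k           = inject₁-≤⁺ le ∷ row-weak⁺ s k

  row-weak⁻ : ∀ (r : List (Fin n)) k → Linked Fin._≤_ (row r k) → Linked Fin._≤_ r
  row-weak⁻ []          k _        = []
  row-weak⁻ (x ∷ [])    k _        = [-]
  row-weak⁻ (x ∷ y ∷ r) k (le ∷ s) = inject₁-≤⁻ le ∷ row-weak⁻ (y ∷ r) k s

  -- Nothing larger can stand below a largest letter, so the whole lower row has to fit under the
  -- smaller letters of the upper row. The inequality is the condition λ₂ ≤ κ₁ of a horizontal
  -- strip.
  row-prefix⁺ : ∀ {r₂ r₁ : List (Fin n)} → Prefix Fin._>_ r₂ r₁ → ∀ k₂ k₁ → length r₂ + k₂ ≤ length r₁ →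
                Prefix Fin._>_ (row r₂ k₂) (row r₁ k₁)
  row-prefix⁺ [] zero k₁ _ = []
  row-prefix⁺ {r₁ = y ∷ r₁} [] (suc k₂) k₁ (s≤s le) = inject₁<fromℕ y ∷ row-prefix⁺ [] k₂ k₁ le
  row-prefix⁺ (gt ∷ p) k₂ k₁ (s≤s le) = inject₁-<⁺ gt ∷ row-prefix⁺ p k₂ k₁ le

  row-prefix⁻ : ∀ (r₂ r₁ : List (Fin n)) k₂ k₁ → Prefix Fin._>_ (row r₂ k₂) (row r₁ k₁) →
                Prefix Fin._>_ r₂ r₁ × length r₂ + k₂ ≤ length r₁
  row-prefix⁻ [] [] zero k₁ _ = [] , z≤n
  row-prefix⁻ [] [] (suc k₂) (suc k₁) (gt ∷ _) = contradiction gt (fromℕ≮ _)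
  row-prefix⁻ (x ∷ r₂) [] k₂ (suc k₁) (gt ∷ _) = contradiction gt (fromℕ≮ _)
  row-prefix⁻ [] (y ∷ r₁) zero k₁ _ = [] , z≤n
  row-prefix⁻ [] (y ∷ r₁) (suc k₂) k₁ (_ ∷ p) = [] , s≤s (proj₂ (row-prefix⁻ [] r₁ k₂ k₁ p))
  row-prefix⁻ (x ∷ r₂) (y ∷ r₁) k₂ k₁ (gt ∷ p) with row-prefix⁻ r₂ r₁ k₂ k₁ p
  ... | p′ , le = inject₁-<⁻ gt ∷ p′ , s≤s le

  shape : Tableau n → List ℕ
  shape = map length

  extend : List ℕ → Tableau n → Tableau (suc n)
  extend (l ∷ ls) (r ∷ T) = row r (l ∸ length r) ∷ extend ls T
  -- Besides the empty tableau this covers lists of different lengths, where the value is a default.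
  extend _        _       = []

  restrict : Tableau (suc n) → Tableau n
  restrict = map lowerRow

  extend-restrict : {T : Tableau (suc n)} → All (Linked Fin._≤_) T → extend (shape T) (restrict T) ≡ T
  extend-restrict []       = refl
  extend-restrict (s ∷ ss) = cong₂ _∷_ (row-lowerRow s) (extend-restrict ss)

  restrict-extend : ∀ (T : Tableau n) ls → length T ≡ length ls → restrict (extend ls T) ≡ T
  restrict-extend []      []       _  = refl
  restrict-extend (r ∷ T) (l ∷ ls) eq = cong₂ _∷_ (lowerRow-row r _) (restrict-extend T ls (suc-injective eq))

  shape-extend : ∀ (T : Tableau n) ls → Strip (shape T) ls → shape (extend ls T) ≡ ls
  shape-extend []      []       _ = refl
  shape-extend (r ∷ T) (l ∷ ls) (le , _ , h) = cong₂ _∷_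
    (trans (length-row r _) (m+[n∸m]≡n le)) (shape-extend T ls h)

  semistandard-extend⁺ : {T : Tableau n} {ls : List ℕ} → Semistandard T → Strip (shape T) ls → Semistandard (extend ls T)
  semistandard-extend⁺ (ss , cs) h = rows ss h , cols cs h
    where
    rows : ∀ {T ls} → All (Linked Fin._≤_) T → Strip (shape T) ls → All (Linked Fin._≤_) (extend ls T)
    rows {ls = []} [] _ = []
    rows {ls = _ ∷ _} (s ∷ ss) (_ , _ , h) = row-weak⁺ s _ ∷ rows ss h
    cols : ∀ {T ls} → Linked (λ upper lower → Prefix Fin._>_ lower upper) T → Strip (shape T) ls →
           Linked (λ upper lower → Prefix Fin._>_ lower upper) (extend ls T)
    cols {ls = []} [] _ = []
    cols {ls = _ ∷ []} [-] _ = [-]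
    cols {T = r₁ ∷ r₂ ∷ T} {l₁ ∷ l₂ ∷ ls} (p ∷ cs) (_ , l₂≤ , h@(le₂ , _)) =
      row-prefix⁺ p (l₂ ∸ length r₂) (l₁ ∸ length r₁) (≤-trans (≤-reflexive (m+[n∸m]≡n le₂)) l₂≤) ∷ cols cs h

  -- The part of `Strip` that is available before column strictness is used. It makes l ∸ length r
  -- the true number of new cells in a row.
  Fits : Tableau n → List ℕ → Set
  Fits []      []       = ⊤
  Fits []      (_ ∷ _)  = ⊥
  Fits (_ ∷ _) []       = ⊥
  Fits (r ∷ T) (l ∷ ls) = length r ≤ l × Fits T ls

  semistandard-extend⁻ : {T : Tableau n} {ls : List ℕ} → Fits T ls → Semistandard (extend ls T) →
                         Semistandard T × Strip (shape T) ls
  semistandard-extend⁻ fit (ss , cs) = let (cs′ , h) = cols fit cs in (rows fit ss , cs′) , h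
    where
    rows : ∀ {T ls} → Fits T ls → All (Linked Fin._≤_) (extend ls T) → All (Linked Fin._≤_) T
    rows {[]} {[]} _ _ = []
    rows {r ∷ T} {l ∷ ls} (_ , fit) (s ∷ ss) = row-weak⁻ r _ s ∷ rows fit ss
    cols : ∀ {T ls} → Fits T ls → Linked (λ upper lower → Prefix Fin._>_ lower upper) (extend ls T) →
           Linked (λ upper lower → Prefix Fin._>_ lower upper) T × Strip (shape T) ls
    cols {[]} {[]} _ _ = [] , tt
    cols {r ∷ []} {l ∷ []} (le , _) _ = [-] , le , tt , tt
    cols {r₁ ∷ r₂ ∷ T} {l₁ ∷ l₂ ∷ ls} (le₁ , fit@(le₂ , _)) (p ∷ cs) with row-prefix⁻ r₂ r₁ _ _ p | cols fit cs
    ... | p′ , l₂≤ | cs′ , h = p′ ∷ cs′ , le₁ , ≤-trans (≤-reflexive (sym (m+[n∸m]≡n le₂))) l₂≤ , h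

  fits-restrict : (T : Tableau (suc n)) → Fits (restrict T) (shape T)
  fits-restrict []      = tt
  fits-restrict (r ∷ T) = List.length-mapMaybe lower r , fits-restrict T

  semistandard-restrict : {T : Tableau (suc n)} → Semistandard T → Semistandard (restrict T) × Strip
      (shape (restrict T)) (shape T)
  semistandard-restrict {T = T} ss = semistandard-extend⁻ (fits-restrict T)
      (subst Semistandard (sym (extend-restrict (proj₁ ss))) ss)

  ∈-fillings⁺ : (T : Tableau n) → T ∈ fillings n (shape T)
  ∈-fillings⁺ []      = here refl
  ∈-fillings⁺ {n} (r ∷ T) = Mem.∈-cartesianProductWith⁺ _∷_
    (∈-toList-words r (All.tabulate (λ {i} _ → Mem.∈-allFin i))) (∈-fillings⁺ T)

  ∈-fillings⁻ : ∀ {T : Tableau n} ls → T ∈ fillings n ls → shape T ≡ ls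
  ∈-fillings⁻ []       (here refl) = refl
  ∈-fillings⁻ {n} (l ∷ ls) T∈ with Mem.∈-cartesianProductWith⁻ _∷_ (map Vec.toList (words (allFin n) l)) (fillings n ls) T∈
  ... | r , T , r∈ , T∈′ , refl with Mem.∈-map⁻ Vec.toList r∈
  ... | v , _ , refl = cong₂ _∷_ (Vec.length-toList v) (∈-fillings⁻ ls T∈′)

  fillings-unique : ∀ n ls → Unique (fillings n ls)
  fillings-unique n []       = [] ∷ []
  fillings-unique n (l ∷ ls) = Unique.cartesianProductWith⁺ _∷_ (λ { refl → refl , refl })
    (Unique.map⁺ toList-injective (words-unique (Unique.allFin⁺ n) l)) (fillings-unique n ls)

  ssyt-unique : ∀ n ls → Unique (ssyt n ls)
  ssyt-unique n ls = Unique.filter⁺ semistandard? (fillings-unique n ls)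

  ∈-ssyt⁺ : ∀ {T : Tableau n} {ls} → Semistandard T → shape T ≡ ls → T ∈ ssyt n ls
  ∈-ssyt⁺ {T = T} ss refl = Mem.∈-filter⁺ semistandard? (∈-fillings⁺ T) ss

  ∈-ssyt⁻ : ∀ {T : Tableau n} {ls} → T ∈ ssyt n ls → Semistandard T × shape T ≡ ls
  ∈-ssyt⁻ {n} {ls = ls} T∈ with Mem.∈-filter⁻ semistandard? {xs = fillings n ls} T∈
  ... | T∈′ , ss = ss , ∈-fillings⁻ ls T∈′

  -- A finite range of shapes that is closed under removing strips. Every shape has L rows, empty
  -- ones included, and need not decrease.
  box : (M L : ℕ) → List (Vec ℕ L)
  box M = words (upTo (suc M))

  box-unique : ∀ M L → Unique (box M L)
  box-unique M = words-unique (Unique.upTo⁺ (suc M))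

  ∈-box⁺ : ∀ {M L} {v : Vec ℕ L} → (∀ i → lookup v i ≤ M) → v ∈ box M L
  ∈-box⁺ h = ∈-words (λ i → Mem.∈-upTo⁺ (s≤s (h i)))

  ∈-box⁻ : ∀ {M L} {v : Vec ℕ L} → v ∈ box M L → ∀ i → lookup v i ≤ M
  ∈-box⁻ v∈ i = s≤s⁻¹ (Mem.∈-upTo⁻ (∈-words⁻ v∈ i))

  strip-≤ : ∀ {L} (κ ls : Vec ℕ L) → Strip (Vec.toList κ) (Vec.toList ls) → ∀ i → lookup κ i ≤ lookup ls i
  strip-≤ (k ∷ κ) (l ∷ ls) (le , _ , h) zero    = le
  strip-≤ (k ∷ κ) (l ∷ ls) (le , _ , h) (suc i) = strip-≤ κ ls h i

  fromList-length : ∀ {A : Set} {L} (xs : List A) → length xs ≡ L → ∃ λ (v : Vec A L) → xs ≡ Vec.toList v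
  fromList-length xs refl = Vec.fromList xs , sym (Vec.toList∘fromList xs)

  -- The cells containing the largest entry form a horizontal strip.
  ssyt-branching : ∀ {n M L} (ls : Vec ℕ L) → ls ∈ box M L → (Φ : Tableau (suc n) → ℚ) →
    ∑ (ssyt (suc n) (Vec.toList ls)) Φ ≡
    ∑ (box M L) (λ κ → ⟦ strip? (Vec.toList κ) (Vec.toList ls) ⟧ ℚ.* ∑ (ssyt n (Vec.toList κ)) (Φ ∘ extend (Vec.toList ls)))
  ssyt-branching {n} {M} {L} ls ls∈ Φ = begin
    ∑ S Φ
      ≡⟨ ∑-cong S split ⟩
    ∑ S (λ T → ∑ B (λ κ → ⟦ has? κ T ⟧ ℚ.* Φ T))
      ≡⟨ ∑-swap S B (λ T κ → ⟦ has? κ T ⟧ ℚ.* Φ T) ⟩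
    ∑ B (λ κ → ∑ S (λ T → ⟦ has? κ T ⟧ ℚ.* Φ T))
      ≡⟨ ∑-ext B (λ κ → trans (sym (∑-filter (has? κ) S Φ)) (fiber κ (strip? (Vec.toList κ) λs))) ⟩
    ∑ B (λ κ → ⟦ strip? (Vec.toList κ) λs ⟧ ℚ.* ∑ (ssyt n (Vec.toList κ)) (Φ ∘ extend λs)) ∎
    where
    open ≡-Reasoning
    λs = Vec.toList ls
    S = ssyt (suc n) λs
    B = box M L
    has? : ∀ (κ : Vec ℕ L) (T : Tableau (suc n)) → Dec (shape (restrict T) ≡ Vec.toList κ)
    has? κ T = List.≡-dec _≟_ (shape (restrict T)) (Vec.toList κ)
    length-λs : length λs ≡ L
    length-λs = Vec.length-toList ls
    split : ∀ T → T ∈ S → Φ T ≡ ∑ B (λ κ → ⟦ has? κ T ⟧ ℚ.* Φ T)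
    split T T∈ with ∈-ssyt⁻ {ls = λs} T∈
    ... | ss , sh with fromList-length {L = L} (shape (restrict T)) (trans (List.length-map length (restrict T)) (trans (List.length-map lowerRow T) (trans (sym (List.length-map length T)) (trans (cong length sh) length-λs))))
    -- Only the shape of the restricted tableau contributes; it lies in the box because κ ≤ λ holds
    -- row by row.
    ... | κ , eq = sym (∑-⟦⟧-* (λ κ → has? κ T) (box-unique M L)
      (∈-box⁺ {v = κ} (λ i → ≤-trans (strip-≤ κ ls (subst₂ Strip eq sh (proj₂ (semistandard-restrict ss))) i) (∈-box⁻ ls∈ i)))
      eq (λ eq′ → toList-injective (trans (sym eq′) eq)) (λ _ → Φ T))
    fiber : ∀ κ (d : Dec (Strip (Vec.toList κ) λs)) →
      ∑ (filter (has? κ) S) Φ ≡ ⟦ d ⟧ ℚ.* ∑ (ssyt n (Vec.toList κ)) (Φ ∘ extend λs)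
    fiber κ (no ¬h) = trans (∑-zero (filter (has? κ) S) {Φ} (λ T T∈ → ⊥-elim (none T T∈)))
        (sym (ℚ.*-zeroˡ (∑ (ssyt n (Vec.toList κ)) (Φ ∘ extend λs))))
      where
      none : ∀ T → T ∈ filter (has? κ) S → ⊥
      none T T∈ with Mem.∈-filter⁻ (has? κ) {xs = S} T∈
      ... | T∈S , eq with ∈-ssyt⁻ {ls = λs} T∈S
      ... | ss , sh = ¬h (subst₂ Strip eq sh (proj₂ (semistandard-restrict ss)))
    -- Here `extend` and `restrict` are inverse to each other: a row is recovered from its smaller
    -- letters and its length.
    fiber κ (yes h) = trans (sym (∑-bij (ssyt-unique n (Vec.toList κ))
        (Unique.filter⁺ (has? κ) (ssyt-unique (suc n) λs)) (extend λs)
        into inj onto {Φ ∘ extend λs} {Φ} (λ _ → refl)))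
      (sym (ℚ.*-identityˡ (∑ (ssyt n (Vec.toList κ)) (Φ ∘ extend λs))))
      where
      length≡ : ∀ {T} → shape T ≡ Vec.toList κ → length T ≡ length λs
      length≡ {T} sh = trans (sym (List.length-map length T))
          (trans (cong length sh) (trans (Vec.length-toList κ) (sym length-λs)))
      into : ∀ {T} → T ∈ ssyt n (Vec.toList κ) → extend λs T ∈ filter (has? κ) S
      into {T} T∈ with ∈-ssyt⁻ T∈
      ... | ss , sh = Mem.∈-filter⁺ (has? κ)
        (∈-ssyt⁺ (semistandard-extend⁺ ss (subst (λ t → Strip t λs) (sym sh) h))
            (shape-extend T λs (subst (λ t → Strip t λs) (sym sh) h)))
        (trans (cong shape (restrict-extend T λs (length≡ sh))) sh)
      inj : ∀ {T T′} → T ∈ ssyt n (Vec.toList κ) → T′ ∈ ssyt n (Vec.toList κ) → extend λs T ≡ extend λs T′ → T ≡ T′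
      inj {T} {T′} T∈ T′∈ eq = trans (sym (restrict-extend T λs (length≡ (proj₂ (∈-ssyt⁻ T∈)))))
        (trans (cong restrict eq) (restrict-extend T′ λs (length≡ (proj₂ (∈-ssyt⁻ T′∈)))))
      onto : ∀ {T} → T ∈ filter (has? κ) S → ∃ λ T′ → T′ ∈ ssyt n (Vec.toList κ) × extend λs T′ ≡ T
      onto {T} T∈ with Mem.∈-filter⁻ (has? κ) {xs = S} T∈
      ... | T∈S , eq with ∈-ssyt⁻ {ls = λs} T∈S
      ... | ss , sh = restrict T , ∈-ssyt⁺ (proj₁ (semistandard-restrict ss)) eq ,
        trans (cong (λ t → extend t (restrict T)) (sym sh)) (extend-restrict (proj₁ ss))

-- Kostka numbers and the local rule

module LocalRule where

  open RationalSums
  open Branching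
  open import Data.Nat.Base
  open import Data.Nat.Properties
  open import Data.Rational.Base using (ℚ; 0ℚ; 1ℚ)

  private variable
    n L : ℕ

  -- The coefficient of tᵏ in (1 - t)⁻ᵇ.
  multichoose : ℕ → ℕ → ℚ
  multichoose zero    k = ⟦ k ≟ 0 ⟧
  multichoose (suc b) k = ∑[ j ∈ upTo (suc k) ] multichoose b j

  size : Vec ℕ L → ℕ
  size v = sum (toList v)

  size-∷ʳ : ∀ (v : Vec ℕ L) k → size (v ∷ʳ k) ≡ size v + k
  size-∷ʳ []      k = +-identityʳ k
  size-∷ʳ (x ∷ v) k = trans (cong (x +_) (size-∷ʳ v k)) (sym (+-assoc x (size v) k))

  lookup≤size : ∀ (v : Vec ℕ L) i → lookup v i ≤ size v
  lookup≤size (x ∷ v) zero    = m≤m+n x (size v)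
  lookup≤size (x ∷ v) (suc i) = ≤-trans (lookup≤size v i) (m≤n+m (size v) x)

  size≡0 : ∀ (v : Vec ℕ L) → size v ≡ 0 → v ≡ Vec.replicate L 0
  size≡0 []         _  = refl
  size≡0 (zero ∷ v) eq = cong (0 ∷_) (size≡0 v eq)

  size-0 : ∀ L → size (Vec.replicate L 0) ≡ 0
  size-0 zero    = refl
  size-0 (suc L) = size-0 L

  ∈-box-size : ∀ {a} (v : Vec ℕ L) → size v ≤ a → v ∈ box a L
  ∈-box-size v le = ∈-box⁺ (λ i → ≤-trans (lookup≤size v i) le)

  lookup-∷ʳ : ∀ {A : Set} {n} (v : Vec A n) x → lookup (v ∷ʳ x) (fromℕ n) ≡ x
  lookup-∷ʳ []      x = refl
  lookup-∷ʳ (_ ∷ v) x = lookup-∷ʳ v x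

  tabulate-∷ʳ : ∀ {A : Set} {n} (f : Fin (suc n) → A) → Vec.tabulate f ≡ Vec.tabulate (f ∘ inject₁) ∷ʳ f (fromℕ n)
  tabulate-∷ʳ {n = zero}  f = refl
  tabulate-∷ʳ {n = suc n} f = cong (f zero ∷_) (tabulate-∷ʳ (f ∘ suc))

  occurrences : Fin n → List (Fin n) → ℕ
  occurrences i r = length (filter (Fin._≟ i) r)

  occurrences-++ : ∀ (i : Fin n) r r′ → occurrences i (r ++ r′) ≡ occurrences i r + occurrences i r′
  occurrences-++ i r r′ = trans (cong length (List.filter-++ (Fin._≟ i) r r′)) (List.length-++ (filter (Fin._≟ i) r))

  occurrences-inject₁ : ∀ (i : Fin n) r k → occurrences (inject₁ i) (row r k) ≡ occurrences i r
  occurrences-inject₁ i [] zero = refl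
  occurrences-inject₁ {n} i [] (suc k) with fromℕ n Fin.≟ inject₁ i
  ... | yes eq = contradiction eq Fin.fromℕ≢inject₁
  ... | no _   = occurrences-inject₁ i [] k
  occurrences-inject₁ i (j ∷ r) k with inject₁ j Fin.≟ inject₁ i | j Fin.≟ i
  ... | yes _  | yes _ = cong suc (occurrences-inject₁ i r k)
  ... | no _   | no _  = occurrences-inject₁ i r k
  ... | yes eq | no ne = contradiction (Fin.inject₁-injective eq) ne
  ... | no ne  | yes eq = contradiction (cong inject₁ eq) ne

  occurrences-fromℕ : ∀ (r : List (Fin n)) k → occurrences (fromℕ n) (row r k) ≡ k
  occurrences-fromℕ []      zero = refl
  occurrences-fromℕ {n} []  (suc k) with fromℕ n Fin.≟ fromℕ n
  ... | yes _ = cong suc (occurrences-fromℕ {n} [] k)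
  ... | no ne = contradiction refl ne
  occurrences-fromℕ {n} (j ∷ r) k with inject₁ j Fin.≟ fromℕ n
  ... | yes eq = contradiction (sym eq) Fin.fromℕ≢inject₁
  ... | no _   = occurrences-fromℕ r k

  extend-inject₁ : ∀ (i : Fin n) T ls → length T ≡ length ls →
    occurrences (inject₁ i) (concat (extend ls T)) ≡ occurrences i (concat T)
  extend-inject₁ i []      []       _  = refl
  extend-inject₁ i (r ∷ T) (l ∷ ls) eq = trans (occurrences-++ (inject₁ i) (row r _) _)
    (trans (cong₂ _+_ (occurrences-inject₁ i r _) (extend-inject₁ i T ls (suc-injective eq)))
        (sym (occurrences-++ i r (concat T))))

  extend-fromℕ : ∀ (T : Tableau n) ls → Strip (shape T) ls →
    occurrences (fromℕ n) (concat (extend ls T)) + sum (shape T) ≡ sum ls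
  extend-fromℕ []      []       _ = refl
  extend-fromℕ {n} (r ∷ T) (l ∷ ls) (le , _ , h) = begin
    occurrences (fromℕ n) (row r (l ∸ length r) ++ concat (extend ls T)) + (length r + sum (shape T))
      ≡⟨ cong (_+ (length r + sum (shape T)))
          (trans (occurrences-++ (fromℕ n) (row r (l ∸ length r)) _) (cong (_+ rest) (occurrences-fromℕ r (l ∸ length r)))) ⟩
    (l ∸ length r) + rest + (length r + sum (shape T))
      ≡⟨ lemma (l ∸ length r) rest (length r) (sum (shape T)) ⟩
    (l ∸ length r) + length r + (rest + sum (shape T))
      ≡⟨ cong₂ _+_ (m∸n+n≡m le) (extend-fromℕ T ls h) ⟩
    l + sum ls ∎
    where
    open ≡-Reasoning
    rest = occurrences (fromℕ n) (concat (extend ls T))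
    lemma : ∀ u v w x → u + v + (w + x) ≡ u + w + (v + x)
    lemma = solve-∀

  strip-length : ∀ κ ls → Strip κ ls → length κ ≡ length ls
  strip-length []      []       _           = refl
  strip-length (_ ∷ κ) (_ ∷ ls) (_ , _ , h) = cong suc (strip-length κ ls h)

  -- The new letter fills exactly the new cells, so p has to be |λ| - |κ|, while the smaller letters
  -- are counted in T. Its exponent stands at the end of the vector because the new letter is the
  -- largest.
  content-extend : ∀ (T : Tableau n) ls (α : Vec ℕ n) p → Strip (shape T) ls →
    ⟦ (α ∷ʳ p) ≟ᵐ content (extend ls T) ⟧ ≡ ⟦ sum ls ≟ sum (shape T) + p ⟧ ℚ.* ⟦ α ≟ᵐ content T ⟧
  content-extend {n} T ls α p h = trans
    (⟦⟧-cong ((α ∷ʳ p) ≟ᵐ content (extend ls T)) ((sum ls ≟ sum (shape T) + p) ×-dec (α ≟ᵐ content T)) to from)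
    (⟦⟧-× (sum ls ≟ sum (shape T) + p) (α ≟ᵐ content T))
    where
    k : ℕ
    k = occurrences (fromℕ n) (concat (extend ls T))
    k+ : k + sum (shape T) ≡ sum ls
    k+ = extend-fromℕ T ls h
    content≡ : content (extend ls T) ≡ content T ∷ʳ k
    content≡ = trans (tabulate-∷ʳ (λ i → occurrences i (concat (extend ls T))))
      (cong (_∷ʳ k) (Vec.tabulate-cong
          (λ i → extend-inject₁ i T ls (trans (sym (List.length-map length T)) (strip-length (shape T) ls h)))))
    to : α ∷ʳ p ≡ content (extend ls T) → sum ls ≡ sum (shape T) + p × α ≡ content T
    to eq with Vec.∷ʳ-injective α (content T) (trans eq content≡)
    ... | α≡ , p≡ = trans (sym k+) (trans (+-comm k _) (cong (sum (shape T) +_) (sym p≡))) , α≡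
    from : sum ls ≡ sum (shape T) + p × α ≡ content T → α ∷ʳ p ≡ content (extend ls T)
    from (eq , α≡) = trans (cong₂ _∷ʳ_ α≡
        (+-cancelʳ-≡ (sum (shape T)) p k (trans (+-comm p _) (trans (sym eq) (sym k+))))) (sym content≡)

  -- The number s_λ(1^b), see `evalOnes-s`.
  #ssyt : ℕ → List ℕ → ℚ
  #ssyt b ls = ∑[ T ∈ ssyt b ls ] 1ℚ

  kostka : ∀ n → Vec ℕ n → List ℕ → ℚ
  kostka n α ls = ∑[ T ∈ ssyt n ls ] ⟦ α ≟ᵐ content T ⟧

  stripᵛ? : ∀ (κ ls : Vec ℕ L) → Dec (Strip (toList κ) (toList ls))
  stripᵛ? κ ls = strip? (toList κ) (toList ls)

  ⟦strip⟧ : (κ ls : Vec ℕ L) → ℚ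
  ⟦strip⟧ κ ls = ⟦ stripᵛ? κ ls ⟧

  #ssyt-suc : ∀ b {a} (ls : Vec ℕ L) → ls ∈ box a L →
    #ssyt (suc b) (toList ls) ≡ ∑ (box a L) (λ κ → ⟦strip⟧ κ ls ℚ.* #ssyt b (toList κ))
  #ssyt-suc b ls ls∈ = ssyt-branching ls ls∈ (λ _ → 1ℚ)

  kostka-suc : ∀ n {a} (α : Vec ℕ n) p (ls : Vec ℕ L) → ls ∈ box a L →
    kostka (suc n) (α ∷ʳ p) (toList ls) ≡
    ∑ (box a L) (λ κ → ⟦strip⟧ κ ls ℚ.* (⟦ size ls ≟ size κ + p ⟧ ℚ.* kostka n α (toList κ)))
  kostka-suc {L} n {a} α p ls ls∈ = trans (ssyt-branching ls ls∈ (λ T → ⟦ (α ∷ʳ p) ≟ᵐ content T ⟧))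
    (∑-ext (box a L) (λ κ → ⟦⟧-*-cong (stripᵛ? κ ls) (λ h → trans
      (∑-cong (ssyt n (toList κ)) (λ T T∈ → let sh = proj₂ (∈-ssyt⁻ {ls = toList κ} T∈) in trans
        (content-extend T (toList ls) α p (subst (λ t → Strip t (toList ls)) (sym sh) h))
        (cong (λ t → ⟦ size ls ≟ sum t + p ⟧ ℚ.* ⟦ α ≟ᵐ content T ⟧) sh)))
      (∑-*ˡ (ssyt n (toList κ)) ⟦ size ls ≟ size κ + p ⟧ (λ T → ⟦ α ≟ᵐ content T ⟧)))))

  empty-rows : (T : Tableau 0) → T ≡ replicate (length T) []
  empty-rows []             = refl
  empty-rows ([] ∷ T)       = cong ([] ∷_) (empty-rows T)
  empty-rows ((() ∷ _) ∷ T)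

  shape-empty : ∀ k → shape {0} (replicate k []) ≡ replicate k 0
  shape-empty zero    = refl
  shape-empty (suc k) = cong (0 ∷_) (shape-empty k)

  sum-replicate-0 : ∀ k → sum (replicate k 0) ≡ 0
  sum-replicate-0 zero    = refl
  sum-replicate-0 (suc k) = sum-replicate-0 k

  sum≡0 : ∀ ls → sum ls ≡ 0 → ls ≡ replicate (length ls) 0
  sum≡0 []          _  = refl
  sum≡0 (zero ∷ ls) eq = cong (0 ∷_) (sum≡0 ls eq)

  semistandard-empty : ∀ {n} k → Semistandard {n} (replicate k [])
  semistandard-empty zero          = [] , []
  semistandard-empty (suc zero)    = [] ∷ [] , [-]
  semistandard-empty (suc (suc k)) with semistandard-empty (suc k)
  ... | ss , cs = [] ∷ ss , [] ∷ cs

  -- Without letters only empty rows can be filled, and in one way.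
  #ssyt-zero : ∀ ls → #ssyt 0 ls ≡ ⟦ sum ls ≟ 0 ⟧
  #ssyt-zero ls with sum ls ≟ 0
  ... | yes eq = trans (∑-single (ssyt-unique 0 ls) {replicate (length ls) []}
      (∈-ssyt⁺ (semistandard-empty (length ls)) (trans (shape-empty (length ls)) (sym (sum≡0 ls eq))))
      {λ _ → 1ℚ} (λ {T} T∈ ne → contradiction
          (trans (empty-rows T) (cong (λ k → replicate k [])
          (trans (sym (List.length-map length T)) (cong length (proj₂ (∈-ssyt⁻ {ls = ls} T∈)))))) ne))
          (sym (⟦⟧-yes (sum ls ≟ 0) eq))
  ... | no ne = trans (∑-zero (ssyt 0 ls) {λ _ → 1ℚ} (λ T T∈ → contradiction
      (trans (cong sum (trans (sym (proj₂ (∈-ssyt⁻ {ls = ls} T∈)))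
          (trans (cong shape (empty-rows T)) (shape-empty (length T))))) (sum-replicate-0 (length T))) ne))
          (sym (⟦⟧-no (sum ls ≟ 0) ne))

  kostka-zero : ∀ ls → kostka 0 [] ls ≡ ⟦ sum ls ≟ 0 ⟧
  kostka-zero ls = trans (∑-ext (ssyt 0 ls) {λ T → ⟦ [] ≟ᵐ content T ⟧} {λ _ → 1ℚ} (λ T → refl)) (#ssyt-zero ls)

  kostka-degree : ∀ n (α : Vec ℕ n) (ls : Vec ℕ L) → size α ≢ size ls → kostka n α (toList ls) ≡ 0ℚ
  kostka-degree zero    []  ls ne = trans (kostka-zero (toList ls)) (⟦⟧-no (size ls ≟ 0) (ne ∘ sym))
  kostka-degree {L} (suc n) α′ ls ne with Vec.initLast α′
  ... | α , p , refl = trans (kostka-suc n α p ls (∈-box-size ls ≤-refl)) (∑-zero (box (size ls) L) (λ κ _ → term κ))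
    where
    term : ∀ κ → ⟦strip⟧ κ ls ℚ.* (⟦ size ls ≟ size κ + p ⟧ ℚ.* kostka n α (toList κ)) ≡ 0ℚ
    term κ = *-0ʳ (⟦strip⟧ κ ls) (⟦⟧-*-0 (size ls ≟ size κ + p) (λ eq →
      kostka-degree n α κ (λ α≡ → ne (trans (size-∷ʳ α p) (trans (cong (_+ p) α≡) (sym eq))))))

  -- Columns increase strictly, so b letters fill at most b rows. In the induction, ν_{i+1} ≤ κ_i
  -- shows that removing one letter moves the nonempty row up by at most one.
  #ssyt-rows : ∀ b (ν : Vec ℕ L) i → b ≤ Fin.toℕ i → lookup ν i ≢ 0 → #ssyt b (toList ν) ≡ 0ℚ
  #ssyt-rows zero    ν i _ ne = trans (#ssyt-zero (toList ν))
      (⟦⟧-no (size ν ≟ 0) (λ eq → ne (n≤0⇒n≡0 (subst (lookup ν i ≤_) eq (lookup≤size ν i)))))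
  #ssyt-rows {L} (suc b) ν (suc i) (s≤s b≤i) ne = trans (#ssyt-suc b ν (∈-box-size ν ≤-refl))
    (∑-zero (box (size ν) L) (λ κ _ → ⟦⟧-*-0 (stripᵛ? κ ν) (λ h →
      #ssyt-rows b κ (inject₁ i) (subst (b ≤_) (sym (Fin.toℕ-inject₁ i)) b≤i) (below κ ν h i ne))))
    where
    below : ∀ {L} (κ ν : Vec ℕ (suc L)) → Strip (toList κ) (toList ν) → ∀ (i : Fin L) → lookup ν (suc i) ≢ 0 → lookup κ
        (inject₁ i) ≢ 0
    below (k ∷ κ@(_ ∷ _)) (_ ∷ ν@(_ ∷ _)) (_ , cap , _) zero    ne refl = ne (n≤0⇒n≡0 cap)
    below (k ∷ κ@(_ ∷ _)) (_ ∷ ν@(_ ∷ _)) (_ , _ , h)   (suc i) ne = below κ ν h i ne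

  -- The constraints on λ₂, λ₃, … when λ / μ and λ / ν are horizontal strips, and equally those on
  -- κ₁, κ₂, … when μ / κ and ν / κ are; (m , μ) and (n , ν) are the heads and tails of μ and ν.
  Between : ∀ {L} → ℕ → ℕ → Vec ℕ L → Vec ℕ L → Vec ℕ L → Set
  Between m n []       []       []       = ⊤
  Between m n (m′ ∷ μ) (n′ ∷ ν) (x ∷ xs) = m′ ⊔ n′ ≤ x × x ≤ m ⊓ n × Between m′ n′ μ ν xs

  -- The toggle of the piecewise-linear form of RSK: every part is reflected in its interval, κ_i =
  -- max(μ_{i+1}, ν_{i+1}) + min(μ_i, ν_i) - λ_{i+1}.
  reflect : ∀ {L} → ℕ → ℕ → Vec ℕ L → Vec ℕ L → Vec ℕ L → Vec ℕ L
  reflect m n []       []       []       = []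
  reflect m n (m′ ∷ μ) (n′ ∷ ν) (x ∷ xs) = ((m′ ⊔ n′) + (m ⊓ n) ∸ x) ∷ reflect m′ n′ μ ν xs

  reflect-between : ∀ {L} m n (μ ν xs : Vec ℕ L) → Between m n μ ν xs → Between m n μ ν (reflect m n μ ν xs)
  reflect-between m n []       []       []       _ = tt
  reflect-between m n (m′ ∷ μ) (n′ ∷ ν) (x ∷ xs) (lo , hi , h) =
    ≤-trans (≤-reflexive (sym (m+n∸n≡m (m′ ⊔ n′) (m ⊓ n)))) (∸-monoʳ-≤ ((m′ ⊔ n′) + (m ⊓ n)) hi) ,
    ≤-trans (∸-monoʳ-≤ ((m′ ⊔ n′) + (m ⊓ n)) lo) (≤-reflexive (m+n∸m≡n (m′ ⊔ n′) (m ⊓ n))) ,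
    reflect-between m′ n′ μ ν xs h

  reflect-involutive : ∀ {L} m n (μ ν xs : Vec ℕ L) → Between m n μ ν xs → reflect m n μ ν (reflect m n μ ν xs) ≡ xs
  reflect-involutive m n []       []       []       _ = refl
  reflect-involutive m n (m′ ∷ μ) (n′ ∷ ν) (x ∷ xs) (lo , hi , h) = cong₂ _∷_
    (m∸[m∸n]≡n (≤-trans hi (m≤n+m (m ⊓ n) (m′ ⊔ n′)))) (reflect-involutive m′ n′ μ ν xs h)

  ⊓+⊔ : ∀ m n → (m ⊓ n) + (m ⊔ n) ≡ m + n
  ⊓+⊔ m n with ≤-total m n
  ... | inj₁ le = cong₂ _+_ (m≤n⇒m⊓n≡m le) (m≤n⇒m⊔n≡n le)
  ... | inj₂ ge = trans (cong₂ _+_ (m≥n⇒m⊓n≡n ge) (m≥n⇒m⊔n≡m ge)) (+-comm n m)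

  -- The sum of the interval ends telescopes: with max(μ₁, ν₁) added, the minimum and the maximum of
  -- each row combine to μ_i + ν_i. Only the minimum in the last row has no place in the sum, and it
  -- is 0 because ν ends in 0.
  size-reflect : ∀ {L} m n (μ ν xs : Vec ℕ L) → Between m n μ ν xs → lookup (n ∷ ν) (fromℕ L) ≡ 0 →
    size (reflect m n μ ν xs) + (size xs + (m ⊔ n)) ≡ (m + size μ) + (n + size ν)
  size-reflect m zero []       []       []       _ _ = trans (⊔-identityʳ m) (lemma m)
    where
    lemma : ∀ m → m ≡ m + 0 + 0
    lemma = solve-∀
  size-reflect m n (m′ ∷ μ) (n′ ∷ ν) (x ∷ xs) (lo , hi , h) last = begin
    (A ∸ x) + size r + (x + size xs + (m ⊔ n))         ≡⟨ lemma₁ (A ∸ x) (size r) x (size xs) (m ⊔ n) ⟩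
    ((A ∸ x) + x) + (size r + size xs) +
        (m ⊔ n)       ≡⟨ cong (λ t → t + (size r + size xs) + (m ⊔ n)) (m∸n+n≡m (≤-trans hi (m≤n+m (m ⊓ n) (m′ ⊔ n′)))) ⟩
    A + (size r + size xs) + (m ⊔ n)                   ≡⟨ lemma₂ (m′ ⊔ n′) (m ⊓ n) (size r) (size xs) (m ⊔ n) ⟩
    ((m ⊓ n) + (m ⊔ n)) + (size r + (size xs + (m′ ⊔ n′))) ≡⟨ cong₂ _+_ (⊓+⊔ m n) (size-reflect m′ n′ μ ν xs h last) ⟩
    (m + n) + ((m′ + size μ) + (n′ + size ν))          ≡⟨ lemma₃ m n (m′ + size μ) (n′ + size ν) ⟩
    (m + (m′ + size μ)) + (n + (n′ + size ν))          ∎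
    where
    open ≡-Reasoning
    A = (m′ ⊔ n′) + (m ⊓ n)
    r = reflect m′ n′ μ ν xs
    lemma₁ : ∀ d s x t u → d + s + (x + t + u) ≡ (d + x) + (s + t) + u
    lemma₁ = solve-∀
    lemma₂ : ∀ b c s t u → b + c + (s + t) + u ≡ (c + u) + (s + (t + b))
    lemma₂ = solve-∀
    lemma₃ : ∀ m n s t → (m + n) + (s + t) ≡ (m + s) + (n + t)
    lemma₃ = solve-∀

  between⇒upper : ∀ {L} m n (μ ν xs : Vec ℕ L) → Between m n μ ν xs → ∀ l → m ⊔ n ≤ l →
    Strip (toList (m ∷ μ)) (toList (l ∷ xs)) × Strip (toList (n ∷ ν)) (toList (l ∷ xs))
  between⇒upper m n []       []       []       _ l le = (m⊔n≤o⇒m≤o m n le , tt , tt) , (m⊔n≤o⇒n≤o m n le , tt , tt)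
  between⇒upper m n (m′ ∷ μ) (n′ ∷ ν) (x ∷ xs) (lo , hi , h) l le with between⇒upper m′ n′ μ ν xs h x lo
  ... | s₁ , s₂ = (m⊔n≤o⇒m≤o m n le , m≤n⊓o⇒m≤n m n hi , s₁) , (m⊔n≤o⇒n≤o m n le , m≤n⊓o⇒m≤o m n hi , s₂)

  upper⇒between : ∀ {L} m n (μ ν xs : Vec ℕ L) l →
    Strip (toList (m ∷ μ)) (toList (l ∷ xs)) → Strip (toList (n ∷ ν)) (toList (l ∷ xs)) → m ⊔ n ≤ l × Between m n μ ν xs
  upper⇒between m n []       []       []       l (le₁ , _) (le₂ , _) = ⊔-lub le₁ le₂ , tt
  upper⇒between m n (m′ ∷ μ) (n′ ∷ ν) (x ∷ xs) l (le₁ , c₁ , s₁) (le₂ , c₂ , s₂) with upper⇒between m′ n′ μ ν xs x s₁ s₂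
  ... | lo , h = ⊔-lub le₁ le₂ , lo , ⊓-glb c₁ c₂ , h

  between⇒lower : ∀ {L} m n (μ ν xs : Vec ℕ L) → Between m n μ ν xs →
    Strip (toList (xs ∷ʳ 0)) (toList (m ∷ μ)) × Strip (toList (xs ∷ʳ 0)) (toList (n ∷ ν))
  between⇒lower m n []       []       []       _ = (z≤n , tt , tt) , (z≤n , tt , tt)
  between⇒lower m n (m′ ∷ μ) (n′ ∷ ν) (x ∷ xs) (lo , hi , h) with between⇒lower m′ n′ μ ν xs h
  ... | s₁ , s₂ = (m≤n⊓o⇒m≤n m n hi , m⊔n≤o⇒m≤o m′ n′ lo , s₁) , (m≤n⊓o⇒m≤o m n hi , m⊔n≤o⇒n≤o m′ n′ lo , s₂)

  lower⇒between : ∀ {L} m n (μ ν xs : Vec ℕ L) →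
    Strip (toList (xs ∷ʳ 0)) (toList (m ∷ μ)) → Strip (toList (xs ∷ʳ 0)) (toList (n ∷ ν)) → Between m n μ ν xs
  lower⇒between m n []       []       []       _ _ = tt
  lower⇒between m n (m′ ∷ μ) (n′ ∷ ν) (x ∷ xs) (le₁ , c₁ , s₁) (le₂ , c₂ , s₂) =
    ⊔-lub c₁ c₂ , ⊓-glb le₁ le₂ , lower⇒between m′ n′ μ ν xs s₁ s₂

  ⟦⟧-×₃ : ∀ {P Q R : Set} (p : Dec P) (q : Dec Q) (r : Dec R) → ⟦ p ×-dec q ×-dec r ⟧ ≡ ⟦ p ⟧ ℚ.* (⟦ q ⟧ ℚ.* ⟦ r ⟧)
  ⟦⟧-×₃ p q r = trans (⟦⟧-× p (q ×-dec r)) (cong (⟦ p ⟧ ℚ.*_) (⟦⟧-× q r))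

  ∑-⟦⟧ : ∀ {A : Set} {P : A → Set} (P? : ∀ x → Dec (P x)) xs → ∑ (filter P? xs) (λ _ → 1ℚ) ≡ ∑ xs (λ x → ⟦ P? x ⟧)
  ∑-⟦⟧ P? xs = trans (∑-filter P? xs (λ _ → 1ℚ)) (∑-ext xs (λ x → ℚ.*-identityʳ ⟦ P? x ⟧))

  -- Fomin's local rule for RSK: λ₁ is determined by the size of λ, and the other
  -- parts of λ and those of κ range over the same intervals, up to reflection.
  local-rule : ∀ {L a} (μ ν : Vec ℕ (suc L)) p → lookup ν (fromℕ L) ≡ 0 → size μ + p ≤ a →
    ∑ (box a (suc L)) (λ ls → ⟦strip⟧ μ ls ℚ.* (⟦strip⟧ ν ls ℚ.* ⟦ size ls ≟ size μ + p ⟧)) ≡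
    ∑ (box a (suc L)) (λ κ → ⟦strip⟧ κ μ ℚ.* (⟦strip⟧ κ ν ℚ.* ⟦ size ν ≤? size κ + p ⟧))
  local-rule {L} {a} μ₀@(m ∷ μ) ν₀@(n ∷ ν) p ν-last bound = begin
    ∑ B (λ ls → ⟦strip⟧ μ₀ ls ℚ.* (⟦strip⟧ ν₀ ls ℚ.* ⟦ size ls ≟ size μ₀ + p ⟧))
      ≡⟨ ∑-ext B (λ ls → sym (⟦⟧-×₃ (stripᵛ? μ₀ ls) (stripᵛ? ν₀ ls) (size ls ≟ size μ₀ + p))) ⟩
    ∑ B (λ ls → ⟦ U? ls ⟧)
      ≡⟨ sym (∑-⟦⟧ U? B) ⟩
    ∑ (filter U? B) (λ _ → 1ℚ)
      ≡⟨ ∑-bij (Unique.filter⁺ U? (box-unique a (suc L))) (Unique.filter⁺ D? (box-unique a (suc L))) f into inj onto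
          {λ _ → 1ℚ} {λ _ → 1ℚ} (λ _ → refl) ⟩
    ∑ (filter D? B) (λ _ → 1ℚ)
      ≡⟨ ∑-⟦⟧ D? B ⟩
    ∑ B (λ κ → ⟦ D? κ ⟧)
      ≡⟨ ∑-ext B (λ κ → ⟦⟧-×₃ (stripᵛ? κ μ₀) (stripᵛ? κ ν₀) (size ν₀ ≤? size κ + p)) ⟩
    ∑ B (λ κ → ⟦strip⟧ κ μ₀ ℚ.* (⟦strip⟧ κ ν₀ ℚ.* ⟦ size ν₀ ≤? size κ + p ⟧)) ∎
    where
    open ≡-Reasoning
    B = box a (suc L)
    U D : Vec ℕ (suc L) → Set
    U ls = Strip (toList μ₀) (toList ls) × Strip (toList ν₀) (toList ls) × size ls ≡ size μ₀ + p
    D κ = Strip (toList κ) (toList μ₀) × Strip (toList κ) (toList ν₀) × size ν₀ ≤ size κ + p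
    U? : ∀ ls → Dec (U ls)
    U? ls = stripᵛ? μ₀ ls ×-dec stripᵛ? ν₀ ls ×-dec (size ls ≟ size μ₀ + p)
    D? : ∀ κ → Dec (D κ)
    D? κ = stripᵛ? κ μ₀ ×-dec stripᵛ? κ ν₀ ×-dec (size ν₀ ≤? size κ + p)
    R : Vec ℕ L → Vec ℕ L
    R = reflect m n μ ν
    f : Vec ℕ (suc L) → Vec ℕ (suc L)
    f (l ∷ xs) = R xs ∷ʳ 0
    size-f : ∀ xs → size (R xs ∷ʳ 0) ≡ size (R xs)
    size-f xs = trans (size-∷ʳ (R xs) 0) (+-identityʳ _)
    into : ∀ {ls} → ls ∈ filter U? B → f ls ∈ filter D? B
    into {l ∷ xs} ls∈ with Mem.∈-filter⁻ U? {xs = B} ls∈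
    ... | ls∈B , s₁ , s₂ , sz with upper⇒between m n μ ν xs l s₁ s₂
    ... | le , h with between⇒lower m n μ ν (R xs) (reflect-between m n μ ν xs h)
    ... | d₁ , d₂ = Mem.∈-filter⁺ D?
        (∈-box⁺ (λ i → ≤-trans (strip-≤ (R xs ∷ʳ 0) μ₀ d₁ i)
        (≤-trans (lookup≤size μ₀ i) (≤-trans (m≤m+n (size μ₀) p) bound))))
      -- By `size-reflect`, λ₁ ≥ max(μ₁, ν₁) turns into |ν| ≤ |κ| + p.
      (d₁ , d₂ , +-cancelˡ-≤ (size μ₀) _ _ (≤-trans (≤-reflexive (sym (size-reflect m n μ ν xs h ν-last)))
        (≤-trans (+-monoʳ-≤ (size (R xs)) (≤-trans (+-monoʳ-≤ (size xs) le) (≤-reflexive (trans (+-comm (size xs) l) sz))))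
        (≤-reflexive (trans (lemma (size (R xs)) (size μ₀) p) (cong (λ t → size μ₀ + (t + p)) (sym (size-f xs))))))))
      where
      lemma : ∀ r s p → r + (s + p) ≡ s + (r + p)
      lemma = solve-∀
    inj : ∀ {ls ls′} → ls ∈ filter U? B → ls′ ∈ filter U? B → f ls ≡ f ls′ → ls ≡ ls′
    inj {l ∷ xs} {l′ ∷ xs′} ls∈ ls′∈ eq with Mem.∈-filter⁻ U? {xs = B} ls∈ | Mem.∈-filter⁻ U? {xs = B} ls′∈
    ... | _ , s₁ , s₂ , sz | _ , s₁′ , s₂′ , sz′ = cong₂ _∷_
        (+-cancelʳ-≡ (size xs) l l′ (trans sz (trans (sym sz′) (cong (λ t → l′ + size t) (sym xs≡))))) xs≡
      where
      xs≡ : xs ≡ xs′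
      xs≡ = trans (sym (reflect-involutive m n μ ν xs (proj₂ (upper⇒between m n μ ν xs l s₁ s₂))))
        (trans (cong R (Vec.∷ʳ-injectiveˡ (R xs) (R xs′) eq))
            (reflect-involutive m n μ ν xs′ (proj₂ (upper⇒between m n μ ν xs′ l′ s₁′ s₂′))))
    onto : ∀ {κ} → κ ∈ filter D? B → ∃ λ ls → ls ∈ filter U? B × f ls ≡ κ
    onto {κ₀} κ∈ with Mem.∈-filter⁻ D? {xs = B} κ∈ | Vec.initLast κ₀
    -- The last part of κ is at most that of ν, hence 0; the parts before it are the reflections of
    -- λ₂, λ₃, ....
    ... | _ , d₁ , d₂ , sz | κ , y , refl with n≤0⇒n≡0 (subst₂ _≤_ (lookup-∷ʳ κ y) ν-last (strip-≤ (κ ∷ʳ y) ν₀ d₂ (fromℕ L)))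
    ... | refl = l ∷ R κ , Mem.∈-filter⁺ U? (∈-box-size (l ∷ R κ) (≤-trans (≤-reflexive size≡) bound))
        (proj₁ up , proj₂ up , size≡) ,
        cong (_∷ʳ 0) (reflect-involutive m n μ ν κ btw)
      where
      btw : Between m n μ ν κ
      btw = lower⇒between m n μ ν κ d₁ d₂
      l : ℕ
      l = size μ₀ + p ∸ size (R κ)
      total : size κ + (size (R κ) + (m ⊔ n)) ≡ size μ₀ + size ν₀
      total = trans (cong (λ t → size t + (size (R κ) + (m ⊔ n))) (sym (reflect-involutive m n μ ν κ btw)))
        (size-reflect m n μ ν (R κ) (reflect-between m n μ ν κ btw) ν-last)
      -- Here |ν| ≤ |κ| + p enters: it leaves room for a first part of at least max(μ₁, ν₁).
      enough : size (R κ) + (m ⊔ n) ≤ size μ₀ + p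
      enough = +-cancelˡ-≤ (size κ) _ _
          (≤-trans (≤-reflexive total) (≤-trans
          (+-monoʳ-≤ (size μ₀) (≤-trans sz (≤-reflexive (cong (_+ p) (trans (size-∷ʳ κ 0) (+-identityʳ _))))))
        (≤-reflexive (lemma (size μ₀) (size κ) p))))
        where
        lemma : ∀ s k p → s + (k + p) ≡ k + (s + p)
        lemma = solve-∀
      size≡ : l + size (R κ) ≡ size μ₀ + p
      size≡ = m∸n+n≡m (≤-trans (m≤m+n (size (R κ)) (m ⊔ n)) enough)
      up : Strip (toList μ₀) (toList (l ∷ R κ)) × Strip (toList ν₀) (toList (l ∷ R κ))
      up = between⇒upper m n μ ν (R κ) (reflect-between m n μ ν κ btw) l
        (+-cancelˡ-≤ (size (R κ)) _ _ (≤-trans enough (≤-reflexive (trans (sym size≡) (+-comm l (size (R κ)))))))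

-- The Pieri rule and Cauchy's identity at 1^b

module Cauchy where

  open RationalSums
  open Branching
  open LocalRule
  open import Data.Nat.Base
  open import Data.Nat.Properties
  open import Data.Rational.Base using (ℚ; 0ℚ; 1ℚ)

  private variable
    L : ℕ

  -- Splits the inequality of the local rule according to the size j of the strip ν / κ, the form to
  -- which the induction hypothesis of `pieri` applies.
  ∑-⟦≟⟧ : ∀ k v p → k ≤ v → ∑ (upTo (suc p)) (λ j → ⟦ v ≟ k + j ⟧) ≡ ⟦ v ≤? k + p ⟧
  ∑-⟦≟⟧ k v p k≤v with v ≤? k + p
  ... | yes le = trans (∑-⟦⟧-1 (λ j → v ≟ k + j) (Unique.upTo⁺ (suc p)) (Mem.∈-upTo⁺ (s≤s (m≤n+o⇒m∸n≤o v k le)))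
      (sym (m+[n∸m]≡n k≤v)) (λ {j} eq → trans (sym (m+n∸m≡n k j)) (cong (_∸ k) (sym eq))))
      (sym (⟦⟧-yes (v ≤? k + p) le))
  ... | no nle = trans (∑-zero (upTo (suc p))
      (λ j j∈ → ⟦⟧-no (v ≟ k + j) (λ eq → nle (subst (_≤ k + p) (sym eq) (+-monoʳ-≤ k (s≤s⁻¹ (Mem.∈-upTo⁻ j∈)))))))
      (sym (⟦⟧-no (v ≤? k + p) nle))

  strip-size : ∀ (κ ls : Vec ℕ L) → Strip (toList κ) (toList ls) → size κ ≤ size ls
  strip-size []      []       _           = z≤n
  strip-size (k ∷ κ) (l ∷ ls) (le , _ , h) = +-mono-≤ le (strip-size κ ls h)

  strip-0 : ∀ L → Strip (toList (Vec.replicate L 0)) (toList (Vec.replicate L 0))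
  strip-0 zero          = tt
  strip-0 (suc zero)    = z≤n , tt , tt
  strip-0 (suc (suc L)) = z≤n , z≤n , strip-0 (suc L)

  ∑-size-0 : ∀ {a} (G : Vec ℕ L → ℚ) → ∑ (box a L) (λ v → ⟦ size v ≟ 0 ⟧ ℚ.* G v) ≡ G (Vec.replicate L 0)
  ∑-size-0 {L} {a} G = ∑-⟦⟧-* (λ v → size v ≟ 0) (box-unique a L)
    (∈-box-size (Vec.replicate L 0) (≤-trans (≤-reflexive (size-0 L)) z≤n)) (size-0 L) (λ {v} → size≡0 v) G

  -- The factor `multichoose b p` is h_p(1^b). In the step, s_λ(1^(b+1)) is the sum of s_ν(1^b) over
  -- strips λ / ν. The local rule replaces λ, which contains μ and ν, by a shape κ contained in
  -- both, and the induction hypothesis then evaluates the sum over ν.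
  pieri : ∀ b {L a} → b ≤ suc L → (μ : Vec ℕ (suc L)) (p : ℕ) → size μ + p ≤ a →
    ∑ (box a (suc L)) (λ ls → ⟦strip⟧ μ ls ℚ.* (⟦ size ls ≟ size μ + p ⟧ ℚ.* #ssyt b (toList ls)))
    ≡ multichoose b p ℚ.* #ssyt b (toList μ)
  pieri zero {L} {a} _ μ p bound = begin
    ∑ B (λ ls → ⟦strip⟧ μ ls ℚ.* (⟦ size ls ≟ size μ + p ⟧ ℚ.* #ssyt 0 (toList ls)))
      ≡⟨ ∑-ext B (λ ls → trans (cong (λ t → ⟦strip⟧ μ ls ℚ.* (⟦ size ls ≟ size μ + p ⟧ ℚ.* t)) (#ssyt-zero (toList ls)))
           (shuffle (⟦strip⟧ μ ls) ⟦ size ls ≟ size μ + p ⟧ ⟦ size ls ≟ 0 ⟧)) ⟩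
    ∑ B (λ ls → ⟦ size ls ≟ 0 ⟧ ℚ.* (⟦strip⟧ μ ls ℚ.* ⟦ size ls ≟ size μ + p ⟧))
      ≡⟨ ∑-size-0 {suc L} {a} (λ ls → ⟦strip⟧ μ ls ℚ.* ⟦ size ls ≟ size μ + p ⟧) ⟩
    ⟦strip⟧ μ 0⃗ ℚ.* ⟦ size 0⃗ ≟ size μ + p ⟧
      ≡⟨ sym (⟦⟧-× (stripᵛ? μ 0⃗) (size 0⃗ ≟ size μ + p)) ⟩
    ⟦ stripᵛ? μ 0⃗ ×-dec (size 0⃗ ≟ size μ + p) ⟧
      ≡⟨ ⟦⟧-cong (stripᵛ? μ 0⃗ ×-dec (size 0⃗ ≟ size μ + p)) ((p ≟ 0) ×-dec (size μ ≟ 0)) to from ⟩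
    ⟦ (p ≟ 0) ×-dec (size μ ≟ 0) ⟧
      ≡⟨ ⟦⟧-× (p ≟ 0) (size μ ≟ 0) ⟩
    ⟦ p ≟ 0 ⟧ ℚ.* ⟦ size μ ≟ 0 ⟧
      ≡⟨ cong (⟦ p ≟ 0 ⟧ ℚ.*_) (sym (#ssyt-zero (toList μ))) ⟩
    ⟦ p ≟ 0 ⟧ ℚ.* #ssyt 0 (toList μ) ∎
    where
    open ≡-Reasoning
    B = box a (suc L)
    0⃗ : Vec ℕ (suc L)
    0⃗ = Vec.replicate (suc L) 0
    shuffle : ∀ x y z → x ℚ.* (y ℚ.* z) ≡ z ℚ.* (x ℚ.* y)
    shuffle x y z = trans (sym (ℚ.*-assoc x y z)) (ℚ.*-comm (x ℚ.* y) z)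
    to : Strip (toList μ) (toList 0⃗) × size 0⃗ ≡ size μ + p → p ≡ 0 × size μ ≡ 0
    to (_ , eq) = m+n≡0⇒n≡0 (size μ) 0≡ , m+n≡0⇒m≡0 (size μ) 0≡
      where 0≡ = trans (sym eq) (size-0 (suc L))
    from : p ≡ 0 × size μ ≡ 0 → Strip (toList μ) (toList 0⃗) × size 0⃗ ≡ size μ + p
    from (p≡ , μ≡) = subst (λ v → Strip (toList v) (toList 0⃗)) (sym (size≡0 μ μ≡)) (strip-0 (suc L)) ,
      trans (size-0 (suc L)) (sym (cong₂ _+_ μ≡ p≡))
  pieri (suc b) {L} {a} (s≤s b≤L) μ p bound = begin
    ∑ B (λ ls → S μ ls ℚ.* (⟦ size ls ≟ size μ + p ⟧ ℚ.* #ssyt (suc b) (toList ls)))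
      ≡⟨ ∑-cong B (λ ls ls∈ → trans (cong (λ t → S μ ls ℚ.* (⟦ size ls ≟ size μ + p ⟧ ℚ.* t)) (#ssyt-suc b ls ls∈))
           (sym (ℚ.*-assoc (S μ ls) ⟦ size ls ≟ size μ + p ⟧ (∑ B (λ ν → S ν ls ℚ.* F ν))))) ⟩
    ∑ B (λ ls → (S μ ls ℚ.* ⟦ size ls ≟ size μ + p ⟧) ℚ.* ∑ B (λ ν → S ν ls ℚ.* F ν))
      ≡⟨ ∑-∑-* B B (λ ls → S μ ls ℚ.* ⟦ size ls ≟ size μ + p ⟧) (λ ls ν → S ν ls ℚ.* F ν) ⟩
    ∑ B (λ ν → ∑ B (λ ls → (S μ ls ℚ.* ⟦ size ls ≟ size μ + p ⟧) ℚ.* (S ν ls ℚ.* F ν)))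
      ≡⟨ ∑-ext B (λ ν → trans (∑-ext B (λ ls → shuffle₁ (S μ ls) ⟦ size ls ≟ size μ + p ⟧ (S ν ls) (F ν)))
           (∑-*ʳ B (F ν) (λ ls → S μ ls ℚ.* (S ν ls ℚ.* ⟦ size ls ≟ size μ + p ⟧)))) ⟩
    ∑ B (λ ν → ∑ B (λ ls → S μ ls ℚ.* (S ν ls ℚ.* ⟦ size ls ≟ size μ + p ⟧)) ℚ.* F ν)
      ≡⟨ ∑-ext B (λ ν → local ν (lookup ν (fromℕ L) ≟ 0)) ⟩
    ∑ B (λ ν → ∑ B (λ κ → S κ μ ℚ.* (S κ ν ℚ.* ⟦ size ν ≤? size κ + p ⟧)) ℚ.* F ν)
      ≡⟨ ∑-ext B (λ ν → trans (cong (ℚ._* F ν) (∑-ext B (λ κ → cong (S κ μ ℚ.*_) (⟦⟧-*-cong (stripᵛ? κ ν) (λ h →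
           sym (∑-⟦≟⟧ (size κ) (size ν) p (strip-size κ ν h)))))))
               (sym (∑-*ʳ B (F ν) (λ κ → S κ μ ℚ.* (S κ ν ℚ.* ∑ Js (λ j → ⟦ size ν ≟ size κ + j ⟧)))))) ⟩
    ∑ B (λ ν → ∑ B (λ κ → (S κ μ ℚ.* (S κ ν ℚ.* ∑ Js (λ j → ⟦ size ν ≟ size κ + j ⟧))) ℚ.* F ν))
      ≡⟨ ∑-swap B B (λ ν κ → (S κ μ ℚ.* (S κ ν ℚ.* ∑ Js (λ j → ⟦ size ν ≟ size κ + j ⟧))) ℚ.* F ν) ⟩
    ∑ B (λ κ → ∑ B (λ ν → (S κ μ ℚ.* (S κ ν ℚ.* ∑ Js (λ j → ⟦ size ν ≟ size κ + j ⟧))) ℚ.* F ν))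
      ≡⟨ ∑-ext B (λ κ → trans (∑-ext B (λ ν → expand κ ν))
          (∑-*ˡ B (S κ μ) (λ ν → ∑ Js (λ j → S κ ν ℚ.* (⟦ size ν ≟ size κ + j ⟧ ℚ.* F ν))))) ⟩
    ∑ B (λ κ → S κ μ ℚ.* ∑ B (λ ν → ∑ Js (λ j → S κ ν ℚ.* (⟦ size ν ≟ size κ + j ⟧ ℚ.* F ν))))
      ≡⟨ ∑-ext B (λ κ → ⟦⟧-*-cong (stripᵛ? κ μ)
          (λ h → trans (∑-swap B Js (λ ν j → S κ ν ℚ.* (⟦ size ν ≟ size κ + j ⟧ ℚ.* F ν)))
           (∑-cong Js (λ j j∈ → pieri b (m≤n⇒m≤1+n b≤L) κ j
               (≤-trans (+-mono-≤ (strip-size κ μ h) (s≤s⁻¹ (Mem.∈-upTo⁻ j∈))) bound))))) ⟩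
    ∑ B (λ κ → S κ μ ℚ.* ∑ Js (λ j → multichoose b j ℚ.* F κ))
      -- By definition the sum of `multichoose b j` over j ≤ p is `multichoose (suc b) p`.
      ≡⟨ ∑-ext B (λ κ → trans (cong (S κ μ ℚ.*_) (∑-*ʳ Js (F κ) (multichoose b)))
          (*-swap (S κ μ) (multichoose (suc b) p) (F κ))) ⟩
    ∑ B (λ κ → multichoose (suc b) p ℚ.* (S κ μ ℚ.* F κ))
      ≡⟨ ∑-*ˡ B (multichoose (suc b) p) (λ κ → S κ μ ℚ.* F κ) ⟩
    multichoose (suc b) p ℚ.* ∑ B (λ κ → S κ μ ℚ.* F κ)
      ≡⟨ cong (multichoose (suc b) p ℚ.*_) (sym (#ssyt-suc b μ (∈-box-size μ (≤-trans (m≤m+n (size μ) p) bound)))) ⟩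
    multichoose (suc b) p ℚ.* #ssyt (suc b) (toList μ) ∎
    where
    open ≡-Reasoning
    B = box a (suc L)
    Js = upTo (suc p)
    S : Vec ℕ (suc L) → Vec ℕ (suc L) → ℚ
    S = ⟦strip⟧
    F : Vec ℕ (suc L) → ℚ
    F ν = #ssyt b (toList ν)
    shuffle₁ : ∀ w x y z → (w ℚ.* x) ℚ.* (y ℚ.* z) ≡ (w ℚ.* (y ℚ.* x)) ℚ.* z
    shuffle₁ w x y z = trans (sym (ℚ.*-assoc (w ℚ.* x) y z))
        (cong (ℚ._* z) (trans (ℚ.*-assoc w x y) (cong (w ℚ.*_) (ℚ.*-comm x y))))
    -- If the last row of ν is not empty, both sides vanish: its index L is at least b, out of reach
    -- of b letters.
    local : ∀ ν → Dec (lookup ν (fromℕ L) ≡ 0) →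
      ∑ B (λ ls → S μ ls ℚ.* (S ν ls ℚ.* ⟦ size ls ≟ size μ + p ⟧)) ℚ.* F ν ≡
      ∑ B (λ κ → S κ μ ℚ.* (S κ ν ℚ.* ⟦ size ν ≤? size κ + p ⟧)) ℚ.* F ν
    local ν (yes eq) = cong (ℚ._* F ν) (local-rule μ ν p eq bound)
    local ν (no ne)  = trans (kill (∑ B (λ ls → S μ ls ℚ.* (S ν ls ℚ.* ⟦ size ls ≟ size μ + p ⟧))))
      (sym (kill (∑ B (λ κ → S κ μ ℚ.* (S κ ν ℚ.* ⟦ size ν ≤? size κ + p ⟧)))))
      where
      kill : ∀ q → q ℚ.* F ν ≡ 0ℚ
      kill q = *-0ʳ q (#ssyt-rows b ν (fromℕ L) (subst (b ≤_) (sym (Fin.toℕ-fromℕ L)) b≤L) ne)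
    expand : ∀ κ ν → (S κ μ ℚ.* (S κ ν ℚ.* ∑ Js (λ j → ⟦ size ν ≟ size κ + j ⟧))) ℚ.* F ν ≡
      S κ μ ℚ.* ∑ Js (λ j → S κ ν ℚ.* (⟦ size ν ≟ size κ + j ⟧ ℚ.* F ν))
    expand κ ν = trans (ℚ.*-assoc (S κ μ) (S κ ν ℚ.* ∑ Js (λ j → ⟦ size ν ≟ size κ + j ⟧)) (F ν))
        (cong (S κ μ ℚ.*_) (trans (ℚ.*-assoc (S κ ν) (∑ Js (λ j → ⟦ size ν ≟ size κ + j ⟧)) (F ν))
      (trans (cong (S κ ν ℚ.*_) (sym (∑-*ʳ Js (F ν) (λ j → ⟦ size ν ≟ size κ + j ⟧))))
          (sym (∑-*ˡ Js (S κ ν) (λ j → ⟦ size ν ≟ size κ + j ⟧ ℚ.* F ν))))))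

  -- The coefficient of x^α in ∏ᵢ (1 - xᵢ)⁻ᵇ.
  ∏multichoose : ℕ → ∀ {n} → Vec ℕ n → ℚ
  ∏multichoose b []      = 1ℚ
  ∏multichoose b (k ∷ α) = multichoose b k ℚ.* ∏multichoose b α

  ∏multichoose-∷ʳ : ∀ b {n} (α : Vec ℕ n) p → ∏multichoose b (α ∷ʳ p) ≡ multichoose b p ℚ.* ∏multichoose b α
  ∏multichoose-∷ʳ b []      p = refl
  ∏multichoose-∷ʳ b (k ∷ α) p = trans (cong (multichoose b k ℚ.*_) (∏multichoose-∷ʳ b α p))
    (*-swap (multichoose b k) (multichoose b p) (∏multichoose b α))

  #ssyt-0⃗ : ∀ b L → #ssyt b (toList (Vec.replicate L 0)) ≡ 1ℚ
  #ssyt-0⃗ zero    L = trans (#ssyt-zero (toList (Vec.replicate L 0))) (⟦⟧-yes (size (Vec.replicate L 0) ≟ 0) (size-0 L))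
  #ssyt-0⃗ (suc b) L = trans (#ssyt-suc b {0} 0⃗ (∈-box-size 0⃗ (≤-reflexive (size-0 L))))
    (trans (∑-⟦⟧-* (λ κ → stripᵛ? κ 0⃗) (box-unique 0 L) (∈-box-size 0⃗ (≤-reflexive (size-0 L))) (strip-0 L)
        (λ {κ} h → size≡0 κ (n≤0⇒n≡0 (subst (size κ ≤_) (size-0 L) (strip-size κ 0⃗ h)))) (#ssyt b ∘ toList))
      (#ssyt-0⃗ b L))
    where
    0⃗ : Vec ℕ L
    0⃗ = Vec.replicate L 0

  -- Cauchy's identity with the second set of variables specialised to 1^b. The last exponent p is
  -- the size of a strip λ / κ; summing over the outer shape λ by `pieri` splits off the factor
  -- h_p(1^b).
  cauchy : ∀ b {L a} → b ≤ suc L → ∀ n (α : Vec ℕ n) → size α ≤ a →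
    ∑ (box a (suc L)) (λ ls → kostka n α (toList ls) ℚ.* #ssyt b (toList ls)) ≡ ∏multichoose b α
  cauchy b {L} {a} b≤ zero [] _ = trans
      (∑-ext (box a (suc L)) (λ ls → cong (ℚ._* #ssyt b (toList ls)) (kostka-zero (toList ls))))
    (trans (∑-size-0 {suc L} {a} (λ ls → #ssyt b (toList ls))) (#ssyt-0⃗ b (suc L)))
  cauchy b {L} {a} b≤ (suc n) α′ bound with Vec.initLast α′
  ... | α , p , refl = begin
    ∑ B (λ ls → kostka (suc n) (α ∷ʳ p) (toList ls) ℚ.* F ls)
      ≡⟨ ∑-cong B (λ ls ls∈ → trans (ℚ.*-comm (kostka (suc n) (α ∷ʳ p) (toList ls)) (F ls))
          (cong (F ls ℚ.*_) (kostka-suc n α p ls ls∈))) ⟩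
    ∑ B (λ ls → F ls ℚ.* ∑ B (λ κ → ⟦strip⟧ κ ls ℚ.* (⟦ size ls ≟ size κ + p ⟧ ℚ.* K κ)))
      ≡⟨ ∑-∑-* B B F (λ ls κ → ⟦strip⟧ κ ls ℚ.* (⟦ size ls ≟ size κ + p ⟧ ℚ.* K κ)) ⟩
    ∑ B (λ κ → ∑ B (λ ls → F ls ℚ.* (⟦strip⟧ κ ls ℚ.* (⟦ size ls ≟ size κ + p ⟧ ℚ.* K κ))))
      ≡⟨ ∑-ext B (λ κ → trans (∑-ext B (λ ls → shuffle (F ls) (⟦strip⟧ κ ls) ⟦ size ls ≟ size κ + p ⟧ (K κ)))
          (∑-*ˡ B (K κ) (λ ls → ⟦strip⟧ κ ls ℚ.* (⟦ size ls ≟ size κ + p ⟧ ℚ.* F ls)))) ⟩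
    ∑ B (λ κ → K κ ℚ.* ∑ B (λ ls → ⟦strip⟧ κ ls ℚ.* (⟦ size ls ≟ size κ + p ⟧ ℚ.* F ls)))
      ≡⟨ ∑-ext B (λ κ → step κ (size α ≟ size κ)) ⟩
    ∑ B (λ κ → multichoose b p ℚ.* (K κ ℚ.* F κ))
      ≡⟨ ∑-*ˡ B (multichoose b p) (λ κ → K κ ℚ.* F κ) ⟩
    multichoose b p ℚ.* ∑ B (λ κ → K κ ℚ.* F κ)
      ≡⟨ cong (multichoose b p ℚ.*_) (cauchy b b≤ n α (≤-trans (m≤m+n (size α) p) (subst (_≤ a) (size-∷ʳ α p) bound))) ⟩
    multichoose b p ℚ.* ∏multichoose b α
      ≡⟨ sym (∏multichoose-∷ʳ b α p) ⟩
    ∏multichoose b (α ∷ʳ p) ∎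
    where
    open ≡-Reasoning
    B = box a (suc L)
    F K : Vec ℕ (suc L) → ℚ
    F ls = #ssyt b (toList ls)
    K ls = kostka n α (toList ls)
    shuffle : ∀ f s e k → f ℚ.* (s ℚ.* (e ℚ.* k)) ≡ k ℚ.* (s ℚ.* (e ℚ.* f))
    shuffle f s e k = trans (cong (f ℚ.*_) (trans (sym (ℚ.*-assoc s e k)) (ℚ.*-comm (s ℚ.* e) k)))
      (trans (*-swap f k (s ℚ.* e)) (cong (k ℚ.*_) (trans (ℚ.*-comm f (s ℚ.* e)) (ℚ.*-assoc s e f))))
    -- If |κ| = |α|, the size bound of `pieri` follows from |α| + p ≤ a; for every other κ the
    -- Kostka number is 0.
    step : ∀ κ → Dec (size α ≡ size κ) → K κ ℚ.* ∑ B (λ ls → ⟦strip⟧ κ ls ℚ.* (⟦ size ls ≟ size κ + p ⟧ ℚ.* F ls)) ≡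
      multichoose b p ℚ.* (K κ ℚ.* F κ)
    step κ (yes eq) = trans (cong (K κ ℚ.*_) (pieri b b≤ κ p (subst (_≤ a) (trans (size-∷ʳ α p) (cong (_+ p) eq)) bound)))
      (*-swap (K κ) (multichoose b p) (F κ))
    step κ (no ne) = trans (*-0ˡ K≡0 (∑ B (λ ls → ⟦strip⟧ κ ls ℚ.* (⟦ size ls ≟ size κ + p ⟧ ℚ.* F ls))))
      (sym (*-0ʳ (multichoose b p) (*-0ˡ K≡0 (F κ))))
      where
      K≡0 : K κ ≡ 0ℚ
      K≡0 = kostka-degree n α κ ne

-- The Schur expansion: from vectors to partitions

module SchurExpansion where

  open RationalSums
  open PartitionLists
  open Branching
  open LocalRule
  open Cauchy
  open import Data.Nat.Base
  open import Data.Nat.Properties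
  open import Data.Rational.Base using (ℚ; 0ℚ; 1ℚ)

  private variable
    n L : ℕ

  -- Empty rows at the bottom change neither the tableau conditions nor the content. They bring
  -- partitions of different lengths to the common length used in `cauchy`.
  padTableau : ℕ → Tableau n → Tableau n
  padTableau k T = T ++ replicate k []

  concat-pad : ∀ k (T : Tableau n) → concat (padTableau k T) ≡ concat T
  concat-pad zero    []      = refl
  concat-pad (suc k) []      = concat-pad k []
  concat-pad k       (r ∷ T) = cong (r ++_) (concat-pad k T)

  semistandard-pad⁺ : ∀ k {T : Tableau n} → Semistandard T → Semistandard (padTableau k T)
  semistandard-pad⁺ k (ss , cs) = All.++⁺ ss (proj₁ (semistandard-empty k)) , cols cs
    where
    cols : ∀ {T} → Linked (λ upper lower → Prefix Fin._>_ lower upper) T →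
           Linked (λ upper lower → Prefix Fin._>_ lower upper) (padTableau k T)
    cols []       = proj₂ (semistandard-empty k)
    cols (p ∷ cs) = p ∷ cols cs
    cols [-]      = single k
      where
      single : ∀ k {r} → Linked (λ upper lower → Prefix Fin._>_ lower upper) (r ∷ replicate k [])
      single zero    = [-]
      single (suc k) = [] ∷ single k

  semistandard-pad⁻ : ∀ k (T : Tableau n) → Semistandard (padTableau k T) → Semistandard T
  semistandard-pad⁻ k T (ss , cs) = All.++⁻ˡ T ss , cols T cs
    where
    cols : ∀ T → Linked (λ upper lower → Prefix Fin._>_ lower upper) (padTableau k T) →
           Linked (λ upper lower → Prefix Fin._>_ lower upper) T
    cols []          _        = []
    cols (_ ∷ [])    _        = [-]
    cols (_ ∷ _ ∷ T) (p ∷ cs) = p ∷ cols (_ ∷ T) cs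

  shape-pad : ∀ k (T : Tableau n) → shape (padTableau k T) ≡ shape T ++ replicate k 0
  shape-pad k T = trans (List.map-++ length T _) (cong (shape T ++_) (List.map-replicate length k []))

  unpad : ∀ k ls (T : Tableau n) → shape T ≡ ls ++ replicate k 0 → ∃ λ T′ → shape T′ ≡ ls × padTableau k T′ ≡ T
  unpad zero    []       []       _  = [] , refl , refl
  unpad (suc k) []       ([] ∷ T) eq with unpad k [] T (List.∷-injectiveʳ eq)
  ... | [] , _ , refl = [] , refl , refl
  unpad k       (l ∷ ls) (r ∷ T)  eq with unpad k ls T (List.∷-injectiveʳ eq)
  ... | T′ , sh , refl = r ∷ T′ , cong₂ _∷_ (List.∷-injectiveˡ eq) sh , refl

  ssyt-pad : ∀ k ls (Φ : Tableau n → ℚ) → ∑ (ssyt n ls) (Φ ∘ padTableau k) ≡ ∑ (ssyt n (ls ++ replicate k 0)) Φ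
  ssyt-pad {n} k ls Φ = ∑-bij (ssyt-unique n ls) (ssyt-unique n (ls ++ replicate k 0)) (padTableau k)
    (λ {T} T∈ → let (ss , sh) = ∈-ssyt⁻ {ls = ls} T∈ in
      ∈-ssyt⁺ (semistandard-pad⁺ k ss) (trans (shape-pad k T) (cong (_++ replicate k 0) sh)))
    (λ {T} {T′} _ _ eq → List.++-cancelʳ (replicate k []) T T′ eq)
    (λ {T} T∈ → let (ss , sh) = ∈-ssyt⁻ {ls = ls ++ replicate k 0} T∈
                    (T′ , sh′ , eq) = unpad k ls T sh in
      T′ , ∈-ssyt⁺ (semistandard-pad⁻ k T′ (subst Semistandard (sym eq) ss)) sh′ , eq)
    {Φ ∘ padTableau k} {Φ} (λ _ → refl)

  kostka-pad : ∀ n (α : Vec ℕ n) k ls → kostka n α ls ≡ kostka n α (ls ++ replicate k 0)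
  kostka-pad n α k ls = trans
    (∑-ext (ssyt n ls) (λ T → cong (λ l → ⟦ α ≟ᵐ Vec.tabulate (λ i → occurrences i l) ⟧) (sym (concat-pad k T))))
    (ssyt-pad k ls (λ T → ⟦ α ≟ᵐ content T ⟧))

  #ssyt-pad : ∀ b k ls → #ssyt b ls ≡ #ssyt b (ls ++ replicate k 0)
  #ssyt-pad b k ls = ssyt-pad {b} k ls (λ _ → 1ℚ)

  shape-decreasing : {T : Tableau n} → Semistandard T → Linked _≥_ (shape T)
  shape-decreasing (_ , cs) = go cs
    where
    go : ∀ {T} → Linked (λ upper lower → Prefix Fin._>_ lower upper) T → Linked _≥_ (shape T)
    go []       = []
    go [-]      = [-]
    go (p ∷ cs) = length-mono p ∷ go cs

  kostka-decreasing : ∀ n (α : Vec ℕ n) ls → ¬ Linked _≥_ ls → kostka n α ls ≡ 0ℚ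
  kostka-decreasing n α ls ¬dec = ∑-zero (ssyt n ls) {λ T → ⟦ α ≟ᵐ content T ⟧} (λ T T∈ → let (ss , sh) = ∈-ssyt⁻ {ls = ls} T∈ in
    contradiction (subst (Linked _≥_) sh (shape-decreasing ss)) ¬dec)

  kostka-degree′ : ∀ n (α : Vec ℕ n) ls → size α ≢ sum ls → kostka n α ls ≡ 0ℚ
  kostka-degree′ n α ls ne = subst (λ t → kostka n α t ≡ 0ℚ) (Vec.toList∘fromList ls)
    (kostka-degree n α (Vec.fromList ls) (λ eq → ne (trans eq (cong sum (Vec.toList∘fromList ls)))))

  pad : ∀ L → List ℕ → Vec ℕ L
  pad zero    _       = []
  pad (suc L) []      = 0 ∷ pad L []
  pad (suc L) (k ∷ μ) = k ∷ pad L μ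

  toList-pad : ∀ L μ → length μ ≤ L → toList (pad L μ) ≡ μ ++ replicate (L ∸ length μ) 0
  toList-pad zero    []      _        = refl
  toList-pad (suc L) []      _        = cong (0 ∷_) (toList-pad L [] z≤n)
  toList-pad (suc L) (k ∷ μ) (s≤s le) = cong (k ∷_) (toList-pad L μ le)

  trim : Vec ℕ L → List ℕ
  trim []          = []
  trim (zero ∷ _)  = []
  trim (suc k ∷ v) = suc k ∷ trim v

  trim-pad : ∀ L μ → All (1 ≤_) μ → length μ ≤ L → trim (pad L μ) ≡ μ
  trim-pad zero    []          _       _        = refl
  trim-pad (suc L) []          _       _        = refl
  trim-pad (suc L) (suc k ∷ μ) (_ ∷ h) (s≤s le) = cong (suc k ∷_) (trim-pad L μ h le)

  decreasing-0 : ∀ (v : Vec ℕ L) → Linked _≥_ (0 ∷ toList v) → v ≡ pad L []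
  decreasing-0 []      _          = refl
  decreasing-0 (x ∷ v) (z≤n ∷ d) = cong (0 ∷_) (decreasing-0 v d)

  pad-trim : ∀ (v : Vec ℕ L) → Linked _≥_ (toList v) → pad L (trim v) ≡ v
  pad-trim []          _ = refl
  pad-trim (zero ∷ v)  d = cong (0 ∷_) (sym (decreasing-0 v d))
  pad-trim (suc k ∷ v) d = cong (suc k ∷_) (pad-trim v (Linked.tail d))

  trim-positive : ∀ (v : Vec ℕ L) → All (1 ≤_) (trim v)
  trim-positive []          = []
  trim-positive (zero ∷ _)  = []
  trim-positive (suc k ∷ v) = s≤s z≤n ∷ trim-positive v

  trim-decreasing : ∀ (v : Vec ℕ L) → Linked _≥_ (toList v) → Linked _≥_ (trim v)
  trim-decreasing []                    _       = []
  trim-decreasing (zero ∷ _)            _       = []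
  trim-decreasing (suc k ∷ [])          _       = [-]
  trim-decreasing (suc k ∷ zero ∷ v)    _       = [-]
  trim-decreasing (suc k ∷ suc j ∷ v)   (g ∷ d) = g ∷ trim-decreasing (suc j ∷ v) d

  length-trim : ∀ (v : Vec ℕ L) → length (trim v) ≤ L
  length-trim []          = z≤n
  length-trim (zero ∷ _)  = z≤n
  length-trim (suc k ∷ v) = s≤s (length-trim v)

  sum-++-0 : ∀ μ k → sum (μ ++ replicate k 0) ≡ sum μ
  sum-++-0 []      k = sum-replicate-0 k
  sum-++-0 (j ∷ μ) k = cong (j +_) (sum-++-0 μ k)

  decreasing-++-0 : ∀ {μ} k → Linked _≥_ μ → Linked _≥_ (μ ++ replicate k 0)
  decreasing-++-0 zero          []      = []
  decreasing-++-0 (suc zero)    []      = [-]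
  decreasing-++-0 (suc (suc k)) []      = z≤n ∷ decreasing-++-0 (suc k) []
  decreasing-++-0 zero          [-]     = [-]
  decreasing-++-0 (suc k)       [-]     = z≤n ∷ decreasing-++-0 (suc k) []
  decreasing-++-0 k             (g ∷ d) = g ∷ decreasing-++-0 k d

  -- Passes from the vectors of `cauchy` to partitions: a vector that does not decrease, or whose
  -- size is not a, has Kostka number 0.
  ∑-kostka-#ssyt : ∀ a b n (α : Vec ℕ n) → size α ≡ a →
    ∑ (partitionLists a) (λ μ → kostka n α μ ℚ.* #ssyt b μ) ≡ ∏multichoose b α
  ∑-kostka-#ssyt a b n α refl = begin
    ∑ (partitionLists a) (λ μ → G μ)
      ≡⟨ ∑-bij (partitionLists-unique a) (Unique.filter⁺ shape? (box-unique a ℓ′))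
          (pad ℓ′) into inj onto {G} {G ∘ toList} same ⟩
    ∑ (filter shape? (box a ℓ′)) (G ∘ toList)
      ≡⟨ ∑-filter shape? (box a ℓ′) (G ∘ toList) ⟩
    ∑ (box a ℓ′) (λ v → ⟦ shape? v ⟧ ℚ.* G (toList v))
      ≡⟨ ∑-ext (box a ℓ′) (λ v → support v (shape? v)) ⟩
    ∑ (box a ℓ′) (G ∘ toList)
      ≡⟨ cauchy b (≤-trans (m≤n+m b a) (n≤1+n (a + b))) n α ≤-refl ⟩
    ∏multichoose b α ∎
    where
    open ≡-Reasoning
    -- Long enough for the at most a parts of a partition of a, and at least b, as `cauchy`
    -- requires.
    ℓ′ : ℕ
    ℓ′ = suc (a + b)
    G : List ℕ → ℚ
    G μ = kostka n α μ ℚ.* #ssyt b μ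
    shape? : ∀ (v : Vec ℕ ℓ′) → Dec (size v ≡ a × Linked _≥_ (toList v))
    shape? v = (size v ≟ a) ×-dec linked? _≥?_ (toList v)
    short : ∀ {μ} → IsPartition a μ → length μ ≤ ℓ′
    short (isPartition eq pos _) = ≤-trans (length≤sum pos) (≤-trans (≤-reflexive eq) (≤-trans (m≤m+n a b) (n≤1+n (a + b))))
    toList-pad′ : ∀ {μ} → IsPartition a μ → toList (pad ℓ′ μ) ≡ μ ++ replicate (ℓ′ ∸ length μ) 0
    toList-pad′ {μ} isp = toList-pad ℓ′ μ (short isp)
    size-pad : ∀ {μ} → IsPartition a μ → size (pad ℓ′ μ) ≡ a
    size-pad {μ} isp@(isPartition eq _ _) = trans (cong sum (toList-pad′ isp)) (trans (sum-++-0 μ _) eq)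
    into : ∀ {μ} → μ ∈ partitionLists a → pad ℓ′ μ ∈ filter shape? (box a ℓ′)
    into {μ} μ∈ with ∈-partitionLists⁻ μ∈
    ... | isp@(isPartition _ _ dec) = Mem.∈-filter⁺ shape? (∈-box-size (pad ℓ′ μ) (≤-reflexive (size-pad isp)))
      (size-pad isp , subst (Linked _≥_) (sym (toList-pad′ isp)) (decreasing-++-0 _ dec))
    inj : ∀ {μ μ′} → μ ∈ partitionLists a → μ′ ∈ partitionLists a → pad ℓ′ μ ≡ pad ℓ′ μ′ → μ ≡ μ′
    inj {μ} {μ′} μ∈ μ′∈ eq with ∈-partitionLists⁻ μ∈ | ∈-partitionLists⁻ μ′∈
    ... | isp@(isPartition _ pos _) | isp′@(isPartition _ pos′ _) =
      trans (sym (trim-pad ℓ′ μ pos (short isp))) (trans (cong trim eq) (trim-pad ℓ′ μ′ pos′ (short isp′)))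
    onto : ∀ {v} → v ∈ filter shape? (box a ℓ′) → ∃ λ μ → μ ∈ partitionLists a × pad ℓ′ μ ≡ v
    onto {v} v∈ with Mem.∈-filter⁻ shape? {xs = box a ℓ′} v∈
    ... | _ , sz , dec = trim v , ∈-partitionLists⁺ (isPartition
      (trans (sym (sum-++-0 (trim v) _))
          (trans (cong sum (sym (toList-pad ℓ′ (trim v) (length-trim v)))) (trans (cong size (pad-trim v dec)) sz)))
      (trim-positive v) (trim-decreasing v dec)) , pad-trim v dec
    same : ∀ {μ} → μ ∈ partitionLists a → G μ ≡ G (toList (pad ℓ′ μ))
    same {μ} μ∈ = trans (cong₂ ℚ._*_ (kostka-pad n α k μ) (#ssyt-pad b k μ))
        (cong G (sym (toList-pad′ (∈-partitionLists⁻ μ∈))))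
      where k = ℓ′ ∸ length μ
    support : ∀ v (d : Dec (size v ≡ a × Linked _≥_ (toList v))) → ⟦ d ⟧ ℚ.* G (toList v) ≡ G (toList v)
    support v (yes _) = ℚ.*-identityˡ (G (toList v))
    support v (no ¬sh) = trans (ℚ.*-zeroˡ (G (toList v))) (sym (*-0ˡ (kostka≡0 (size v ≟ a)) (#ssyt b (toList v))))
      where
      kostka≡0 : Dec (size v ≡ a) → kostka n α (toList v) ≡ 0ℚ
      kostka≡0 (yes eq) = kostka-decreasing n α (toList v) (λ dec → ¬sh (eq , dec))
      kostka≡0 (no ne)  = kostka-degree n α v (ne ∘ sym)

  length-concat : ∀ (T : Tableau n) → length (concat T) ≡ sum (shape T)
  length-concat []      = refl
  length-concat (r ∷ T) = trans (List.length-++ r) (cong (length r +_) (length-concat T))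

  -- Every tableau has one content, with exponents at most the number d of cells, so the sum over
  -- exponents counts it once.
  evalOnes-s : ∀ b {d} (μ : Partition d) → s[1^ b ] μ ≡ #ssyt b (parts μ)
  evalOnes-s b {d} (μ , isPartition sz _ _) = trans
    (∑-swap W (ssyt b μ) (λ β T → ⟦ β ≟ᵐ content T ⟧))
    (∑-cong (ssyt b μ) (λ T T∈ → ∑-⟦⟧-1 (_≟ᵐ content T) (words-unique (Unique.upTo⁺ (suc d)) b)
      (∈-words (λ i → Mem.∈-upTo⁺ (s≤s (small T T∈ i)))) refl id))
    where
    W = words (upTo (suc d)) b
    small : ∀ T → T ∈ ssyt b μ → ∀ i → lookup (content T) i ≤ d
    small T T∈ i = ≤-trans (≤-reflexive (Vec.lookup∘tabulate (λ i → occurrences i (concat T)) i))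
      (≤-trans (List.length-filter (Fin._≟ i) (concat T))
          (≤-reflexive (trans (length-concat T) (trans (cong sum (proj₂ (∈-ssyt⁻ {ls = μ} T∈))) sz))))

  schur-expansion : ∀ a b q n (α : Vec ℕ n) →
    ∑ (partitions a) (λ μ → (s[1^ b ] μ ℚ.* q) ℚ.* s μ n α) ≡ q ℚ.* (⟦ size α ≟ a ⟧ ℚ.* ∏multichoose b α)
  schur-expansion a b q n α = begin
    ∑ (partitions a) (λ μ → (s[1^ b ] μ ℚ.* q) ℚ.* s μ n α)
      ≡⟨ ∑-ext (partitions a) (λ μ → trans (cong (λ t → (t ℚ.* q) ℚ.* s μ n α) (evalOnes-s b μ))
          (shuffle (#ssyt b (parts μ)) q (s μ n α))) ⟩
    ∑ (partitions a) (λ μ → q ℚ.* G (parts μ))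
      ≡⟨ ∑-*ˡ (partitions a) q (G ∘ parts) ⟩
    q ℚ.* ∑ (partitions a) (G ∘ parts)
      ≡⟨ cong (q ℚ.*_) (trans (∑-partitions a G) (step (size α ≟ a))) ⟩
    q ℚ.* (⟦ size α ≟ a ⟧ ℚ.* ∏multichoose b α) ∎
    where
    open ≡-Reasoning
    G : List ℕ → ℚ
    G μ = kostka n α μ ℚ.* #ssyt b μ
    shuffle : ∀ x y z → (x ℚ.* y) ℚ.* z ≡ y ℚ.* (z ℚ.* x)
    shuffle x y z = trans (cong (ℚ._* z) (ℚ.*-comm x y)) (trans (ℚ.*-assoc y x z) (cong (y ℚ.*_) (ℚ.*-comm x z)))
    step : Dec (size α ≡ a) → ∑ (partitionLists a) G ≡ ⟦ size α ≟ a ⟧ ℚ.* ∏multichoose b α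
    step (yes eq) = trans (∑-kostka-#ssyt a b n α eq) (sym (⟦⟧-*-yes (size α ≟ a) eq (∏multichoose b α)))
    step (no ne)  = trans (∑-zero (partitionLists a) (λ μ μ∈ → *-0ˡ
        (kostka-degree′ n α μ (λ eq → ne (trans eq (IsPartition.sums-to (∈-partitionLists⁻ μ∈))))) (#ssyt b μ)))
      (sym (⟦⟧-*-no (size α ≟ a) ne (∏multichoose b α)))

-- Coefficients of ∏ᵢ (1 - xᵢ)⁻ᵇ and their recursions

module Plethysm where

  open RationalSums
  open LocalRule using (multichoose; size; size≡0; size-0)
  open Cauchy using (∏multichoose)
  open PartitionLists using ()
  open import Data.Nat.Base
  open import Data.Nat.Properties
  open import Data.Rational.Base using (ℚ; 0ℚ; 1ℚ)

  private variable
    n : ℕ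

  -- `_⊛_` for a fixed number of variables, so that the first exponent can be split off as in
  -- `conv-∷`.
  conv : (Vec ℕ n → ℚ) → (Vec ℕ n → ℚ) → Vec ℕ n → ℚ
  conv f g α = ∑ (splittings α) (λ βγ → f (proj₁ βγ) ℚ.* g (proj₂ βγ))

  conv-cong : ∀ {f f′ g g′ : Vec ℕ n → ℚ} → (∀ α → f α ≡ f′ α) → (∀ α → g α ≡ g′ α) → ∀ α → conv f g α ≡ conv f′ g′ α
  conv-cong f≗ g≗ α = ∑-ext (splittings α) (λ (β , γ) → cong₂ ℚ._*_ (f≗ β) (g≗ γ))

  conv-∷ : ∀ (f g : Vec ℕ (suc n) → ℚ) k α →
    conv f g (k ∷ α) ≡ ∑ (upTo (suc k)) (λ i → conv (f ∘ (i ∷_)) (g ∘ (k ∸ i ∷_)) α)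
  conv-∷ f g k α = ∑-cartesian (λ i (β , γ) → i ∷ β , k ∸ i ∷ γ) (upTo (suc k)) (splittings α)
    (λ βγ → f (proj₁ βγ) ℚ.* g (proj₂ βγ))

  conv-[] : ∀ (f g : Vec ℕ 0 → ℚ) → conv f g [] ≡ f [] ℚ.* g []
  conv-[] f g = ℚ.+-identityʳ (f [] ℚ.* g [])

  conv-∑ʳ : ∀ {A : Set} (f : Vec ℕ n → ℚ) (xs : List A) (G : A → Vec ℕ n → ℚ) α →
    conv f (λ γ → ∑ xs (λ x → G x γ)) α ≡ ∑ xs (λ x → conv f (G x) α)
  conv-∑ʳ f xs G α = trans
    (∑-ext (splittings α) (λ (β , γ) → sym (∑-*ˡ xs (f β) (λ x → G x γ))))
    (∑-swap (splittings α) xs (λ (β , γ) x → f β ℚ.* G x γ))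

  conv-∑ˡ : ∀ {A : Set} (xs : List A) (F : A → Vec ℕ n → ℚ) (g : Vec ℕ n → ℚ) α →
    conv (λ β → ∑ xs (λ x → F x β)) g α ≡ ∑ xs (λ x → conv (F x) g α)
  conv-∑ˡ xs F g α = trans
    (∑-ext (splittings α) (λ (β , γ) → sym (∑-*ʳ xs (g γ) (λ x → F x β))))
    (∑-swap (splittings α) xs (λ (β , γ) x → F x β ℚ.* g γ))

  conv-*ʳ : ∀ (f : Vec ℕ n → ℚ) q (g : Vec ℕ n → ℚ) α → conv f (λ γ → q ℚ.* g γ) α ≡ q ℚ.* conv f g α
  conv-*ʳ f q g α = trans (∑-ext (splittings α) (λ (β , γ) → *-swap (f β) q (g γ)))
    (∑-*ˡ (splittings α) q (λ (β , γ) → f β ℚ.* g γ))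

  conv-*ˡ : ∀ q (f g : Vec ℕ n → ℚ) α → conv (λ β → q ℚ.* f β) g α ≡ q ℚ.* conv f g α
  conv-*ˡ q f g α = trans (∑-ext (splittings α) (λ (β , γ) → ℚ.*-assoc q (f β) (g γ)))
    (∑-*ˡ (splittings α) q (λ (β , γ) → f β ℚ.* g γ))

  conv-+ˡ : ∀ (f f′ g : Vec ℕ n → ℚ) α → conv (λ β → f β ℚ.+ f′ β) g α ≡ conv f g α ℚ.+ conv f′ g α
  conv-+ˡ f f′ g α = trans (∑-ext (splittings α) (λ (β , γ) → ℚ.*-distribʳ-+ (g γ) (f β) (f′ β)))
    (∑-+ (splittings α) (λ (β , γ) → f β ℚ.* g γ) (λ (β , γ) → f′ β ℚ.* g γ))

  ∑-upTo-≤ : ∀ {m k} → m ≤ k → (G : ℕ → ℚ) → ∑ (upTo (suc m)) G ≡ ∑ (upTo (suc k)) (λ j → ⟦ j ≤? m ⟧ ℚ.* G j)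
  ∑-upTo-≤ {m} {k} m≤k G = trans
    (∑-bij (Unique.upTo⁺ (suc m)) (Unique.filter⁺ (_≤? m) (Unique.upTo⁺ (suc k))) id
      (λ j∈ → let j≤m = s≤s⁻¹ (Mem.∈-upTo⁻ j∈) in Mem.∈-filter⁺ (_≤? m) (Mem.∈-upTo⁺ (s≤s (≤-trans j≤m m≤k))) j≤m)
      (λ _ _ eq → eq)
      (λ {j} j∈ → j , Mem.∈-upTo⁺ (s≤s (proj₂ (Mem.∈-filter⁻ (_≤? m) {xs = upTo (suc k)} j∈))) , refl)
      {G} {G} (λ _ → refl))
    (∑-filter (_≤? m) (upTo (suc k)) G)

  -- Both sides run over the triples with i + j + l = k.
  ∑-triangle : ∀ k (T : ℕ → ℕ → ℕ → ℚ) →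
    ∑ (upTo (suc k)) (λ i → ∑ (upTo (suc (k ∸ i))) (λ j → T i j (k ∸ i ∸ j))) ≡
    ∑ (upTo (suc k)) (λ j → ∑ (upTo (suc (k ∸ j))) (λ i → T i j (k ∸ j ∸ i)))
  ∑-triangle k T = begin
    ∑ K (λ i → ∑ (upTo (suc (k ∸ i))) (λ j → T i j (k ∸ i ∸ j)))
      ≡⟨ ∑-ext K (λ i → ∑-upTo-≤ (m∸n≤m k i) (λ j → T i j (k ∸ i ∸ j))) ⟩
    ∑ K (λ i → ∑ K (λ j → ⟦ j ≤? k ∸ i ⟧ ℚ.* T i j (k ∸ i ∸ j)))
      ≡⟨ ∑-swap K K (λ i j → ⟦ j ≤? k ∸ i ⟧ ℚ.* T i j (k ∸ i ∸ j)) ⟩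
    ∑ K (λ j → ∑ K (λ i → ⟦ j ≤? k ∸ i ⟧ ℚ.* T i j (k ∸ i ∸ j)))
      ≡⟨ ∑-cong K (λ j j∈ → ∑-cong K (λ i i∈ → cong₂ ℚ._*_
           (⟦⟧-cong (j ≤? k ∸ i) (i ≤? k ∸ j) (flip i j (s≤s⁻¹ (Mem.∈-upTo⁻ i∈))) (flip j i (s≤s⁻¹ (Mem.∈-upTo⁻ j∈))))
           (cong (T i j) (trans (∸-+-assoc k i j) (trans (cong (k ∸_) (+-comm i j)) (sym (∸-+-assoc k j i))))))) ⟩
    ∑ K (λ j → ∑ K (λ i → ⟦ i ≤? k ∸ j ⟧ ℚ.* T i j (k ∸ j ∸ i)))
      ≡⟨ ∑-ext K (λ j → sym (∑-upTo-≤ (m∸n≤m k j) (λ i → T i j (k ∸ j ∸ i)))) ⟩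
    ∑ K (λ j → ∑ (upTo (suc (k ∸ j))) (λ i → T i j (k ∸ j ∸ i))) ∎
    where
    open ≡-Reasoning
    K = upTo (suc k)
    flip : ∀ i j → i ≤ k → j ≤ k ∸ i → i ≤ k ∸ j
    flip i j i≤k j≤ = m+n≤o⇒m≤o∸n i (≤-trans (+-monoʳ-≤ i j≤) (≤-reflexive (m+[n∸m]≡n i≤k)))

  -- Commutativity and associativity in one: products over a partition nest to the right, and this
  -- exchanges two neighbouring factors.
  conv-swap : ∀ {n} (f g e : Vec ℕ n → ℚ) α → conv f (conv g e) α ≡ conv g (conv f e) α
  conv-swap {zero}  f g e [] = trans (conv-[] f (conv g e)) (trans (cong (f [] ℚ.*_) (conv-[] g e))
    (trans (*-swap (f []) (g []) (e [])) (sym (trans (conv-[] g (conv f e)) (cong (g [] ℚ.*_) (conv-[] f e))))))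
  conv-swap {suc n} f g e (k ∷ α) = begin
    conv f (conv g e) (k ∷ α)
      ≡⟨ expand f g ⟩
    ∑ K (λ i → ∑ (upTo (suc (k ∸ i))) (λ j → conv (f ∘ (i ∷_)) (conv (g ∘ (j ∷_)) (e ∘ (k ∸ i ∸ j ∷_))) α))
      ≡⟨ ∑-ext K (λ i → ∑-ext (upTo (suc (k ∸ i))) (λ j → conv-swap (f ∘ (i ∷_)) (g ∘ (j ∷_)) (e ∘ (k ∸ i ∸ j ∷_)) α)) ⟩
    ∑ K (λ i → ∑ (upTo (suc (k ∸ i))) (λ j → conv (g ∘ (j ∷_)) (conv (f ∘ (i ∷_)) (e ∘ (k ∸ i ∸ j ∷_))) α))
      ≡⟨ ∑-triangle k (λ i j l → conv (g ∘ (j ∷_)) (conv (f ∘ (i ∷_)) (e ∘ (l ∷_))) α) ⟩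
    ∑ K (λ j → ∑ (upTo (suc (k ∸ j))) (λ i → conv (g ∘ (j ∷_)) (conv (f ∘ (i ∷_)) (e ∘ (k ∸ j ∸ i ∷_))) α))
      ≡⟨ sym (expand g f) ⟩
    conv g (conv f e) (k ∷ α) ∎
    where
    open ≡-Reasoning
    K = upTo (suc k)
    expand : ∀ f g → conv f (conv g e) (k ∷ α) ≡
      ∑ K (λ i → ∑ (upTo (suc (k ∸ i))) (λ j → conv (f ∘ (i ∷_)) (conv (g ∘ (j ∷_)) (e ∘ (k ∸ i ∸ j ∷_))) α))
    expand f g = trans (conv-∷ f (conv g e) k α) (∑-ext K (λ i → trans
      (conv-cong {f = f ∘ (i ∷_)} (λ _ → refl) (λ γ → conv-∷ g e (k ∸ i) γ) α)
      (conv-∑ʳ (f ∘ (i ∷_)) (upTo (suc (k ∸ i))) (λ j → conv (g ∘ (j ∷_)) (e ∘ (k ∸ i ∸ j ∷_))) α)))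

  ∈-splittings : ∀ (α : Vec ℕ n) {β γ} → (β , γ) ∈ splittings α → size β + size γ ≡ size α
  ∈-splittings []      (here refl) = refl
  ∈-splittings (k ∷ α) βγ∈ with Mem.∈-cartesianProductWith⁻ (λ i (β , γ) → i ∷ β , k ∸ i ∷ γ) (upTo (suc k))
      (splittings α) βγ∈
  ... | i , (β , γ) , i∈ , βγ∈′ , refl = trans (interchange i (size β) (k ∸ i) (size γ))
      (cong₂ _+_ (m+[n∸m]≡n (s≤s⁻¹ (Mem.∈-upTo⁻ i∈))) (∈-splittings α βγ∈′))
    where
    interchange : ∀ i b k c → i + b + (k + c) ≡ i + k + (b + c)
    interchange = solve-∀

  conv-one : ∀ (g : Vec ℕ n → ℚ) α → conv (λ β → ⟦ size β ≟ 0 ⟧) g α ≡ g α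
  conv-one g []      = trans (conv-[] (λ β → ⟦ size β ≟ 0 ⟧) g) (ℚ.*-identityˡ (g []))
  conv-one {suc n} g (k ∷ α) = trans (conv-∷ (λ β → ⟦ size β ≟ 0 ⟧) g k α) (trans
    (∑-single (Unique.upTo⁺ (suc k)) {0}
        (Mem.∈-upTo⁺ (s≤s z≤n)) {λ i → conv (λ β → ⟦ i + size β ≟ 0 ⟧) (g ∘ (k ∸ i ∷_)) α} vanish)
    (conv-one (g ∘ (k ∷_)) α))
    where
    vanish : ∀ {i} → i ∈ upTo (suc k) → i ≢ 0 → conv (λ β → ⟦ i + size β ≟ 0 ⟧) (g ∘ (k ∸ i ∷_)) α ≡ 0ℚ
    vanish {zero}  _ ne = contradiction refl ne
    vanish {suc i} _ _  = ∑-zero (splittings α) (λ (β , γ) _ → ℚ.*-zeroˡ (g (k ∸ suc i ∷ γ)))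

  ∑-reverse : ∀ k (G : ℕ → ℚ) → ∑ (upTo (suc k)) (λ j → G (k ∸ j)) ≡ ∑ (upTo (suc k)) G
  ∑-reverse zero    G = refl
  ∑-reverse (suc k) G = trans (∑-upTo-suc (suc k) (λ j → G (suc k ∸ j)))
    (trans (cong (G (suc k) ℚ.+_) (∑-reverse k G)) (trans (ℚ.+-comm (G (suc k)) _) (sym (∑-upTo-sucʳ (suc k) G))))

  multichoose-pascal : ∀ b k → multichoose (suc b) (suc k) ≡ multichoose (suc b) k ℚ.+ multichoose b (suc k)
  multichoose-pascal b k = ∑-upTo-sucʳ (suc k) (multichoose b)

  -- The coefficient form of d/dt (1 - t)⁻ᵇ = b (1 - t)⁻⁽ᵇ⁺¹⁾. For b + 1 both sides are reduced to
  -- (k + 1 + b) times the coefficient of tᵏ in (1 - t)⁻⁽ᵇ⁺¹⁾.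
  multichoose-absorb : ∀ b k → ι (suc k) ℚ.* multichoose b (suc k) ≡ ι b ℚ.* multichoose (suc b) k
  multichoose-absorb zero    k = trans (ℚ.*-zeroʳ (ι (suc k))) (sym (*-0ˡ ι-0 (multichoose 1 k)))
  multichoose-absorb (suc b) k = trans lhs (sym (rhs k))
    where
    M = multichoose
    open ≡-Reasoning
    lhs : ι (suc k) ℚ.* M (suc b) (suc k) ≡ (ι (suc k) ℚ.+ ι b) ℚ.* M (suc b) k
    lhs = begin
      ι (suc k) ℚ.* M (suc b) (suc k)
        ≡⟨ cong (ι (suc k) ℚ.*_) (multichoose-pascal b k) ⟩
      ι (suc k) ℚ.* (M (suc b) k ℚ.+ M b (suc k))
        ≡⟨ ℚ.*-distribˡ-+ (ι (suc k)) (M (suc b) k) (M b (suc k)) ⟩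
      ι (suc k) ℚ.* M (suc b) k ℚ.+ ι (suc k) ℚ.* M b (suc k)
        ≡⟨ cong (ι (suc k) ℚ.* M (suc b) k ℚ.+_) (multichoose-absorb b k) ⟩
      ι (suc k) ℚ.* M (suc b) k ℚ.+ ι b ℚ.* M (suc b) k
        ≡⟨ sym (ℚ.*-distribʳ-+ (M (suc b) k) (ι (suc k)) (ι b)) ⟩
      (ι (suc k) ℚ.+ ι b) ℚ.* M (suc b) k ∎
    rhs : ∀ k → ι (suc b) ℚ.* M (suc (suc b)) k ≡ (ι (suc k) ℚ.+ ι b) ℚ.* M (suc b) k
    rhs zero = cong₂ ℚ._*_ (trans (ι-suc b) (cong (ℚ._+ ι b) (sym ι-1))) (ℚ.+-identityʳ (M (suc b) 0))
    rhs (suc k) = begin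
      ι (suc b) ℚ.* M (suc (suc b)) (suc k)
        ≡⟨ cong (ι (suc b) ℚ.*_) (multichoose-pascal (suc b) k) ⟩
      ι (suc b) ℚ.* (M (suc (suc b)) k ℚ.+ M (suc b) (suc k))
        ≡⟨ ℚ.*-distribˡ-+ (ι (suc b)) (M (suc (suc b)) k) (M (suc b) (suc k)) ⟩
      ι (suc b) ℚ.* M (suc (suc b)) k ℚ.+ ι (suc b) ℚ.* M (suc b) (suc k)
        ≡⟨ cong (ℚ._+ ι (suc b) ℚ.* M (suc b) (suc k)) (sym (multichoose-absorb (suc b) k)) ⟩
      ι (suc k) ℚ.* M (suc b) (suc k) ℚ.+ ι (suc b) ℚ.* M (suc b) (suc k)
        ≡⟨ sym (ℚ.*-distribʳ-+ (M (suc b) (suc k)) (ι (suc k)) (ι (suc b))) ⟩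
      (ι (suc k) ℚ.+ ι (suc b)) ℚ.* M (suc b) (suc k)
        ≡⟨ cong (ℚ._* M (suc b) (suc k))
            (trans (sym (ι-+ (suc k) (suc b))) (trans (cong ι (cong suc (+-suc k b))) (ι-+ (suc (suc k)) b))) ⟩
      (ι (suc (suc k)) ℚ.+ ι b) ℚ.* M (suc b) (suc k) ∎

  -- (1 - x)⁻¹ (1 - x)⁻ᵇ = (1 - x)⁻⁽ᵇ⁺¹⁾ in every variable.
  ∑-∏multichoose : ∀ b (α : Vec ℕ n) → conv (λ _ → 1ℚ) (∏multichoose b) α ≡ ∏multichoose (suc b) α
  ∑-∏multichoose b []      = conv-[] (λ _ → 1ℚ) (∏multichoose b)
  ∑-∏multichoose b (k ∷ α) = trans (conv-∷ (λ _ → 1ℚ) (∏multichoose b) k α) (trans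
    (∑-ext (upTo (suc k)) (λ i → trans (conv-*ʳ (λ _ → 1ℚ) (multichoose b (k ∸ i)) (∏multichoose b) α)
      (cong (multichoose b (k ∸ i) ℚ.*_) (∑-∏multichoose b α))))
    (trans (∑-*ʳ (upTo (suc k)) (∏multichoose (suc b) α) (λ i → multichoose b (k ∸ i)))
      (cong (ℚ._* ∏multichoose (suc b) α) (∑-reverse k (multichoose b)))))

  powerSum : ℕ → ∀ {n} → Vec ℕ n → ℚ
  powerSum j {n} = pᵏ j n

  ⟦≟-∷⟧ : ∀ k (α : Vec ℕ n) j β → ⟦ (k ∷ α) ≟ᵐ (j ∷ β) ⟧ ≡ ⟦ k ≟ j ⟧ ℚ.* ⟦ α ≟ᵐ β ⟧
  ⟦≟-∷⟧ k α j β = trans (⟦⟧-cong ((k ∷ α) ≟ᵐ (j ∷ β)) ((k ≟ j) ×-dec (α ≟ᵐ β)) Vec.∷-injective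
      (λ (eq , eq′) → cong₂ _∷_ eq eq′))
    (⟦⟧-× (k ≟ j) (α ≟ᵐ β))

  ⟦≟-0⟧ : ∀ (α : Vec ℕ n) → ⟦ α ≟ᵐ Vec.replicate n 0 ⟧ ≡ ⟦ size α ≟ 0 ⟧
  ⟦≟-0⟧ {n} α = ⟦⟧-cong (α ≟ᵐ Vec.replicate n 0) (size α ≟ 0) (λ { refl → size-0 n }) (size≡0 α)

  -- Either the first variable carries the whole exponent j, or it does not occur.
  powerSum-∷ : ∀ j k (α : Vec ℕ n) → powerSum j (k ∷ α) ≡ ⟦ k ≟ j ⟧ ℚ.* ⟦ size α ≟ 0 ⟧ ℚ.+ ⟦ k ≟ 0 ⟧ ℚ.* powerSum j α
  powerSum-∷ {n} j k α = cong₂ ℚ._+_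
    (trans (⟦≟-∷⟧ k α j (Vec.replicate n 0)) (cong (⟦ k ≟ j ⟧ ℚ.*_) (⟦≟-0⟧ α)))
    (trans (cong (λ l → ∑ l (λ i → ⟦ (k ∷ α) ≟ᵐ (Vec.replicate (suc n) 0 Vec.[ i ]≔ j) ⟧)) (sym (List.map-tabulate id suc)))
    (trans (∑-map suc (allFin n) (λ i → ⟦ (k ∷ α) ≟ᵐ (Vec.replicate (suc n) 0 Vec.[ i ]≔ j) ⟧))
    (trans (∑-ext (allFin n) (λ i → ⟦≟-∷⟧ k α 0 (Vec.replicate n 0 Vec.[ i ]≔ j)))
      (∑-*ˡ (allFin n) ⟦ k ≟ 0 ⟧ (λ i → ⟦ α ≟ᵐ (Vec.replicate n 0 Vec.[ i ]≔ j) ⟧)))))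

  powerSum-degree : ∀ j (α : Vec ℕ n) → size α ≢ j → powerSum j α ≡ 0ℚ
  powerSum-degree j []      ne = refl
  powerSum-degree j (k ∷ α) ne = trans (powerSum-∷ j k α) (trans (cong₂ ℚ._+_
      (trans (sym (⟦⟧-× (k ≟ j) (size α ≟ 0)))
          (⟦⟧-no ((k ≟ j) ×-dec (size α ≟ 0)) (λ (k≡j , α≡0) → ne (trans (cong₂ _+_ k≡j α≡0) (+-identityʳ j)))))
      (⟦⟧-*-0 (k ≟ 0) (λ { refl → powerSum-degree j α ne })))
    (ℚ.+-identityˡ 0ℚ))

  conv-powerSum-∷ : ∀ b j k (α : Vec ℕ n) →
    conv (powerSum j) (∏multichoose b) (k ∷ α) ≡
    ∑ (upTo (suc k)) (λ i → ⟦ i ≟ j ⟧ ℚ.* multichoose b (k ∸ i)) ℚ.* ∏multichoose b α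
      ℚ.+ multichoose b k ℚ.* conv (powerSum j) (∏multichoose b) α
  conv-powerSum-∷ {n} b j k α = begin
    conv (powerSum j) X (k ∷ α)
      ≡⟨ conv-∷ (powerSum j) X k α ⟩
    ∑ K (λ i → conv (powerSum j ∘ (i ∷_)) (X ∘ (k ∸ i ∷_)) α)
      ≡⟨ ∑-ext K term ⟩
    ∑ K (λ i → (⟦ i ≟ j ⟧ ℚ.* c i) ℚ.* X α ℚ.+ ⟦ i ≟ 0 ⟧ ℚ.* (c i ℚ.* P))
      ≡⟨ ∑-+ K (λ i → (⟦ i ≟ j ⟧ ℚ.* c i) ℚ.* X α) (λ i → ⟦ i ≟ 0 ⟧ ℚ.* (c i ℚ.* P)) ⟩
    ∑ K (λ i → (⟦ i ≟ j ⟧ ℚ.* c i) ℚ.* X α) ℚ.+ ∑ K (λ i → ⟦ i ≟ 0 ⟧ ℚ.* (c i ℚ.* P))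
      ≡⟨ cong₂ ℚ._+_ (∑-*ʳ K (X α) (λ i → ⟦ i ≟ j ⟧ ℚ.* c i))
           (∑-⟦⟧-* (_≟ 0) (Unique.upTo⁺ (suc k)) (Mem.∈-upTo⁺ (s≤s z≤n)) refl id (λ i → c i ℚ.* P)) ⟩
    ∑ K (λ i → ⟦ i ≟ j ⟧ ℚ.* c i) ℚ.* X α ℚ.+ multichoose b k ℚ.* P ∎
    where
    open ≡-Reasoning
    K = upTo (suc k)
    X : ∀ {n} → Vec ℕ n → ℚ
    X = ∏multichoose b
    c : ℕ → ℚ
    c i = multichoose b (k ∸ i)
    P = conv (powerSum j) X α
    term : ∀ i → conv (powerSum j ∘ (i ∷_)) (X ∘ (k ∸ i ∷_)) α ≡ (⟦ i ≟ j ⟧ ℚ.* c i) ℚ.* X α ℚ.+ ⟦ i ≟ 0 ⟧ ℚ.* (c i ℚ.* P)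
    term i = begin
      conv (powerSum j ∘ (i ∷_)) (λ γ → c i ℚ.* X γ) α
        ≡⟨ conv-*ʳ (powerSum j ∘ (i ∷_)) (c i) X α ⟩
      c i ℚ.* conv (powerSum j ∘ (i ∷_)) X α
        ≡⟨ cong (c i ℚ.*_) (trans (conv-cong {g = X} (powerSum-∷ j i) (λ _ → refl) α)
            (trans (conv-+ˡ (λ β → ⟦ i ≟ j ⟧ ℚ.* ⟦ size β ≟ 0 ⟧) (λ β → ⟦ i ≟ 0 ⟧ ℚ.* powerSum j β) X α)
              (cong₂ ℚ._+_ (trans (conv-*ˡ ⟦ i ≟ j ⟧ (λ β → ⟦ size β ≟ 0 ⟧) X α) (cong (⟦ i ≟ j ⟧ ℚ.*_) (conv-one X α)))
                (conv-*ˡ ⟦ i ≟ 0 ⟧ (powerSum j) X α)))) ⟩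
      c i ℚ.* (⟦ i ≟ j ⟧ ℚ.* X α ℚ.+ ⟦ i ≟ 0 ⟧ ℚ.* P)
        ≡⟨ ℚ.*-distribˡ-+ (c i) (⟦ i ≟ j ⟧ ℚ.* X α) (⟦ i ≟ 0 ⟧ ℚ.* P) ⟩
      c i ℚ.* (⟦ i ≟ j ⟧ ℚ.* X α) ℚ.+ c i ℚ.* (⟦ i ≟ 0 ⟧ ℚ.* P)
        ≡⟨ cong₂ ℚ._+_ (trans (*-swap (c i) ⟦ i ≟ j ⟧ (X α)) (sym (ℚ.*-assoc ⟦ i ≟ j ⟧ (c i) (X α))))
            (*-swap (c i) ⟦ i ≟ 0 ⟧ P) ⟩
      (⟦ i ≟ j ⟧ ℚ.* c i) ℚ.* X α ℚ.+ ⟦ i ≟ 0 ⟧ ℚ.* (c i ℚ.* P) ∎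

  -- Euler's identity in one variable: x d/dx acts on (1 - x)⁻ᵇ as multiplication by b x / (1 - x).
  -- The bound D need only reach k, which lets `euler` keep it fixed while the variables are split
  -- off.
  ∑-positive : ∀ b k D → k ≤ D →
    ι b ℚ.* ∑ (upTo D) (λ t → ∑ (upTo (suc k)) (λ i → ⟦ i ≟ suc t ⟧ ℚ.* multichoose b (k ∸ i))) ≡ ι k ℚ.* multichoose b k
  ∑-positive b k D k≤D = trans (cong (ι b ℚ.*_)
      (trans (∑-swap (upTo D) (upTo (suc k)) (λ t i → ⟦ i ≟ suc t ⟧ ℚ.* c i)) rows)) (final k)
    where
    c : ℕ → ℚ
    c i = multichoose b (k ∸ i)
    inner : ∀ i → i < k → ∑ (upTo D) (λ t → ⟦ suc i ≟ suc t ⟧ ℚ.* c (suc i)) ≡ c (suc i)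
    inner i i<k = ∑-⟦⟧-* (λ t → suc i ≟ suc t) (Unique.upTo⁺ D) (Mem.∈-upTo⁺ (<-≤-trans i<k k≤D)) refl
      (λ eq → sym (suc-injective eq)) (λ _ → c (suc i))
    rows : ∑ (upTo (suc k)) (λ i → ∑ (upTo D) (λ t → ⟦ i ≟ suc t ⟧ ℚ.* c i)) ≡ ∑ (upTo k) (λ i → c (suc i))
    rows = trans (∑-upTo-suc k (λ i → ∑ (upTo D) (λ t → ⟦ i ≟ suc t ⟧ ℚ.* c i)))
      (trans (cong₂ ℚ._+_ (∑-zero (upTo D) (λ t _ → ℚ.*-zeroˡ (c 0)))
          (∑-cong (upTo k) (λ i i∈ → inner i (Mem.∈-upTo⁻ i∈)))) (ℚ.+-identityˡ _))
    final : ∀ k → ι b ℚ.* ∑ (upTo k) (λ i → multichoose b (k ∸ suc i)) ≡ ι k ℚ.* multichoose b k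
    final zero    = trans (ℚ.*-zeroʳ (ι b)) (sym (*-0ˡ ι-0 (multichoose b 0)))
    final (suc k) = trans (cong (ι b ℚ.*_) (∑-reverse k (multichoose b))) (sym (multichoose-absorb b k))

  -- Euler's operator ∑ᵢ xᵢ ∂/∂xᵢ acts on ∏ᵢ (1 - xᵢ)⁻ᵇ as multiplication by b ∑ⱼ pⱼ.
  euler : ∀ b (α : Vec ℕ n) D → size α ≤ D →
    ι b ℚ.* ∑ (upTo D) (λ t → conv (powerSum (suc t)) (∏multichoose b) α) ≡ ι (size α) ℚ.* ∏multichoose b α
  euler b [] D _ = trans
    (*-0ʳ (ι b) (∑-zero (upTo D) (λ t _ → trans (conv-[] (powerSum (suc t)) (∏multichoose b)) (ℚ.*-zeroˡ 1ℚ))))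
    (sym (*-0ˡ ι-0 1ℚ))
  euler b (k ∷ α) D le = begin
    ι b ℚ.* ∑ (upTo D) (λ t → conv (powerSum (suc t)) X (k ∷ α))
      ≡⟨ cong (ι b ℚ.*_) (trans (∑-ext (upTo D) (λ t → conv-powerSum-∷ b (suc t) k α))
          (trans (∑-+ (upTo D) (λ t → A t ℚ.* X α) (λ t → multichoose b k ℚ.* C t))
            (cong₂ ℚ._+_ (∑-*ʳ (upTo D) (X α) A) (∑-*ˡ (upTo D) (multichoose b k) C)))) ⟩
    ι b ℚ.* (∑ (upTo D) A ℚ.* X α ℚ.+ multichoose b k ℚ.* ∑ (upTo D) C)
      ≡⟨ ℚ.*-distribˡ-+ (ι b) (∑ (upTo D) A ℚ.* X α) (multichoose b k ℚ.* ∑ (upTo D) C) ⟩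
    ι b ℚ.* (∑ (upTo D) A ℚ.* X α) ℚ.+ ι b ℚ.* (multichoose b k ℚ.* ∑ (upTo D) C)
      ≡⟨ cong₂ ℚ._+_ (trans (sym (ℚ.*-assoc (ι b) (∑ (upTo D) A) (X α)))
          (trans (cong (ℚ._* X α) (∑-positive b k D (≤-trans (m≤m+n k (size α)) le)))
          (ℚ.*-assoc (ι k) (multichoose b k) (X α))))
          (trans (*-swap (ι b) (multichoose b k) (∑ (upTo D) C))
              (trans (cong (multichoose b k ℚ.*_) (euler b α D (≤-trans (m≤n+m (size α) k) le)))
            (*-swap (multichoose b k) (ι (size α)) (X α)))) ⟩
    ι k ℚ.* (multichoose b k ℚ.* X α) ℚ.+ ι (size α) ℚ.* (multichoose b k ℚ.* X α)
      ≡⟨ trans (sym (ℚ.*-distribʳ-+ (multichoose b k ℚ.* X α) (ι k) (ι (size α))))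
          (cong (ℚ._* (multichoose b k ℚ.* X α)) (sym (ι-+ k (size α)))) ⟩
    ι (k + size α) ℚ.* (multichoose b k ℚ.* X α) ∎
    where
    open ≡-Reasoning
    X : ∀ {n} → Vec ℕ n → ℚ
    X = ∏multichoose b
    A C : ℕ → ℚ
    A t = ∑ (upTo (suc k)) (λ i → ⟦ i ≟ suc t ⟧ ℚ.* multichoose b (k ∸ i))
    C t = conv (powerSum (suc t)) X α

  -- The coefficient of x^α in h_d[bX], i.e. the degree d part of ∏ᵢ (1 - xᵢ)⁻ᵇ.
  plethysm : ℕ → ℕ → ∀ {n} → Vec ℕ n → ℚ
  plethysm b d α = ⟦ size α ≟ d ⟧ ℚ.* ∏multichoose b α

  -- Next to a factor of degree j, the degree d part of a product meets exactly the degree d - j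
  -- part of the other factor.
  conv-homogeneous : ∀ {f : Vec ℕ n → ℚ} {j} b {d} → (∀ β → size β ≢ j → f β ≡ 0ℚ) → j ≤ d → ∀ α →
    conv f (plethysm b (d ∸ j)) α ≡ ⟦ size α ≟ d ⟧ ℚ.* conv f (∏multichoose b) α
  conv-homogeneous {f = f} {j} b {d} hom j≤d α = trans
    (∑-cong (splittings α) (λ (β , γ) βγ∈ → term β γ (∈-splittings α βγ∈) (size β ≟ j)))
    (∑-*ˡ (splittings α) ⟦ size α ≟ d ⟧ (λ (β , γ) → f β ℚ.* ∏multichoose b γ))
    where
    term : ∀ β γ → size β + size γ ≡ size α → Dec (size β ≡ j) →
      f β ℚ.* plethysm b (d ∸ j) γ ≡ ⟦ size α ≟ d ⟧ ℚ.* (f β ℚ.* ∏multichoose b γ)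
    term β γ eq (yes refl) = trans (*-swap (f β) ⟦ size γ ≟ d ∸ size β ⟧ (∏multichoose b γ))
      (cong (ℚ._* (f β ℚ.* ∏multichoose b γ)) (⟦⟧-cong (size γ ≟ d ∸ size β) (size α ≟ d)
        (λ γ≡ → trans (sym eq) (trans (cong (size β +_) γ≡) (m+[n∸m]≡n j≤d)))
        (λ α≡ → trans (sym (m+n∸m≡n (size β) (size γ))) (cong (_∸ size β) (trans eq α≡)))))
    term β γ eq (no ne) = trans (*-0ˡ (hom β ne) (plethysm b (d ∸ j) γ))
      (sym (*-0ʳ ⟦ size α ≟ d ⟧ (*-0ˡ (hom β ne) (∏multichoose b γ))))

  vec-sum : ∀ (α : Vec ℕ n) → Vec.sum α ≡ size α
  vec-sum []      = refl
  vec-sum (k ∷ α) = cong (k +_) (vec-sum α)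

  hᵏ-size : ∀ k (α : Vec ℕ n) → hᵏ k n α ≡ ⟦ size α ≟ k ⟧
  hᵏ-size k α = cong (λ t → ⟦ t ≟ k ⟧) (vec-sum α)

  plethysm-powerSum : ∀ b d (α : Vec ℕ n) →
    ι b ℚ.* ∑ (upTo d) (λ t → conv (pᵏ (suc t) n) (plethysm b (d ∸ suc t)) α) ≡ ι d ℚ.* plethysm b d α
  plethysm-powerSum {n} b d α = begin
    ι b ℚ.* ∑ (upTo d) (λ t → conv (pᵏ (suc t) n) (plethysm b (d ∸ suc t)) α)
      ≡⟨ cong (ι b ℚ.*_) (trans (∑-cong (upTo d) (λ t t∈ → conv-homogeneous b (powerSum-degree (suc t)) (Mem.∈-upTo⁻ t∈) α))
           (∑-*ˡ (upTo d) ⟦ size α ≟ d ⟧ (λ t → conv (powerSum (suc t)) (∏multichoose b) α))) ⟩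
    ι b ℚ.* (⟦ size α ≟ d ⟧ ℚ.* ∑ (upTo d) (λ t → conv (powerSum (suc t)) (∏multichoose b) α))
      ≡⟨ *-swap (ι b) ⟦ size α ≟ d ⟧ _ ⟩
    ⟦ size α ≟ d ⟧ ℚ.* (ι b ℚ.* ∑ (upTo d) (λ t → conv (powerSum (suc t)) (∏multichoose b) α))
      ≡⟨ ⟦⟧-*-cong (size α ≟ d) (λ { refl → euler b α d ≤-refl }) ⟩
    ⟦ size α ≟ d ⟧ ℚ.* (ι (size α) ℚ.* ∏multichoose b α)
      ≡⟨ ⟦⟧-*-cong (size α ≟ d) (λ { refl → refl }) ⟩
    ⟦ size α ≟ d ⟧ ℚ.* (ι d ℚ.* ∏multichoose b α)
      ≡⟨ *-swap ⟦ size α ≟ d ⟧ (ι d) (∏multichoose b α) ⟩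
    ι d ℚ.* plethysm b d α ∎
    where open ≡-Reasoning

  -- All coefficients of ∑ⱼ hⱼ are 1, so multiplying by it adds one factor (1 - xᵢ)⁻¹ in every
  -- variable. The term of h₀ = 1 stands apart because removing a part of a partition yields only
  -- the terms with j ≥ 1.
  plethysm-complete : ∀ b d (α : Vec ℕ n) →
    plethysm b d α ℚ.+ ∑ (upTo d) (λ t → conv (hᵏ (suc t) n) (plethysm b (d ∸ suc t)) α) ≡ plethysm (suc b) d α
  plethysm-complete {n} b d α = begin
    plethysm b d α ℚ.+ ∑ (upTo d) (λ t → conv (hᵏ (suc t) n) (plethysm b (d ∸ suc t)) α)
      ≡⟨ cong₂ ℚ._+_ (sym (trans (conv-cong {g = plethysm b d} (hᵏ-size 0) (λ _ → refl) α) (conv-one (plethysm b d) α)))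
          refl ⟩
    conv (hᵏ 0 n) (plethysm b d) α ℚ.+ ∑ (upTo d) (λ t → conv (hᵏ (suc t) n) (plethysm b (d ∸ suc t)) α)
      ≡⟨ sym (∑-upTo-suc d (λ t → conv (hᵏ t n) (plethysm b (d ∸ t)) α)) ⟩
    ∑ D (λ t → conv (hᵏ t n) (plethysm b (d ∸ t)) α)
      ≡⟨ ∑-cong D (λ t t∈ → conv-homogeneous b (λ β ne → trans (hᵏ-size t β) (⟦⟧-no (size β ≟ t) ne))
          (s≤s⁻¹ (Mem.∈-upTo⁻ t∈)) α) ⟩
    ∑ D (λ t → ⟦ size α ≟ d ⟧ ℚ.* conv (hᵏ t n) X α)
      ≡⟨ ∑-*ˡ D ⟦ size α ≟ d ⟧ (λ t → conv (hᵏ t n) X α) ⟩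
    ⟦ size α ≟ d ⟧ ℚ.* ∑ D (λ t → conv (hᵏ t n) X α)
      ≡⟨ ⟦⟧-*-cong (size α ≟ d) total ⟩
    ⟦ size α ≟ d ⟧ ℚ.* ∏multichoose (suc b) α ∎
    where
    open ≡-Reasoning
    D = upTo (suc d)
    X : Vec ℕ n → ℚ
    X = ∏multichoose b
    total : size α ≡ d → ∑ D (λ t → conv (hᵏ t n) X α) ≡ ∏multichoose (suc b) α
    total refl = trans (sym (conv-∑ˡ D (λ t → hᵏ t n) X α)) (trans
      (∑-cong (splittings α) (λ (β , γ) βγ∈ → cong (ℚ._* X γ) (trans (∑-ext D (λ t → hᵏ-size t β))
        (let β≤ = ≤-trans (m≤m+n (size β) (size γ)) (≤-reflexive (∈-splittings α βγ∈)) in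
          ∑-⟦⟧-1 (size β ≟_) (Unique.upTo⁺ (suc d)) (Mem.∈-upTo⁺ (s≤s β≤)) refl sym))))
      (∑-∏multichoose b α))

-- Sums over partitions with a marked part

module AddingParts where

  open RationalSums
  open PartitionLists
  open Plethysm
  open import Data.Nat.Base
  open import Data.Nat.Properties
  open import Data.Rational.Base using (ℚ; 1ℚ)

  mult : List ℕ → ℕ → ℕ
  mult μ j = length (filter (_≟ j) μ)

  mult-here : ∀ k μ → mult (k ∷ μ) k ≡ suc (mult μ k)
  mult-here k μ = cong length (List.filter-accept (_≟ k) refl)

  mult-there : ∀ {k j} μ → k ≢ j → mult (k ∷ μ) j ≡ mult μ j
  mult-there {j = j} μ ne = cong length (List.filter-reject (_≟ j) ne)

  insertPart : ℕ → List ℕ → List ℕ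
  insertPart j []      = j ∷ []
  insertPart j (k ∷ μ) with k ≤? j
  ... | yes _ = j ∷ k ∷ μ
  ... | no _  = k ∷ insertPart j μ

  deletePart : ℕ → List ℕ → List ℕ
  deletePart j []      = []
  deletePart j (k ∷ μ) with k ≟ j
  ... | yes _ = μ
  ... | no _  = k ∷ deletePart j μ

  mult-insert : ∀ j μ → mult (insertPart j μ) j ≡ suc (mult μ j)
  mult-insert j []      = mult-here j []
  mult-insert j (k ∷ μ) with k ≤? j
  ... | yes _ = mult-here j (k ∷ μ)
  ... | no k≰j = trans (mult-there (insertPart j μ) k≢j) (trans (mult-insert j μ) (cong suc (sym (mult-there μ k≢j))))
    where
    k≢j : k ≢ j
    k≢j refl = k≰j ≤-refl

  mult-insert-≢ : ∀ {j i} μ → i ≢ j → mult (insertPart j μ) i ≡ mult μ i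
  mult-insert-≢ {j} {i} []      ne = mult-there [] (ne ∘ sym)
  mult-insert-≢ {j} {i} (k ∷ μ) ne with k ≤? j
  ... | yes _ = mult-there (k ∷ μ) (ne ∘ sym)
  ... | no _ with k ≟ i
  ... | yes refl = trans (mult-here k (insertPart j μ)) (trans (cong suc (mult-insert-≢ μ ne)) (sym (mult-here k μ)))
  ... | no k≢i   = trans (mult-there (insertPart j μ) k≢i) (trans (mult-insert-≢ μ ne) (sym (mult-there μ k≢i)))

  length-insert : ∀ j μ → length (insertPart j μ) ≡ suc (length μ)
  length-insert j []      = refl
  length-insert j (k ∷ μ) with k ≤? j
  ... | yes _ = refl
  ... | no _  = cong suc (length-insert j μ)

  sum-insert : ∀ j μ → sum (insertPart j μ) ≡ j + sum μ
  sum-insert j []      = refl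
  sum-insert j (k ∷ μ) with k ≤? j
  ... | yes _ = refl
  ... | no _  = trans (cong (k +_) (sum-insert j μ))
      (trans (sym (+-assoc k j (sum μ))) (trans (cong (_+ sum μ) (+-comm k j)) (+-assoc j k (sum μ))))

  all-insert : ∀ {P : ℕ → Set} {j μ} → P j → All P μ → All P (insertPart j μ)
  all-insert {μ = []}        pj _        = pj ∷ []
  all-insert {j = j} {k ∷ μ} pj (pk ∷ h) with k ≤? j
  ... | yes _ = pj ∷ pk ∷ h
  ... | no _  = pk ∷ all-insert pj h

  insert-decreasing : ∀ {j μ} → AllPairs _≥_ μ → AllPairs _≥_ (insertPart j μ)
  insert-decreasing {μ = []}        _        = [] ∷ []
  insert-decreasing {j} {k ∷ μ} (k≥ ∷ d) with k ≤? j
  ... | yes k≤j = (k≤j ∷ All.map (λ i≤k → ≤-trans i≤k k≤j) k≥) ∷ k≥ ∷ d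
  ... | no k≰j  = all-insert (<⇒≤ (≰⇒> k≰j)) k≥ ∷ insert-decreasing d

  delete-insert : ∀ j μ → deletePart j (insertPart j μ) ≡ μ
  delete-insert j [] with j ≟ j
  ... | yes _ = refl
  ... | no ne = contradiction refl ne
  delete-insert j (k ∷ μ) with k ≤? j
  ... | yes _ with j ≟ j
  ...   | yes _ = refl
  ...   | no ne = contradiction refl ne
  delete-insert j (k ∷ μ) | no k≰j with k ≟ j
  ...   | yes refl = contradiction ≤-refl k≰j
  ...   | no _     = cong (k ∷_) (delete-insert j μ)

  insert-max : ∀ j μ → All (_≤ j) μ → insertPart j μ ≡ j ∷ μ
  insert-max j []      _       = refl
  insert-max j (k ∷ μ) (p ∷ _) with k ≤? j
  ... | yes _ = refl
  ... | no ne = contradiction p ne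

  insert-delete : ∀ {j μ} → AllPairs _≥_ μ → j ∈ μ → insertPart j (deletePart j μ) ≡ μ
  insert-delete {j} {k ∷ μ} (k≥ ∷ d) j∈ with k ≟ j
  ... | yes refl = insert-max k μ k≥
  ... | no k≢j with j∈
  ...   | here refl = contradiction refl k≢j
  ...   | there j∈′ with k ≤? j
  ...     | yes k≤j = contradiction (≤-antisym k≤j (All.lookup k≥ j∈′)) k≢j
  ...     | no _    = cong (k ∷_) (insert-delete d j∈′)

  all-delete : ∀ {P : ℕ → Set} {j μ} → All P μ → All P (deletePart j μ)
  all-delete {μ = []} _ = []
  all-delete {j = j} {k ∷ μ} (p ∷ h) with k ≟ j
  ... | yes _ = h
  ... | no _  = p ∷ all-delete h

  delete-decreasing : ∀ {j μ} → AllPairs _≥_ μ → AllPairs _≥_ (deletePart j μ)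
  delete-decreasing {μ = []} _ = []
  delete-decreasing {j} {k ∷ μ} (k≥ ∷ d) with k ≟ j
  ... | yes _ = d
  ... | no _  = all-delete k≥ ∷ delete-decreasing d

  mult>0⇒∈ : ∀ {j} μ → 1 ≤ mult μ j → j ∈ μ
  mult>0⇒∈ {j} (k ∷ μ) pos with k ≟ j
  ... | yes refl = here refl
  ... | no ne    = there (mult>0⇒∈ μ (subst (1 ≤_) (mult-there μ ne) pos))

  ≥-trans : ∀ {i j k} → i ≥ j → j ≥ k → i ≥ k
  ≥-trans p q = ≤-trans q p

  insert-partition : ∀ {d j ν} → 1 ≤ j → j ≤ d → IsPartition (d ∸ j) ν → IsPartition d (insertPart j ν)
  insert-partition {d} {j} {ν} 1≤j j≤d (isPartition sz pos dec) = isPartition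
    (trans (sum-insert j ν) (trans (cong (λ t → j + t) sz) (m+[n∸m]≡n j≤d)))
    (all-insert 1≤j pos) (AllPairs⇒Linked (insert-decreasing (Linked⇒AllPairs ≥-trans dec)))

  delete-partition : ∀ {d j μ} → j ∈ μ → IsPartition d μ → IsPartition (d ∸ j) (deletePart j μ) × insertPart j
      (deletePart j μ) ≡ μ
  delete-partition {d} {j} {μ} j∈ (isPartition refl pos dec) = isPartition
    (trans (sym (m+n∸m≡n j (sum (deletePart j μ)))) (cong (_∸ j) (trans (sym (sum-insert j (deletePart j μ))) (cong sum eq))))
    (all-delete pos) (AllPairs⇒Linked (delete-decreasing dec′)) , eq
    where
    dec′ : AllPairs _≥_ μ
    dec′ = Linked⇒AllPairs ≥-trans dec
    eq : insertPart j (deletePart j μ) ≡ μ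
    eq = insert-delete dec′ j∈

  -- The factor m_j removes the partitions without a part j; each of the others arises from exactly
  -- one ν by insertion.
  ∑-insertPart : ∀ {d j} → 1 ≤ j → j ≤ d → (W : List ℕ → ℚ) →
    ∑ (partitionLists d) (λ μ → ι (mult μ j) ℚ.* W μ) ≡
    ∑ (partitionLists (d ∸ j)) (λ ν → ι (suc (mult ν j)) ℚ.* W (insertPart j ν))
  ∑-insertPart {d} {j} 1≤j j≤d W = begin
    ∑ P G
      ≡⟨ ∑-ext P (λ μ → support μ (has? μ)) ⟩
    ∑ P (λ μ → ⟦ has? μ ⟧ ℚ.* G μ)
      ≡⟨ sym (∑-filter has? P G) ⟩
    ∑ (filter has? P) G
      ≡⟨ sym (∑-bij (partitionLists-unique (d ∸ j)) (Unique.filter⁺ has? (partitionLists-unique d)) (insertPart j)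
          (λ {ν} ν∈ → Mem.∈-filter⁺ has? (∈-partitionLists⁺ (insert-partition 1≤j j≤d (∈-partitionLists⁻ ν∈)))
              (subst (1 ≤_) (sym (mult-insert j ν)) (s≤s z≤n)))
          (λ {ν} {ν′} _ _ eq → trans (sym (delete-insert j ν)) (trans (cong (deletePart j) eq) (delete-insert j ν′)))
          (λ {μ} μ∈ → let (μ∈P , has) = Mem.∈-filter⁻ has? {xs = P} μ∈
                          (isp , eq) = delete-partition (mult>0⇒∈ μ has) (∈-partitionLists⁻ μ∈P) in
              deletePart j μ , ∈-partitionLists⁺ isp , eq)
          {λ ν → ι (suc (mult ν j)) ℚ.* W (insertPart j ν)} {G}
          (λ {ν} _ → cong (λ t → ι t ℚ.* W (insertPart j ν)) (sym (mult-insert j ν)))) ⟩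
    ∑ (partitionLists (d ∸ j)) (λ ν → ι (suc (mult ν j)) ℚ.* W (insertPart j ν)) ∎
    where
    open ≡-Reasoning
    P = partitionLists d
    G : List ℕ → ℚ
    G μ = ι (mult μ j) ℚ.* W μ
    has? : ∀ μ → Dec (1 ≤ mult μ j)
    has? μ = 1 ≤? mult μ j
    support : ∀ μ (e : Dec (1 ≤ mult μ j)) → G μ ≡ ⟦ e ⟧ ℚ.* G μ
    support μ (yes _) = sym (ℚ.*-identityˡ (G μ))
    support μ (no ne) = trans (*-0ˡ (trans (cong ι (n<1⇒n≡0 (≰⇒> ne))) ι-0) (W μ)) (sym (ℚ.*-zeroˡ (G μ)))

  ∏ˢ-insert : ∀ (f : ℕ → Series) j ν n α → ∏ˢ f (insertPart j ν) n α ≡ conv (f j n) (∏ˢ f ν n) α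
  ∏ˢ-insert f j []      n α = refl
  ∏ˢ-insert f j (k ∷ ν) n α with k ≤? j
  ... | yes _ = refl
  ... | no _  = trans (conv-cong {f = f k n} (λ _ → refl) (∏ˢ-insert f j ν n) α) (conv-swap (f k n) (f j n) (∏ˢ f ν n) α)

  -- Collects the parts of μ by size; every size lies between 1 and d.
  ∑-mult : ∀ {d} μ (F : ℕ → ℚ) → All (1 ≤_) μ → All (_≤ d) μ →
    ∑ (upTo d) (λ t → F (suc t) ℚ.* ι (mult μ (suc t))) ≡ ∑ μ F
  ∑-mult {d} []      F _ _ = ∑-zero (upTo d) (λ t _ → *-0ʳ (F (suc t)) ι-0)
  ∑-mult {d} (suc k ∷ μ) F (_ ∷ pos) (k<d ∷ bnd) = begin
    ∑ (upTo d) (λ t → F (suc t) ℚ.* ι (mult (suc k ∷ μ) (suc t)))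
      ≡⟨ ∑-ext (upTo d) (λ t → step t (suc k ≟ suc t)) ⟩
    ∑ (upTo d) (λ t → ⟦ suc k ≟ suc t ⟧ ℚ.* F (suc t) ℚ.+ F (suc t) ℚ.* ι (mult μ (suc t)))
      ≡⟨ ∑-+ (upTo d) (λ t → ⟦ suc k ≟ suc t ⟧ ℚ.* F (suc t)) (λ t → F (suc t) ℚ.* ι (mult μ (suc t))) ⟩
    ∑ (upTo d) (λ t → ⟦ suc k ≟ suc t ⟧ ℚ.* F (suc t)) ℚ.+ ∑ (upTo d) (λ t → F (suc t) ℚ.* ι (mult μ (suc t)))
      ≡⟨ cong₂ ℚ._+_
          (∑-⟦⟧-* (λ t → suc k ≟ suc t) (Unique.upTo⁺ d) (Mem.∈-upTo⁺ k<d) refl (λ eq → sym (suc-injective eq)) (F ∘ suc))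
          (∑-mult μ F pos bnd) ⟩
    F (suc k) ℚ.+ ∑ μ F ∎
    where
    open ≡-Reasoning
    step : ∀ t → Dec (suc k ≡ suc t) → F (suc t) ℚ.* ι (mult (suc k ∷ μ) (suc t)) ≡
      ⟦ suc k ≟ suc t ⟧ ℚ.* F (suc t) ℚ.+ F (suc t) ℚ.* ι (mult μ (suc t))
    step t (yes refl) = trans (cong (λ u → F (suc k) ℚ.* ι u) (mult-here (suc k) μ))
      (trans (cong (F (suc k) ℚ.*_) (ι-suc (mult μ (suc k))))
      (trans (ℚ.*-distribˡ-+ (F (suc k)) 1ℚ (ι (mult μ (suc k))))
        (cong (ℚ._+ F (suc k) ℚ.* ι (mult μ (suc k)))
            (trans (ℚ.*-identityʳ (F (suc k))) (sym (⟦⟧-*-yes (suc k ≟ suc k) refl (F (suc k))))))))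
    step t (no ne) = trans (cong (λ u → F (suc t) ℚ.* ι u) (mult-there μ ne))
      (trans (sym (ℚ.+-identityˡ (F (suc t) ℚ.* ι (mult μ (suc t)))))
        (cong (ℚ._+ F (suc t) ℚ.* ι (mult μ (suc t))) (sym (⟦⟧-*-no (suc k ≟ suc t) ne (F (suc t))))))

  -- ∏_k r(k)^{m_k} / m_k!
  weight : (ℕ → ℚ) → List ℕ → ℚ
  weight r []      = 1ℚ
  weight r (k ∷ μ) = r k ℚ.* (1/ι (suc (mult μ k)) ℚ.* weight r μ)

  -- The definition of `weight` follows the order of the list, but the factors of different part
  -- sizes are independent: inserting in the middle costs the same as adding at the front.
  weight-insert : ∀ r j ν → weight r (insertPart j ν) ≡ r j ℚ.* (1/ι (suc (mult ν j)) ℚ.* weight r ν)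
  weight-insert r j []      = refl
  weight-insert r j (k ∷ ν) with k ≤? j
  ... | yes _ = refl
  ... | no k≰j = begin
    r k ℚ.* (1/ι (suc (mult (insertPart j ν) k)) ℚ.* weight r (insertPart j ν))
      ≡⟨ cong₂ (λ u v → r k ℚ.* (1/ι (suc u) ℚ.* v)) (mult-insert-≢ ν k≢j) (weight-insert r j ν) ⟩
    r k ℚ.* (x ℚ.* (r j ℚ.* (y ℚ.* weight r ν)))
      ≡⟨ cong (r k ℚ.*_) (*-swap x (r j) (y ℚ.* weight r ν)) ⟩
    r k ℚ.* (r j ℚ.* (x ℚ.* (y ℚ.* weight r ν)))
      ≡⟨ *-swap (r k) (r j) _ ⟩
    r j ℚ.* (r k ℚ.* (x ℚ.* (y ℚ.* weight r ν)))
      ≡⟨ cong (r j ℚ.*_) (trans (cong (r k ℚ.*_) (*-swap x y (weight r ν))) (*-swap (r k) y (x ℚ.* weight r ν))) ⟩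
    r j ℚ.* (y ℚ.* (r k ℚ.* (x ℚ.* weight r ν)))
      ≡⟨ cong (λ u → r j ℚ.* (1/ι (suc u) ℚ.* (r k ℚ.* (x ℚ.* weight r ν)))) (sym (mult-there ν k≢j)) ⟩
    r j ℚ.* (1/ι (suc (mult (k ∷ ν) j)) ℚ.* (r k ℚ.* (x ℚ.* weight r ν))) ∎
    where
    open ≡-Reasoning
    k≢j : k ≢ j
    k≢j refl = k≰j ≤-refl
    x y : ℚ
    x = 1/ι (suc (mult ν k))
    y = 1/ι (suc (mult ν j))

  -- Σ_{μ ⊢ d} e(ℓ(μ)) ∏ r(k)^{m_k} / m_k! f_μ
  generating : (ℕ → ℚ) → (ℕ → ℚ) → (ℕ → Series) → ℕ → ∀ n → Vec ℕ n → ℚ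
  generating e r f d n α = ∑ (partitionLists d) (λ μ → (e (length μ) ℚ.* weight r μ) ℚ.* ∏ˢ f μ n α)

  -- The factor m_j marks a part j. Removing that part cancels m_j against 1 / m_j!, releases `r j`
  -- and the series of index j, and shortens the partition by one, whence `e ∘ suc`.
  generating-mult : ∀ e r f {d t} → t < d → ∀ n α →
    ∑ (partitionLists d) (λ μ → ι (mult μ (suc t)) ℚ.* ((e (length μ) ℚ.* weight r μ) ℚ.* ∏ˢ f μ n α)) ≡
    r (suc t) ℚ.* conv (f (suc t) n) (generating (e ∘ suc) r f (d ∸ suc t) n) α
  generating-mult e r f {d} {t} t<d n α = begin
    ∑ (partitionLists d) (λ μ → ι (mult μ j) ℚ.* W μ)
      ≡⟨ ∑-insertPart (s≤s z≤n) t<d W ⟩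
    ∑ Q (λ ν → ι (suc (mult ν j)) ℚ.* W (insertPart j ν))
      ≡⟨ ∑-ext Q term ⟩
    ∑ Q (λ ν → r j ℚ.* ((e (suc (length ν)) ℚ.* weight r ν) ℚ.* conv (f j n) (∏ˢ f ν n) α))
      ≡⟨ ∑-*ˡ Q (r j) (λ ν → (e (suc (length ν)) ℚ.* weight r ν) ℚ.* conv (f j n) (∏ˢ f ν n) α) ⟩
    r j ℚ.* ∑ Q (λ ν → (e (suc (length ν)) ℚ.* weight r ν) ℚ.* conv (f j n) (∏ˢ f ν n) α)
      ≡⟨ cong (r j ℚ.*_) (trans (∑-ext Q (λ ν → sym (conv-*ʳ (f j n) (e (suc (length ν)) ℚ.* weight r ν) (∏ˢ f ν n) α)))
           (sym (conv-∑ʳ (f j n) Q (λ ν γ → (e (suc (length ν)) ℚ.* weight r ν) ℚ.* ∏ˢ f ν n γ) α))) ⟩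
    r j ℚ.* conv (f j n) (generating (e ∘ suc) r f (d ∸ j) n) α ∎
    where
    open ≡-Reasoning
    j = suc t
    Q = partitionLists (d ∸ j)
    W : List ℕ → ℚ
    W μ = (e (length μ) ℚ.* weight r μ) ℚ.* ∏ˢ f μ n α
    cancel : ∀ k e r w p → ι (suc k) ℚ.* ((e ℚ.* (r ℚ.* (1/ι (suc k) ℚ.* w))) ℚ.* p) ≡ r ℚ.* ((e ℚ.* w) ℚ.* p)
    cancel k e r w p = begin
      ι (suc k) ℚ.* ((e ℚ.* (r ℚ.* (1/ι (suc k) ℚ.* w))) ℚ.* p)
        ≡⟨ solve 6 (λ i u e r w p → i :* ((e :* (r :* (u :* w))) :* p) := (u :* i) :* (r :* ((e :* w) :* p))) refl
            (ι (suc k)) (1/ι (suc k)) e r w p ⟩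
      (1/ι (suc k) ℚ.* ι (suc k)) ℚ.* (r ℚ.* ((e ℚ.* w) ℚ.* p))
        ≡⟨ trans (cong (ℚ._* (r ℚ.* ((e ℚ.* w) ℚ.* p))) (1/ι-*-ι (suc k))) (ℚ.*-identityˡ (r ℚ.* ((e ℚ.* w) ℚ.* p))) ⟩
      r ℚ.* ((e ℚ.* w) ℚ.* p) ∎
      where
      open +-*-Solver
    term : ∀ ν → ι (suc (mult ν j)) ℚ.* W (insertPart j ν) ≡
      r j ℚ.* ((e (suc (length ν)) ℚ.* weight r ν) ℚ.* conv (f j n) (∏ˢ f ν n) α)
    term ν = trans (cong (ι (suc (mult ν j)) ℚ.*_)
        (cong₂ ℚ._*_ (cong₂ ℚ._*_ (cong e (length-insert j ν)) (weight-insert r j ν)) (∏ˢ-insert f j ν n α)))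
      (cancel (mult ν j) (e (suc (length ν))) (r j) (weight r ν) (conv (f j n) (∏ˢ f ν n) α))

  -- Marks one part of μ with weight F. For F = `ι` the weights add up to d, for F = 1 to the number
  -- of parts.
  generating-∑ : ∀ e r f d n α (F : ℕ → ℚ) →
    ∑ (partitionLists d) (λ μ → ∑ μ F ℚ.* ((e (length μ) ℚ.* weight r μ) ℚ.* ∏ˢ f μ n α)) ≡
    ∑ (upTo d) (λ t → F (suc t) ℚ.* (r (suc t) ℚ.* conv (f (suc t) n) (generating (e ∘ suc) r f (d ∸ suc t) n) α))
  generating-∑ e r f d n α F = begin
    ∑ P (λ μ → ∑ μ F ℚ.* W μ)
      ≡⟨ ∑-cong P (λ μ μ∈ → trans (cong (ℚ._* W μ) (sym (split μ (∈-partitionLists⁻ μ∈))))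
          (sym (∑-*ʳ (upTo d) (W μ) (λ t → F (suc t) ℚ.* ι (mult μ (suc t)))))) ⟩
    ∑ P (λ μ → ∑ (upTo d) (λ t → (F (suc t) ℚ.* ι (mult μ (suc t))) ℚ.* W μ))
      ≡⟨ ∑-swap P (upTo d) (λ μ t → (F (suc t) ℚ.* ι (mult μ (suc t))) ℚ.* W μ) ⟩
    ∑ (upTo d) (λ t → ∑ P (λ μ → (F (suc t) ℚ.* ι (mult μ (suc t))) ℚ.* W μ))
      ≡⟨ ∑-cong (upTo d) (λ t t∈ → trans (∑-ext P (λ μ → ℚ.*-assoc (F (suc t)) (ι (mult μ (suc t))) (W μ)))
          (trans (∑-*ˡ P (F (suc t)) (λ μ → ι (mult μ (suc t)) ℚ.* W μ))
              (cong (F (suc t) ℚ.*_) (generating-mult e r f (Mem.∈-upTo⁻ t∈) n α)))) ⟩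
    ∑ (upTo d) (λ t → F (suc t) ℚ.* (r (suc t) ℚ.* conv (f (suc t) n) (generating (e ∘ suc) r f (d ∸ suc t) n) α)) ∎
    where
    open ≡-Reasoning
    P = partitionLists d
    W : List ℕ → ℚ
    W μ = (e (length μ) ℚ.* weight r μ) ℚ.* ∏ˢ f μ n α
    split : ∀ μ → IsPartition d μ → ∑ (upTo d) (λ t → F (suc t) ℚ.* ι (mult μ (suc t))) ≡ ∑ μ F
    split μ (isPartition refl pos _) = ∑-mult μ F pos (All.tabulate (λ k∈ → part≤sum k∈))

-- Generating functions for power sums and complete functions

module GeneratingFunctions where

  open RationalSums
  open PartitionLists
  open Plethysm
  open AddingParts
  open LocalRule using (multichoose; size; size≡0)
  open Cauchy using (∏multichoose)
  open import Data.Integer.Base using (+_)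
  open import Data.Nat.Base using (ℕ; zero; suc; _∸_; _≤_; _<_; s≤s)
  open import Data.Rational.Base using (ℚ; 0ℚ; 1ℚ; _/_; _*_; _+_)

  private variable
    n : ℕ

  multichoose-0 : ∀ b → multichoose b 0 ≡ 1ℚ
  multichoose-0 zero    = refl
  multichoose-0 (suc b) = trans (ℚ.+-identityʳ (multichoose b 0)) (multichoose-0 b)

  ∏multichoose-0 : ∀ b n → ∏multichoose b (Vec.replicate n 0) ≡ 1ℚ
  ∏multichoose-0 b zero    = refl
  ∏multichoose-0 b (suc n) = trans (cong₂ _*_ (multichoose-0 b) (∏multichoose-0 b n)) (ℚ.*-identityˡ 1ℚ)

  ∏multichoose-none : ∀ (α : Vec ℕ n) → size α ≢ 0 → ∏multichoose 0 α ≡ 0ℚ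
  ∏multichoose-none []          ne = contradiction refl ne
  ∏multichoose-none (zero ∷ α)  ne = *-0ʳ 1ℚ (∏multichoose-none α ne)
  ∏multichoose-none (suc k ∷ α) ne = ℚ.*-zeroˡ (∏multichoose 0 α)

  generating-zero : ∀ e r f b n (α : Vec ℕ n) → e 0 ≡ 1ℚ → generating e r f 0 n α ≡ plethysm b 0 α
  generating-zero e r f b n α e0 = begin
    (e 0 * 1ℚ) * one n α + 0ℚ
      ≡⟨ ℚ.+-identityʳ ((e 0 * 1ℚ) * one n α) ⟩
    (e 0 * 1ℚ) * one n α
      ≡⟨ cong₂ _*_ (trans (ℚ.*-identityʳ (e 0)) e0) (⟦≟-0⟧ α) ⟩
    1ℚ * ⟦ size α ℕ.≟ 0 ⟧
      ≡⟨ ℚ.*-comm 1ℚ ⟦ size α ℕ.≟ 0 ⟧ ⟩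
    ⟦ size α ℕ.≟ 0 ⟧ * 1ℚ
      ≡⟨ ⟦⟧-*-cong (size α ℕ.≟ 0) (λ eq → sym (trans (cong (∏multichoose b) (size≡0 α eq)) (∏multichoose-0 b n))) ⟩
    plethysm b 0 α ∎
    where open ≡-Reasoning

  ∑-ι : ∀ μ → ∑ μ ι ≡ ι (sum μ)
  ∑-ι []      = sym ι-0
  ∑-ι (k ∷ μ) = trans (cong (λ t → ι k + t) (∑-ι μ)) (sym (ι-+ k (sum μ)))

  -- With the rate b / k, `weight` becomes b^ℓ / z_μ; see `weight-z`.
  powerSumRate : ℕ → ℕ → ℚ
  powerSumRate b zero    = 0ℚ
  powerSumRate b (suc k) = ι b * 1/ι (suc k)

  -- Strong induction on d, carried by the bound D. The factor d enters as the sum of the parts; for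
  -- a part of size j, its weight j turns the rate b / j into b.
  generating-p : ∀ b d D → d ≤ D → ∀ n (α : Vec ℕ n) → generating (λ _ → 1ℚ) (powerSumRate b) pᵏ d n α ≡ plethysm b d α
  generating-p b zero    D       _         n α = generating-zero (λ _ → 1ℚ) (powerSumRate b) pᵏ b n α refl
  generating-p b d@(suc d′) (suc D) (s≤s d′≤D) n α = ι-cancelˡ d (begin
    ι d * generating e r pᵏ d n α
      ≡⟨ sym (∑-*ˡ P (ι d) W) ⟩
    ∑ P (λ μ → ι d * W μ)
      ≡⟨ ∑-cong P (λ μ μ∈ → cong (_* W μ) (trans (cong ι (sym (IsPartition.sums-to (∈-partitionLists⁻ μ∈)))) (sym (∑-ι μ)))) ⟩
    ∑ P (λ μ → ∑ μ ι * W μ)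
      ≡⟨ generating-∑ e r pᵏ d n α ι ⟩
    ∑ (upTo d) (λ t → ι (suc t) * (r (suc t) * conv (pᵏ (suc t) n) (generating e r pᵏ (d ∸ suc t) n) α))
      ≡⟨ ∑-ext (upTo d) (λ t → trans (rate t (conv (pᵏ (suc t) n) (generating e r pᵏ (d ∸ suc t) n) α))
           (cong (ι b *_) (conv-cong {f = pᵏ (suc t) n} (λ _ → refl)
               (generating-p b (d ∸ suc t) D (ℕ.≤-trans (ℕ.m∸n≤m d′ t) d′≤D) n) α))) ⟩
    ∑ (upTo d) (λ t → ι b * conv (pᵏ (suc t) n) (plethysm b (d ∸ suc t)) α)
      ≡⟨ ∑-*ˡ (upTo d) (ι b) (λ t → conv (pᵏ (suc t) n) (plethysm b (d ∸ suc t)) α) ⟩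
    ι b * ∑ (upTo d) (λ t → conv (pᵏ (suc t) n) (plethysm b (d ∸ suc t)) α)
      ≡⟨ plethysm-powerSum b d α ⟩
    ι d * plethysm b d α ∎)
    where
    open ≡-Reasoning
    P = partitionLists d
    e r : ℕ → ℚ
    e _ = 1ℚ
    r = powerSumRate b
    W : List ℕ → ℚ
    W μ = (1ℚ * weight r μ) * ∏ˢ pᵏ μ n α
    rate : ∀ t q → ι (suc t) * (r (suc t) * q) ≡ ι b * q
    rate t q = trans (sym (ℚ.*-assoc (ι (suc t)) (ι b * 1/ι (suc t)) q)) (cong (_* q)
      (trans (*-swap (ι (suc t)) (ι b) (1/ι (suc t)))
          (trans (cong (ι b *_) (trans (ℚ.*-comm (ι (suc t)) (1/ι (suc t))) (1/ι-*-ι (suc t)))) (ℚ.*-identityʳ (ι b)))))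

  -- b! / (b - l)!, the share of the multinomial coefficient that depends on the length l alone; it
  -- is 0 for l > b.
  fallingFactorial : ℕ → ℕ → ℕ
  fallingFactorial b       zero    = 1
  fallingFactorial zero    (suc l) = 0
  fallingFactorial (suc b) (suc l) = suc b ℕ.* fallingFactorial b l

  -- The identity (b + 1 - l) F(b + 1, l) = (b + 1) F(b, l), arranged without subtraction.
  fallingFactorial-suc : ∀ b l → suc b ℕ.* fallingFactorial (suc b) l ≡
    l ℕ.* fallingFactorial (suc b) l ℕ.+ suc b ℕ.* fallingFactorial b l
  fallingFactorial-suc b       zero    = refl
  fallingFactorial-suc zero    (suc zero)    = refl
  fallingFactorial-suc zero    (suc (suc l)) = sym (trans (ℕ.+-identityʳ _) (ℕ.*-zeroʳ (suc (suc l))))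
  fallingFactorial-suc (suc b) (suc l) = trans (cong (suc (suc b) ℕ.*_) (cong (F ℕ.+_) (fallingFactorial-suc b l)))
    (lemma (suc (suc b)) F l (suc b ℕ.* fallingFactorial b l))
    where
    F = fallingFactorial (suc b) l
    lemma : ∀ c f l g → c ℕ.* (f ℕ.+ (l ℕ.* f ℕ.+ g)) ≡ suc l ℕ.* (c ℕ.* f) ℕ.+ c ℕ.* g
    lemma = solve-∀

  -- Induction on b, after multiplication by b + 1. `fallingFactorial-suc` splits off ℓ copies of
  -- each term, read as a marked part; these give the terms j ≥ 1 of `plethysm-complete`, and the
  -- remainder gives the term j = 0.
  generating-h : ∀ b d n (α : Vec ℕ n) → generating (ι ∘ fallingFactorial b) (λ _ → 1ℚ) hᵏ d n α ≡ plethysm b d α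
  generating-h zero    zero    n α = generating-zero (ι ∘ fallingFactorial 0) (λ _ → 1ℚ) hᵏ 0 n α ι-1
  generating-h zero    (suc d) n α = trans
    (∑-zero (partitionLists (suc d)) (λ μ μ∈ → vanish μ (IsPartition.sums-to (∈-partitionLists⁻ μ∈))))
    (sym (⟦⟧-*-0 (size α ℕ.≟ suc d) (λ eq → ∏multichoose-none α (λ eq′ → ℕ.0≢1+n (trans (sym eq′) eq)))))
    where
    vanish : ∀ μ → sum μ ≡ suc d → (ι (fallingFactorial 0 (length μ)) * weight (λ _ → 1ℚ) μ) * ∏ˢ hᵏ μ n α ≡ 0ℚ
    vanish (k ∷ μ) _ = *-0ˡ (*-0ˡ ι-0 (weight (λ _ → 1ℚ) (k ∷ μ))) (∏ˢ hᵏ (k ∷ μ) n α)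
  generating-h (suc b) d n α = ι-cancelˡ (suc b) (begin
    ι (suc b) * generating (ι ∘ ff (suc b)) r hᵏ d n α
      ≡⟨ sym (∑-*ˡ P (ι (suc b)) (W (suc b))) ⟩
    ∑ P (λ μ → ι (suc b) * W (suc b) μ)
      ≡⟨ ∑-ext P (λ μ → recurrence (length μ) (weight r μ) (∏ˢ hᵏ μ n α)) ⟩
    ∑ P (λ μ → ι (length μ) * W (suc b) μ + ι (suc b) * W b μ)
      ≡⟨ ∑-+ P (λ μ → ι (length μ) * W (suc b) μ) (λ μ → ι (suc b) * W b μ) ⟩
    ∑ P (λ μ → ι (length μ) * W (suc b) μ) + ∑ P (λ μ → ι (suc b) * W b μ)
      ≡⟨ cong₂ _+_ (trans (∑-ext P (λ μ → cong (_* W (suc b) μ) (sym (∑-1 μ))))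
          (generating-∑ (ι ∘ ff (suc b)) r hᵏ d n α (λ _ → 1ℚ)))
           (trans (∑-*ˡ P (ι (suc b)) (W b)) (cong (ι (suc b) *_) (generating-h b d n α))) ⟩
    ∑ (upTo d) (λ t → 1ℚ * (1ℚ * conv (hᵏ (suc t) n) (generating (ι ∘ ff (suc b) ∘ suc) r hᵏ (d ∸ suc t) n) α)) + ι
        (suc b) * plethysm b d α
      ≡⟨ cong (_+ ι (suc b) * plethysm b d α) (trans (∑-ext (upTo d) (λ t → trans (ℚ.*-identityˡ _) (trans (ℚ.*-identityˡ _)
           (trans (conv-cong {f = hᵏ (suc t) n} (λ _ → refl) (λ γ → scaled (d ∸ suc t) γ) α)
               (conv-*ʳ (hᵏ (suc t) n) (ι (suc b)) (plethysm b (d ∸ suc t)) α)))))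
           (∑-*ˡ (upTo d) (ι (suc b)) (λ t → conv (hᵏ (suc t) n) (plethysm b (d ∸ suc t)) α))) ⟩
    ι (suc b) * S + ι (suc b) * plethysm b d α
      ≡⟨ trans (sym (ℚ.*-distribˡ-+ (ι (suc b)) S (plethysm b d α)))
          (cong (ι (suc b) *_) (trans (ℚ.+-comm S (plethysm b d α)) (plethysm-complete b d α))) ⟩
    ι (suc b) * plethysm (suc b) d α ∎)
    where
    open ≡-Reasoning
    P = partitionLists d
    ff = fallingFactorial
    r : ℕ → ℚ
    r _ = 1ℚ
    W : ℕ → List ℕ → ℚ
    W c μ = (ι (ff c (length μ)) * weight r μ) * ∏ˢ hᵏ μ n α
    S = ∑ (upTo d) (λ t → conv (hᵏ (suc t) n) (plethysm b (d ∸ suc t)) α)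
    recurrence : ∀ l w q → ι (suc b) * ((ι (ff (suc b) l) * w) * q) ≡ ι l * ((ι (ff (suc b) l) * w) * q) + ι (suc b) *
        ((ι (ff b l) * w) * q)
    recurrence l w q = begin
      ι (suc b) * ((ι (ff (suc b) l) * w) * q)
        ≡⟨ pull (ι (suc b)) (ι (ff (suc b) l)) ⟩
      (ι (suc b) * ι (ff (suc b) l)) * (w * q)
        ≡⟨ cong (_* (w * q)) (trans (sym (ι-* (suc b) (ff (suc b) l))) (trans (cong ι (fallingFactorial-suc b l))
             (trans (ι-+ (l ℕ.* ff (suc b) l) (suc b ℕ.* ff b l))
                 (cong₂ _+_ (ι-* l (ff (suc b) l)) (ι-* (suc b) (ff b l)))))) ⟩
      (ι l * ι (ff (suc b) l) + ι (suc b) * ι (ff b l)) * (w * q)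
        ≡⟨ ℚ.*-distribʳ-+ (w * q) (ι l * ι (ff (suc b) l)) (ι (suc b) * ι (ff b l)) ⟩
      (ι l * ι (ff (suc b) l)) * (w * q) + (ι (suc b) * ι (ff b l)) * (w * q)
        ≡⟨ cong₂ _+_ (sym (pull (ι l) (ι (ff (suc b) l)))) (sym (pull (ι (suc b)) (ι (ff b l)))) ⟩
      ι l * ((ι (ff (suc b) l) * w) * q) + ι (suc b) * ((ι (ff b l) * w) * q) ∎
      where
      pull : ∀ x y → x * ((y * w) * q) ≡ (x * y) * (w * q)
      pull x y = trans (cong (x *_) (ℚ.*-assoc y w q)) (sym (ℚ.*-assoc x y (w * q)))
    -- Once the marked part is gone, F(b + 1, l + 1) = (b + 1) F(b, l) leads back to b.
    scaled : ∀ c (γ : Vec ℕ n) → generating (ι ∘ ff (suc b) ∘ suc) r hᵏ c n γ ≡ ι (suc b) * plethysm b c γ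
    scaled c γ = trans (∑-ext (partitionLists c) (λ μ → trans
        (cong (λ t → (t * weight r μ) * ∏ˢ hᵏ μ n γ) (ι-* (suc b) (ff b (length μ))))
        (trans (cong (_* ∏ˢ hᵏ μ n γ) (ℚ.*-assoc (ι (suc b)) (ι (ff b (length μ))) (weight r μ)))
            (ℚ.*-assoc (ι (suc b)) (ι (ff b (length μ)) * weight r μ) (∏ˢ hᵏ μ n γ)))))
      (trans (∑-*ˡ (partitionLists c) (ι (suc b)) (λ μ → (ι (ff b (length μ)) * weight r μ) * ∏ˢ hᵏ μ n γ))
          (cong (ι (suc b) *_) (generating-h b c n γ)))

  product-update : ∀ {f g : ℕ → ℕ} c {k} M → k < M → f k ≡ c ℕ.* g k → (∀ i → i ≢ k → f i ≡ g i) →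
    product (applyUpTo f M) ≡ c ℕ.* product (applyUpTo g M)
  product-update {f} {g} c {zero} (suc M) _ eq same = trans (cong₂ ℕ._*_ eq (rest M (λ i → same (suc i) (λ ()))))
      (ℕ.*-assoc c (g 0) _)
    where
    rest : ∀ M {f g : ℕ → ℕ} → (∀ i → f i ≡ g i) → product (applyUpTo f M) ≡ product (applyUpTo g M)
    rest zero    eq = refl
    rest (suc M) eq = cong₂ ℕ._*_ (eq 0) (rest M (eq ∘ suc))
  product-update {f} {g} c {suc k} (suc M) (s≤s k<M) eq same = trans
    (cong₂ ℕ._*_ (same 0 (λ ())) (product-update c M k<M eq (λ i ne → same (suc i) (ne ∘ ℕ.suc-injective))))
    (trans (sym (ℕ.*-assoc (g 0) c R)) (trans (cong (ℕ._* R) (ℕ.*-comm (g 0) c)) (ℕ.*-assoc c (g 0) R)))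
    where R = product (applyUpTo (g ∘ suc) M)

-- The coefficients of the three expansions and the character values

module Coefficients where

  open RationalSums
  open PartitionLists
  open FixedPaths using (χ-cycles)
  open Rotations using (∑-parking)
  open Plethysm
  open AddingParts
  open GeneratingFunctions
  open SchurExpansion using (schur-expansion)
  open import Data.Integer.Base using (+_; _⊖_)
  open import Data.Nat.Base using (ℕ; zero; suc; _∸_; _^_; _!; _≤_; _<_; z≤n; s≤s; NonZero)
  open import Data.Rational.Base using (ℚ; 1ℚ; _/_; _*_; _+_)

  private variable
    n : ℕ

  zᴸ : ℕ → List ℕ → ℕ
  zᴸ M μ = product (applyUpTo (λ i → suc i ^ mult μ (suc i) ℕ.* mult μ (suc i) !) M)

  zᴸ-[] : ∀ M → zᴸ M [] ≡ 1
  zᴸ-[] = ones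
    where
    ones : ∀ M → product (applyUpTo (λ _ → 1) M) ≡ 1
    ones zero    = refl
    ones (suc M) = trans (ℕ.+-identityʳ _) (ones M)

  -- A new part j replaces j^m m! by j^(m+1) (m+1)! and leaves the other factors alone.
  zᴸ-∷ : ∀ {M} k μ → k < M → zᴸ M (suc k ∷ μ) ≡ (suc k ℕ.* suc (mult μ (suc k))) ℕ.* zᴸ M μ
  zᴸ-∷ {M} k μ k<M = product-update (suc k ℕ.* suc (mult μ (suc k))) M k<M
    (trans (cong (λ t → suc k ^ t ℕ.* t !) (mult-here (suc k) μ))
        (lemma (suc k) (suc k ^ mult μ (suc k)) (suc (mult μ (suc k))) (mult μ (suc k) !)))
    (λ i i≢k → cong (λ t → suc i ^ t ℕ.* t !) (mult-there μ (λ eq → i≢k (sym (ℕ.suc-injective eq)))))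
    where
    lemma : ∀ k e m f → (k ℕ.* e) ℕ.* (m ℕ.* f) ≡ (k ℕ.* m) ℕ.* (e ℕ.* f)
    lemma = solve-∀

  weight-z : ∀ b {M} μ → All (1 ≤_) μ → All (_≤ M) μ → weight (powerSumRate b) μ * ι (zᴸ M μ) ≡ ι (b ^ length μ)
  weight-z b {M} [] _ _ = trans (ℚ.*-identityˡ (ι (zᴸ M []))) (cong ι (zᴸ-[] M))
  weight-z b {M} (suc k ∷ μ) (_ ∷ pos) (k<M ∷ bnd) = begin
    ((ι b * 1/ι (suc k)) * (1/ι t * w)) * ι (zᴸ M (suc k ∷ μ))
      ≡⟨ cong (((ι b * 1/ι (suc k)) * (1/ι t * w)) *_)
          (trans (cong ι (zᴸ-∷ k μ k<M)) (trans (ι-* (suc k ℕ.* t) (zᴸ M μ)) (cong (_* ι (zᴸ M μ)) (ι-* (suc k) t)))) ⟩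
    ((ι b * 1/ι (suc k)) * (1/ι t * w)) * ((ι (suc k) * ι t) * ι (zᴸ M μ))
      ≡⟨ solve 7 (λ b u v w x y z → ((b :* u) :* (v :* w)) :* ((x :* y) :* z) := (u :* x) :*
          ((v :* y) :* (b :* (w :* z)))) refl
           (ι b) (1/ι (suc k)) (1/ι t) w (ι (suc k)) (ι t) (ι (zᴸ M μ)) ⟩
    (1/ι (suc k) * ι (suc k)) * ((1/ι t * ι t) * (ι b * (w * ι (zᴸ M μ))))
      ≡⟨ cong₂ (λ u v → u * (v * (ι b * (w * ι (zᴸ M μ))))) (1/ι-*-ι (suc k)) (1/ι-*-ι t) ⟩
    1ℚ * (1ℚ * (ι b * (w * ι (zᴸ M μ))))
      ≡⟨ trans (ℚ.*-identityˡ (1ℚ * (ι b * (w * ι (zᴸ M μ))))) (ℚ.*-identityˡ (ι b * (w * ι (zᴸ M μ)))) ⟩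
    ι b * (w * ι (zᴸ M μ))
      ≡⟨ cong (ι b *_) (weight-z b μ pos bnd) ⟩
    ι b * ι (b ^ length μ)
      ≡⟨ sym (ι-* b (b ^ length μ)) ⟩
    ι (b ^ suc (length μ)) ∎
    where
    open ≡-Reasoning
    open +-*-Solver
    t : ℕ
    t = suc (mult μ (suc k))
    w : ℚ
    w = weight (powerSumRate b) μ

  parts-≤ : ∀ {d} (μ : Partition d) → All (_≤ d) (parts μ)
  parts-≤ (μ , isPartition refl _ _) = All.tabulate part≤sum

  1/z : ∀ {d} → Partition d → ℚ
  1/z μ = 1/ι (z μ) {{z≢0 μ}}

  /z-1/z : ∀ {d} k (μ : Partition d) → + k /z μ ≡ ι k * 1/z μ
  /z-1/z k μ = /≡ι*1/ k (z μ) {{z≢0 μ}}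

  weight-1/z : ∀ b {d} (μ : Partition d) → weight (powerSumRate b) (parts μ) ≡ ι (b ^ ℓ μ) * 1/z μ
  weight-1/z b {d} μ@(_ , isPartition _ pos _) = begin
    w                              ≡⟨ sym (ℚ.*-identityʳ w) ⟩
    w * 1ℚ                         ≡⟨ cong (w *_) (sym (trans (ℚ.*-comm (ι (z μ)) (1/z μ)) (1/ι-*-ι (z μ) {{z≢0 μ}}))) ⟩
    w * (ι (z μ) * 1/z μ)          ≡⟨ sym (ℚ.*-assoc w (ι (z μ)) (1/z μ)) ⟩
    (w * ι (z μ)) * 1/z μ          ≡⟨ cong (_* 1/z μ) (weight-z b (parts μ) pos (parts-≤ μ)) ⟩
    ι (b ^ ℓ μ) * 1/z μ            ∎
    where
    open ≡-Reasoning
    w : ℚ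
    w = weight (powerSumRate b) (parts μ)

  1/! : ℕ → ℚ
  1/! k = 1/ + k !

  1/!-suc : ∀ k → 1/! (suc k) ≡ 1/ι (suc k) * 1/! k
  1/!-suc k = trans (1/ι-def (suc k !) {{suc k ℕ.!≢0}}) (trans (1/ι-* (suc k) (k !) {{_}} {{k ℕ.!≢0}} {{suc k ℕ.!≢0}})
    (cong (1/ι (suc k) *_) (sym (1/ι-def (k !) {{k ℕ.!≢0}}))))

  1/!-* : ∀ k → 1/! k * ι (k !) ≡ 1ℚ
  1/!-* k = trans (cong (_* ι (k !)) (1/ι-def (k !) {{k ℕ.!≢0}})) (1/ι-*-ι (k !) {{k ℕ.!≢0}})

  -- The fold inside `multinomial`, with its start value q left open.
  ∏1/! : (ℕ → ℕ) → ℕ → ℚ → ℚ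
  ∏1/! g M q = foldr (λ k q → 1/ k ! * q) q (applyUpTo (+_ ∘ g) M)

  ∏1/!-cong : ∀ M q {f g : ℕ → ℕ} → (∀ i → f i ≡ g i) → ∏1/! f M q ≡ ∏1/! g M q
  ∏1/!-cong zero    q eq = refl
  ∏1/!-cong (suc M) q eq = cong₂ (λ k q → 1/! k * q) (eq 0) (∏1/!-cong M q (eq ∘ suc))

  ∏1/!-update : ∀ {f g : ℕ → ℕ} {k} M q → k < M → f k ≡ suc (g k) → (∀ i → i ≢ k → f i ≡ g i) →
    ∏1/! f M q ≡ 1/ι (suc (g k)) * ∏1/! g M q
  ∏1/!-update {f} {g} {zero} (suc M) q _ eq same = trans
      (cong₂ _*_ (trans (cong 1/! eq) (1/!-suc (g 0))) (∏1/!-cong M q (λ i → same (suc i) (λ ()))))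
    (ℚ.*-assoc (1/ι (suc (g 0))) (1/! (g 0)) (∏1/! (g ∘ suc) M q))
  ∏1/!-update {f} {g} {suc k} (suc M) q (s≤s k<M) eq same = trans
    (cong₂ _*_ (cong 1/! (same 0 (λ ()))) (∏1/!-update M q k<M eq (λ i ne → same (suc i) (ne ∘ ℕ.suc-injective))))
    (*-swap (1/! (g 0)) (1/ι (suc (g (suc k)))) (∏1/! (g ∘ suc) M q))

  weight-∏1/! : ∀ {M} q μ → All (1 ≤_) μ → All (_≤ M) μ → ∏1/! (λ i → mult μ (suc i)) M q ≡ weight (λ _ → 1ℚ) μ * q
  weight-∏1/! {M} q [] _ _ = trans (go M) (sym (ℚ.*-identityˡ q))
    where
    go : ∀ M → ∏1/! (λ _ → 0) M q ≡ q
    go zero    = refl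
    go (suc M) = trans (cong (1/! 0 *_) (go M)) (ℚ.*-identityˡ q)
  weight-∏1/! {M} q (suc k ∷ μ) (_ ∷ pos) (k<M ∷ bnd) = begin
    ∏1/! (λ i → mult (suc k ∷ μ) (suc i)) M q
      ≡⟨ ∏1/!-update M q k<M (mult-here (suc k) μ) (λ i i≢k → mult-there μ (λ eq → i≢k (sym (ℕ.suc-injective eq)))) ⟩
    1/ι t * ∏1/! (λ i → mult μ (suc i)) M q
      ≡⟨ cong (1/ι t *_) (weight-∏1/! q μ pos bnd) ⟩
    1/ι t * (weight (λ _ → 1ℚ) μ * q)
      ≡⟨ sym (ℚ.*-assoc (1/ι t) (weight (λ _ → 1ℚ) μ) q) ⟩
    (1/ι t * weight (λ _ → 1ℚ) μ) * q
      ≡⟨ cong (_* q) (sym (ℚ.*-identityˡ (1/ι t * weight (λ _ → 1ℚ) μ))) ⟩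
    (1ℚ * (1/ι t * weight (λ _ → 1ℚ) μ)) * q ∎
    where
    open ≡-Reasoning
    t : ℕ
    t = suc (mult μ (suc k))

  -- For l > b both sides are 0: `b ⊖ l` is negative and `1/_!` vanishes there. This matches the
  -- convention for multinomial coefficients with a negative entry.
  fallingFactorial-! : ∀ b l → 1/ b ⊖ l ! * ι (b !) ≡ ι (fallingFactorial b l)
  fallingFactorial-! b       zero    = trans (1/!-* b) (sym ι-1)
  fallingFactorial-! zero    (suc l) = trans (ℚ.*-zeroˡ (ι (0 !))) (sym ι-0)
  fallingFactorial-! (suc b) (suc l) = begin
    1/ suc b ⊖ suc l ! * ι (suc b !)
      ≡⟨ cong₂ _*_ (cong 1/_! (ℤ.[1+m]⊖[1+n]≡m⊖n b l)) (ι-* (suc b) (b !)) ⟩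
    1/ b ⊖ l ! * (ι (suc b) * ι (b !))
      ≡⟨ *-swap (1/ b ⊖ l !) (ι (suc b)) (ι (b !)) ⟩
    ι (suc b) * (1/ b ⊖ l ! * ι (b !))
      ≡⟨ cong (ι (suc b) *_) (fallingFactorial-! b l) ⟩
    ι (suc b) * ι (fallingFactorial b l)
      ≡⟨ sym (ι-* (suc b) (fallingFactorial b l)) ⟩
    ι (suc b ℕ.* fallingFactorial b l) ∎
    where open ≡-Reasoning

  multinomial-weight : ∀ b {d} (μ : Partition d) →
    multinomial b ((b ⊖ ℓ μ) ∷ applyUpTo (λ i → + m μ (suc i)) d) ≡ ι (fallingFactorial b (ℓ μ)) * weight (λ _ → 1ℚ) (parts μ)
  multinomial-weight b {d} μ@(_ , isPartition _ pos _) = begin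
    1/ b ⊖ ℓ μ ! * ∏1/! (m μ ∘ suc) d (+ (b !) / 1)
      ≡⟨ cong (1/ b ⊖ ℓ μ ! *_) (trans (weight-∏1/! (+ (b !) / 1) (parts μ) pos (parts-≤ μ)) (cong (w *_) (ι-def (b !)))) ⟩
    1/ b ⊖ ℓ μ ! * (w * ι (b !))
      ≡⟨ trans (*-swap (1/ b ⊖ ℓ μ !) w (ι (b !))) (trans (cong (w *_) (fallingFactorial-! b (ℓ μ))) (ℚ.*-comm w _)) ⟩
    ι (fallingFactorial b (ℓ μ)) * w ∎
    where
    open ≡-Reasoning
    w : ℚ
    w = weight (λ _ → 1ℚ) (parts μ)

  ^-pred : ∀ b {l} → 1 ≤ l → b ^ l ≡ b ℕ.* b ^ (l ∸ 1)
  ^-pred b {suc l} _ = refl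

  1≤ℓ : ∀ {a} .{{_ : NonZero a}} (μ : Partition a) → 1 ≤ ℓ μ
  1≤ℓ {a} ([] , isPartition sz _ _)    = contradiction (sym sz) (ℕ.≢-nonZero⁻¹ a)
  1≤ℓ     (_ ∷ _ , _)                  = s≤s z≤n

  χ-ofCycleType : ∀ {a b} .{{_ : NonZero a}} .{{_ : NonZero b}} → Coprime a b → (μ : Partition a) →
    χ[PF a , b ] (ofCycleType μ) ≡ ι (b ^ (ℓ μ ∸ 1))
  -- Matching the sum of the parts with `refl` makes the transport in `ofCycleType` disappear.
  χ-ofCycleType {a} {b} coprime μ@(ps , isPartition refl pos _) = ι-cancelˡ b (begin
    ι b * χ[PF a , b ] (ofCycleType μ)  ≡⟨ cong (ι b *_) (χ-cycles ps pos b) ⟩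
    _                                   ≡⟨ ∑-parking b ps coprime ⟩
    ι (b ^ ℓ μ)                         ≡⟨ cong ι (^-pred b (1≤ℓ μ)) ⟩
    ι (b ℕ.* b ^ (ℓ μ ∸ 1))             ≡⟨ ι-* b (b ^ (ℓ μ ∸ 1)) ⟩
    ι b * ι (b ^ (ℓ μ ∸ 1))             ∎)
    where open ≡-Reasoning

  Frob-PF : ∀ {a b} .{{_ : NonZero a}} .{{_ : NonZero b}} → Coprime a b →
    Frob χ[PF a , b ] ≈ ∑ˢ[ μ ∈ partitions a ] (+ (b ^ (ℓ μ ∸ 1)) /z μ) • p μ
  Frob-PF {a} {b} coprime n α = ∑-ext (partitions a) (λ μ → cong (_* p μ n α) (begin
    χ[PF a , b ] (ofCycleType μ) * (+ 1 /z μ)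
      ≡⟨ cong₂ _*_ (χ-ofCycleType coprime μ) (trans (/z-1/z 1 μ) (trans (cong (_* 1/z μ) ι-1) (ℚ.*-identityˡ (1/z μ)))) ⟩
    ι (b ^ (ℓ μ ∸ 1)) * 1/z μ
      ≡⟨ sym (/z-1/z (b ^ (ℓ μ ∸ 1)) μ) ⟩
    + (b ^ (ℓ μ ∸ 1)) /z μ ∎))
    where open ≡-Reasoning

  -- The coefficient is 1 / b times the weight b^ℓ / z_μ. As a is positive, ℓ ≥ 1 and the truncated
  -- exponent is the true one.
  p-expansion : ∀ a b .{{_ : NonZero a}} .{{_ : NonZero b}} n (α : Vec ℕ n) →
    ∑ (partitions a) (λ μ → (+ (b ^ (ℓ μ ∸ 1)) /z μ) * p μ n α) ≡ 1/ι b * plethysm b a α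
  p-expansion a b n α = begin
    ∑ P (λ μ → (+ (b ^ (ℓ μ ∸ 1)) /z μ) * p μ n α)
      ≡⟨ ∑-ext P (λ μ → sym (trans (cong (λ t → 1/ι b * ((1ℚ * t) * p μ n α)) (weight-p μ))
          (cancel (+ (b ^ (ℓ μ ∸ 1)) /z μ) (p μ n α)))) ⟩
    ∑ P (λ μ → 1/ι b * ((1ℚ * weight (powerSumRate b) (parts μ)) * p μ n α))
      ≡⟨ ∑-*ˡ P (1/ι b) (λ μ → (1ℚ * weight (powerSumRate b) (parts μ)) * p μ n α) ⟩
    1/ι b * ∑ P (λ μ → (1ℚ * weight (powerSumRate b) (parts μ)) * p μ n α)
      ≡⟨ cong (1/ι b *_) (trans (∑-partitions a (λ μ → (1ℚ * weight (powerSumRate b) μ) * ∏ˢ pᵏ μ n α))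
          (generating-p b a a ℕ.≤-refl n α)) ⟩
    1/ι b * plethysm b a α ∎
    where
    open ≡-Reasoning
    P = partitions a
    cancel : ∀ q r → 1/ι b * ((1ℚ * (ι b * q)) * r) ≡ q * r
    cancel q r = trans (cong (λ t → 1/ι b * (t * r)) (ℚ.*-identityˡ (ι b * q)))
      (trans (cong (1/ι b *_) (ℚ.*-assoc (ι b) q r)) (1/ι-*-ι-* b (q * r)))
    weight-p : ∀ (μ : Partition a) → weight (powerSumRate b) (parts μ) ≡ ι b * (+ (b ^ (ℓ μ ∸ 1)) /z μ)
    weight-p μ = trans (weight-1/z b μ) (trans (cong (_* 1/z μ) (trans (cong ι (^-pred b (1≤ℓ μ))) (ι-* b (b ^ (ℓ μ ∸ 1)))))
      (trans (ℚ.*-assoc (ι b) (ι (b ^ (ℓ μ ∸ 1))) (1/z μ)) (cong (ι b *_) (sym (/z-1/z (b ^ (ℓ μ ∸ 1)) μ)))))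

  h-expansion : ∀ a b .{{_ : NonZero b}} n (α : Vec ℕ n) →
    ∑ (partitions a) (λ μ → ((+ 1 / b) * multinomial b ((b ⊖ ℓ μ) ∷ applyUpTo (λ i → + m μ (suc i)) a)) * h μ n α)
      ≡ 1/ι b * plethysm b a α
  h-expansion a b n α = begin
    ∑ P (λ μ → ((+ 1 / b) * multinomial b ((b ⊖ ℓ μ) ∷ applyUpTo (λ i → + m μ (suc i)) a)) * h μ n α)
      ≡⟨ ∑-ext P (λ μ → trans (cong₂ (λ u v → (u * v) * h μ n α) (1/ι-def b) (multinomial-weight b μ))
           (ℚ.*-assoc (1/ι b) (ι (fallingFactorial b (ℓ μ)) * weight (λ _ → 1ℚ) (parts μ)) (h μ n α))) ⟩
    ∑ P (λ μ → 1/ι b * ((ι (fallingFactorial b (ℓ μ)) * weight (λ _ → 1ℚ) (parts μ)) * h μ n α))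
      ≡⟨ ∑-*ˡ P (1/ι b) (λ μ → (ι (fallingFactorial b (ℓ μ)) * weight (λ _ → 1ℚ) (parts μ)) * h μ n α) ⟩
    1/ι b * ∑ P (λ μ → (ι (fallingFactorial b (ℓ μ)) * weight (λ _ → 1ℚ) (parts μ)) * h μ n α)
      ≡⟨ cong (1/ι b *_) (trans (∑-partitions a
          (λ μ → (ι (fallingFactorial b (length μ)) * weight (λ _ → 1ℚ) μ) * ∏ˢ hᵏ μ n α)) (generating-h b a n α)) ⟩
    1/ι b * plethysm b a α ∎
    where
    open ≡-Reasoning
    P = partitions a

  s-expansion : ∀ a b .{{_ : NonZero b}} n (α : Vec ℕ n) →
    ∑ (partitions a) (λ μ → (s[1^ b ] μ * (+ 1 / b)) * s μ n α) ≡ 1/ι b * plethysm b a α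
  s-expansion a b n α = trans (schur-expansion a b (+ 1 / b) n α) (cong (_* plethysm b a α) (1/ι-def b))

open Coefficients using (Frob-PF; p-expansion; h-expansion; s-expansion)
open import Data.Integer.Base using (+_; _⊖_)
open import Data.Nat.Base using (ℕ; suc; _∸_; _^_; NonZero)
open import Data.Rational.Base using (_/_; _*_)

theorem3 : (a b : ℕ) .{{_ : NonZero a}} .{{_ : NonZero b}} → Coprime a b →
    (Frob χ[PF a , b ] ≈
    ∑ˢ[ μ ∈ partitions a ]
    ((+ 1 / b) * multinomial b ((b ⊖ ℓ μ) ∷ applyUpTo (λ i → + m μ (suc i)) a)) • h μ)
    × (Frob χ[PF a , b ] ≈
    ∑ˢ[ μ ∈ partitions a ] (+ (b ^ (ℓ μ ∸ 1)) /z μ) • p μ)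
    × (Frob χ[PF a , b ] ≈
    ∑ˢ[ μ ∈ partitions a ] (s[1^ b ] μ * (+ 1 / b)) • s μ)
theorem3 a b coprime =
  (λ n α → trans (Frob≡ n α) (sym (h-expansion a b n α))) ,
  Frob-PF coprime ,
  (λ n α → trans (Frob≡ n α) (sym (s-expansion a b n α)))
  where
  Frob≡ : ∀ n α → Frob χ[PF a , b ] n α ≡ _
  Frob≡ n α = trans (Frob-PF coprime n α) (p-expansion a b n α)
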